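{- Let $\mathbb{K}_0$ be a proper sub-division ring of the division ring $\mathbb{K}$, and let $\Gamma(\mathbb{K})$ be one of $\mathrm{Gr}_{1,n}(A_n(\mathbb{K}))$ ($n\ge 3$), $\mathrm{Gr}_{1,- }(D_n(\mathbb{K}))$ ($n\ge4$), $\mathrm{Gr}_{1,+,- }(D_n(\mathbb{K}))$ ($n\ge4$) or $\mathrm{Gr}_{+,- }(D_n(\mathbb{K}))$ ($n\ge3$), with $\mathbb{K}$ a field in the $D_n$ cases. Then the set $\Omega_{\mathbb{K}_0}(\Gamma(\mathbb{K}))$ of nearly $\mathbb{K}_0$-rational points of $\Gamma(\mathbb{K})$ is a proper subspace of $\Gamma(\mathbb{K})$.
   Context: Building $A_n(\mathbb{K})$ ($X_n=A_n$): elements are the subspaces of dimension $1,\dots,n$ of an $(n+1)$-dimensional right $\mathbb{K}$-vector space $V$ with fixed basis $E$ (type = dimension), incidence is symmetrized inclusion; diagram: path $1-\cdots-n$. Building $D_n(\mathbb{K})$ ($X_n=D_n$): $V$ is $2n$-dimensional over the field $\mathbb{K}$ with basis $E=(e_1,\dots,e_{2n})$ and quadratic form $q=x_1x_2+\dots+x_{2n-1}x_{2n}$; the $n$-dimensional totally singular subspaces split into classes $\mathfrak S^{+},\mathfrak S^-$ ($X,Y$ in the same class iff $X\cap Y$ has even codimension in $X$). Elements: totally singular subspaces of dimension $i\in\{1,\dots,n-2\}$ (type $i$) and members of $\mathfrak S^\pm$ (type $\pm$); incidence is symmetrized inclusion except $X\in\mathfrak S^+$, $Y\in\mathfrak S^-$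 incident iff $\dim(X\cap Y)=n-1$. Diagram: path $1-\cdots-(n-2)$ with $n-2$ adjacent to $+$ and $-$. A flag is a set of pairwise incident elements. $\mathrm{Gr}_J$ has as points the flags of type $J$ and as lines the flags of type $(J\setminus\{j\})\cup\mathrm{fr}(j)$ ($\mathrm{fr}(j)$ = diagram neighbours of $j$), incidence meaning the union is a flag. A vector is $\mathbb{K}_0$-rational if it is a $\mathbb{K}_0$-combination of $E$; a subspace/element is $\mathbb{K}_0$-rational if it has a basis of $\mathbb{K}_0$-rational vectors. A node $t$ of the diagram splits $J$ if $t\notin J$ and $J$ is not contained in a single connected component of the diagram with $t$ removed. A point $F$ ($J$-flag) of $\Gamma(\mathbb{K})=\mathrm{Gr}_J(X_n(\mathbb{K}))$ is nearly $\mathbb{K}_0$-rational if at least one element of $F$ is $\mathbb{K}_0$-rational, or there is a $\mathbb{K}_0$-rational element of $X_n(\mathbb{K})$ incident with all elements of $F$ whose type splits $J$. A subspace of a point-line geometry is a set of points containing all points of every line meeting it in at least two points; it is proper if it is not the whole point set. -}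

module Defs where

open import Level using (Level; _⊔_) renaming (suc to lsuc)
open import Algebra.Bundles using (Ring)
open import Data.Nat as ℕ using (ℕ; zero; suc; _∸_)
open import Data.Fin using (Fin; toℕ) renaming (zero to fzero; suc to fsuc)
open import Data.Product using (Σ; _×_; _,_; proj₁; proj₂)
open import Data.Sum using (_⊎_)
open import Data.Unit using (⊤)
open import Data.Empty using (⊥)
open import Relation.Nullary using (¬_)
open import Relation.Binary.PropositionalEquality using (_≡_)

record DivisionRing (c ℓ : Level) : Set (lsuc (c ⊔ ℓ)) where
  field
    ring : Ring c ℓ
  open Ring ring public
  field
    0≉1     : ¬ (0# ≈ 1#)
    inverse : ∀ x → ¬ (x ≈ 0#) → Σ Carrier λ y → (x * y ≈ 1#) × (y * x ≈ 1#)

IsCommutative : ∀ {c ℓ} → DivisionRing c ℓ → Set (c ⊔ ℓ)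
IsCommutative K = ∀ x y → x * y ≈ y * x
  where open DivisionRing K

record SubDivisionRing {c ℓ} (K : DivisionRing c ℓ) (p : Level) : Set (c ⊔ ℓ ⊔ lsuc p) where
  open DivisionRing K
  field
    In   : Carrier → Set p
    resp : ∀ {x y} → x ≈ y → In x → In y
    0∈   : In 0#
    1∈   : In 1#
    +∈   : ∀ {x y} → In x → In y → In (x + y)
    -∈   : ∀ {x} → In x → In (- x)
    *∈   : ∀ {x y} → In x → In y → In (x * y)
    inv∈ : ∀ {x y} → In x → x * y ≈ 1# → y * x ≈ 1# → In y

IsProper : ∀ {c ℓ p} {K : DivisionRing c ℓ} → SubDivisionRing K p → Set (c ⊔ p)
IsProper {K = K} K₀ = Σ (DivisionRing.Carrier K) λ x → ¬ SubDivisionRing.In K₀ x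

record Geometry (e r : Level) : Set (lsuc (e ⊔ r)) where
  field
    Ty   : Set
    Adj  : Ty → Ty → Set
    Elem : Ty → Set e
    EqE  : ∀ {t} → Elem t → Elem t → Set e
    Inc  : ∀ {s t} → Elem s → Elem t → Set e
    Rat  : ∀ {t} → Elem t → Set r

record PLGeometry (a : Level) : Set (lsuc a) where
  field
    Pt   : Set a
    Ln   : Set a
    _≈P_ : Pt → Pt → Set a
    _I_  : Pt → Ln → Set a

module _ {a : Level} (Γ : PLGeometry a) where
  open PLGeometry Γ

  IsSubspace : ∀ {b} → (Pt → Set b) → Set (a ⊔ b)
  IsSubspace S = ∀ (L : Ln) (x y z : Pt) → x I L → y I L → z I L →
                 ¬ (x ≈P y) → S x → S y → S z

  IsProperSubspace : ∀ {b} → (Pt → Set b) → Set (a ⊔ b)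
  IsProperSubspace S = IsSubspace S × Σ Pt λ x → ¬ S x

module GeometryDefs {e r : Level} (G : Geometry e r) where
  open Geometry G

  Flag : (Ty → Set) → Set e
  Flag J = Σ ((t : Ty) → J t → Elem t) λ F →
             ∀ s t (p : J s) (q : J t) → Inc (F s p) (F t q)

  LineType : (Ty → Set) → Ty → Ty → Set
  LineType J j t = (J t × ¬ (t ≡ j)) ⊎ Adj j t

  -- Gr_J : points are J-flags, lines are flags of type (J\{j}) ∪ fr(j)
  -- (j ∈ J), incidence meaning the union is a flag
  Gr : (Ty → Set) → PLGeometry e
  Gr J = record
    { Pt   = Flag J
    ; Ln   = Σ Ty λ j → J j × Flag (LineType J j)
    ; _≈P_ = λ F F' → ∀ t (p : J t) → EqE (proj₁ F t p) (proj₁ F' t p)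
    ; _I_  = λ F L → ∀ s t (p : J s) (q : LineType J (proj₁ L) t) →
                       Inc (proj₁ F s p) (proj₁ (proj₂ (proj₂ L)) t q)
    }

  data Reach (t : Ty) : Ty → Ty → Set where
    here : ∀ {a} → ¬ (a ≡ t) → Reach t a a
    step : ∀ {a b c} → ¬ (a ≡ t) → Adj a b → Reach t b c → Reach t a c

  Splits : (Ty → Set) → Ty → Set
  Splits J t = ¬ (J t) × ¬ (Σ Ty λ c → ¬ (c ≡ t) × (∀ a → J a → Reach t c a))

  NearlyRational : (J : Ty → Set) → Flag J → Set (e ⊔ r)
  NearlyRational J F =
      (Σ Ty λ t → Σ (J t) λ p → Rat (proj₁ F t p))
    ⊎ (Σ Ty λ t → Splits J t × Σ (Elem t) λ x →
          Rat x × (∀ s (p : J s) → Inc x (proj₁ F s p)))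

  OmegaProperSubspace : (Ty → Set) → Set (e ⊔ r)
  OmegaProperSubspace J = IsProperSubspace (Gr J) (NearlyRational J)

-- Linear algebra over a division ring: right vector space K^I with
-- standard basis, subspaces given by bases (independent frames)

module LinAlg {c ℓ p} (K : DivisionRing c ℓ) (K₀ : SubDivisionRing K p) where
  open DivisionRing K
  open SubDivisionRing K₀ using (In)

  ∑ : ∀ {d} → (Fin d → Carrier) → Carrier
  ∑ {zero}  f = 0#
  ∑ {suc d} f = f fzero + ∑ (λ k → f (fsuc k))

  Vect : Set → Set c
  Vect I = I → Carrier

  _≈v_ : ∀ {I} → Vect I → Vect I → Set ℓ
  u ≈v v = ∀ i → u i ≈ v i

  zeroV : ∀ {I} → Vect I
  zeroV _ = 0#

  Frame : ℕ → Set → Set c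
  Frame d I = Fin d → Vect I

  lincomb : ∀ {d I} → Frame d I → (Fin d → Carrier) → Vect I
  lincomb B γ i = ∑ (λ k → B k i * γ k)

  InSpan : ∀ {d I} → Frame d I → Vect I → Set (c ⊔ ℓ)
  InSpan B v = Σ (_ → Carrier) λ γ → lincomb B γ ≈v v

  Indep : ∀ {d I} → Frame d I → Set (c ⊔ ℓ)
  Indep B = ∀ γ → lincomb B γ ≈v zeroV → ∀ k → γ k ≈ 0#

  _⊑_ : ∀ {d d' I} → Frame d I → Frame d' I → Set (c ⊔ ℓ)
  B ⊑ B' = ∀ k → InSpan B' (B k)

  SameSpan : ∀ {d d' I} → Frame d I → Frame d' I → Set (c ⊔ ℓ)
  SameSpan B B' = (B ⊑ B') × (B' ⊑ B)

  SymIncl : ∀ {d d' I} → Frame d I → Frame d' I → Set (c ⊔ ℓ)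
  SymIncl B B' = (B ⊑ B') ⊎ (B' ⊑ B)

  IntDim : ∀ {d d' I} → Frame d I → Frame d' I → ℕ → Set (c ⊔ ℓ)
  IntDim X Y m = Σ (Frame m _) λ C → Indep C ×
                   (∀ k → InSpan X (C k) × InSpan Y (C k)) ×
                   (∀ v → InSpan X v → InSpan Y v → InSpan C v)

  -- K₀-rational vector: a K₀-combination of the standard basis E,
  -- i.e. all coordinates lie in K₀
  RatVec : ∀ {I} → Vect I → Set p
  RatVec v = ∀ i → In (v i)

  RatSpace : ∀ {d I} → Frame d I → Set (c ⊔ ℓ ⊔ p)
  RatSpace {d} {I} B = Σ (Frame d I) λ B' → Indep B' × SameSpan B B' × (∀ k → RatVec (B' k))

  -- The building A_n(K): V = K^(n+1); types 1..n encoded by Fin n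
  -- (type i ↦ toℕ i + 1 = dimension)

  AdjPath : ∀ {m} → Fin m → Fin m → Set
  AdjPath i j = (toℕ j ≡ suc (toℕ i)) ⊎ (toℕ i ≡ suc (toℕ j))

  BuildingA : ℕ → Geometry (c ⊔ ℓ) (c ⊔ ℓ ⊔ p)
  BuildingA n = record
    { Ty   = Fin n
    ; Adj  = AdjPath
    ; Elem = λ i → Σ (Frame (suc (toℕ i)) (Fin (suc n))) Indep
    ; EqE  = λ X Y → SameSpan (proj₁ X) (proj₁ Y)
    ; Inc  = λ X Y → SymIncl (proj₁ X) (proj₁ Y)
    ; Rat  = λ X → RatSpace (proj₁ X)
    }

  J-A-1n : (n : ℕ) → Fin n → Set
  J-A-1n n t = (toℕ t ≡ 0) ⊎ (suc (toℕ t) ≡ n)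

  -- The building D_n(K): V = K^(2n), coordinates indexed by Fin n × Fin 2,
  -- (k , 0) ↔ e_(2k+1), (k , 1) ↔ e_(2k+2);  q = Σ_k x_(k,0) x_(k,1)

  VD : ℕ → Set
  VD n = Fin n × Fin 2

  q : ∀ {n} → Vect (VD n) → Carrier
  q x = ∑ (λ k → x (k , fzero) * x (k , fsuc fzero))

  TotSingular : ∀ {d n} → Frame d (VD n) → Set (c ⊔ ℓ)
  TotSingular B = ∀ γ → q (lincomb B γ) ≈ 0#

  -- reference maximal totally singular subspace ⟨e_1, e_3, …, e_(2n-1)⟩
  X₀ : ∀ n → Frame n (VD n)
  X₀ n k (k' , fzero) with Data.Fin._≟_ k k'
  ... | Relation.Nullary.yes _ = 1#
  ... | Relation.Nullary.no  _ = 0#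
  X₀ n k (k' , fsuc _) = 0#

  Even Odd : ℕ → Set
  Even m = Σ ℕ λ h → m ≡ h ℕ.+ h
  Odd  m = Σ ℕ λ h → m ≡ suc (h ℕ.+ h)

  -- the two classes 𝔖⁺ (containing X₀) and 𝔖⁻ of n-dimensional totally
  -- singular subspaces: X ∈ 𝔖⁺ iff X ∩ X₀ has even codimension in X
  ClassPlus ClassMinus : ∀ n → Frame n (VD n) → Set (c ⊔ ℓ)
  ClassPlus  n X = Σ ℕ λ m → IntDim X (X₀ n) m × Even (n ∸ m)
  ClassMinus n X = Σ ℕ λ m → IntDim X (X₀ n) m × Odd  (n ∸ m)

  -- types: sing i (i : Fin (n-2)) is type toℕ i + 1; plus = +, minus = −
  data DType (n : ℕ) : Set where
    sing  : Fin (n ∸ 2) → DType n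
    plus  : DType n
    minus : DType n

  dimD : ∀ {n} → DType n → ℕ
  dimD (sing i) = suc (toℕ i)
  dimD {n} plus  = n
  dimD {n} minus = n

  ClassD : ∀ {n} (t : DType n) → Frame (dimD t) (VD n) → Set (c ⊔ ℓ)
  ClassD (sing i)  X = Level.Lift (c ⊔ ℓ) ⊤
  ClassD {n} plus  X = ClassPlus n X
  ClassD {n} minus X = ClassMinus n X

  AdjD : ∀ {n} → DType n → DType n → Set
  AdjD (sing i) (sing j) = AdjPath i j
  AdjD {n} (sing i) plus  = suc (toℕ i) ≡ n ∸ 2
  AdjD {n} (sing i) minus = suc (toℕ i) ≡ n ∸ 2
  AdjD {n} plus  (sing j) = suc (toℕ j) ≡ n ∸ 2
  AdjD {n} minus (sing j) = suc (toℕ j) ≡ n ∸ 2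
  AdjD plus  plus  = ⊥
  AdjD plus  minus = ⊥
  AdjD minus plus  = ⊥
  AdjD minus minus = ⊥

  ElemD : ∀ n → DType n → Set (c ⊔ ℓ)
  ElemD n t = Σ (Frame (dimD t) (VD n)) λ X → Indep X × TotSingular X × ClassD t X

  IncD : ∀ {n} (s t : DType n) → Frame (dimD s) (VD n) → Frame (dimD t) (VD n) → Set (c ⊔ ℓ)
  IncD {n} plus  minus X Y = IntDim X Y (n ∸ 1)
  IncD {n} minus plus  X Y = IntDim X Y (n ∸ 1)
  IncD s t X Y = SymIncl X Y

  BuildingD : ℕ → Geometry (c ⊔ ℓ) (c ⊔ ℓ ⊔ p)
  BuildingD n = record
    { Ty   = DType n
    ; Adj  = AdjD
    ; Elem = ElemD n
    ; EqE  = λ X Y → SameSpan (proj₁ X) (proj₁ Y)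
    ; Inc  = λ {s} {t} X Y → IncD s t (proj₁ X) (proj₁ Y)
    ; Rat  = λ X → RatSpace (proj₁ X)
    }

  IsType1 : ∀ {n} → DType n → Set
  IsType1 (sing i) = toℕ i ≡ 0
  IsType1 plus     = ⊥
  IsType1 minus    = ⊥

  J-D-1m J-D-1pm J-D-pm : ∀ n → DType n → Set
  J-D-1m  n t = IsType1 t ⊎ (t ≡ minus)
  J-D-1pm n t = IsType1 t ⊎ (t ≡ plus) ⊎ (t ≡ minus)
  J-D-pm  n t = (t ≡ plus) ⊎ (t ≡ minus)

-- A vector v can be written as Σ w_j b_j with w_j rational and the scalars b_j left independent over K₀; every
-- subspace spanned by rational vectors that contains v then contains all w_j (Decomposition, hull). So, writing RS(P)
-- for the span of the rational vectors of P, one has RS(P) ∩ RS(Q) ⊆ RS(P ∩ Q).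
--
-- A flag (p, H) of type {1,n} in A_n is nearly rational iff p ∈ RS(H). If p moves on a line, linearity of RS(H)
-- gives the subspace property; if H moves, then W = H₁ ∩ H₂ is the intersection of all hyperplanes of the line and
-- p ∈ RS(H₁) ∩ RS(H₂) ⊆ RS(W). In D_n a maximal totally singular subspace that contains a rational hyperplane is
-- itself rational, so types {1,-} and {1,+,-} have similar descriptions, and two members of one class containing a
-- subspace W of dimension n-2 are equal or meet in W (parity). For {+,-}, a rational vector of O outside a rational
-- neighbour Y of O makes O rational.
--
-- With x ∉ K₀, the point e₁ + e₄ x (e₁ + e₂ x in A_n) lies in a subspace that contains neither e₁ nor e₄ (e₂), and
-- since 1 and x are left independent over K₀ it is not in the span of the rational vectors of that subspace.

module Submission where

open import Defs
open import Level using (Level; _⊔_; Lift; lift; lower)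
open import Algebra.Bundles using (CommutativeSemiring)
import Algebra.Properties.Ring as RingProperties
import Algebra.Properties.Semiring.Sum as SemiringSums
import Algebra.Solver.Ring.NaturalCoefficients.Default as SemiringSolver
open import Axiom.ExcludedMiddle using (ExcludedMiddle)
open import Data.Bool using (Bool; false)
open import Data.Empty using (⊥; ⊥-elim)
open import Data.Fin using (Fin; toℕ; fromℕ; fromℕ<; inject₁; punchIn; combine; remQuot; _↑ˡ_)
  renaming (zero to fzero; suc to fsuc)
import Data.Fin.Properties as Finₚ
open import Data.Nat as ℕ using (ℕ; zero; suc; _∸_; _≤_; _<_; z≤n; s≤s)
import Data.Nat.Properties as ℕₚ
open import Data.Product using (Σ; _×_; _,_; proj₁; proj₂)
open import Data.Sum using (_⊎_; inj₁; inj₂; swap)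
open import Data.Unit using (⊤; tt)
open import Data.Vec.Functional using (_∷_; []; insertAt)
open import Data.Vec.Functional.Properties using (insertAt-lookup; insertAt-punchIn)
open import Function using (_∘_)
open import Function.Bundles using (mk⇔)
import Relation.Binary.Reasoning.Setoid as SetoidReasoning
open import Relation.Binary.PropositionalEquality as ≡ using (_≡_)
open import Relation.Nullary using (¬_; Dec; yes; no; contradiction)
open import Relation.Nullary.Decidable using (does; does-⇔; dec-true; dec-false)

-- Subspaces occur in two forms: as independent frames, since elements are given that way, and as
-- predicates closed under the operations (`Sub`), since perpendiculars, intersections and RS come
-- without a basis. Excluded middle extracts a frame from a predicate (`basis`). The dimension of a
-- basis of RS then selects the clause of near rationality: 1 makes the point rational, the top
-- dimension makes the large element rational, and anything between gives an element of a splitting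
-- type. In D_n this breaks at dimension n - 1, which no element has; rational hyperplanes fill that
-- gap. Their treatment rests on U^⊥/U for U totally singular of dimension n - 1: a hyperbolic plane
-- with exactly two singular points. If U is rational, so are both points: one comes from linear
-- equations over K₀, the other from an equation that is linear in its only unknown. Only node n - 2
-- splits it, so a rational subspace of X ∩ Y counts only if it is large enough, and the line
-- argument becomes a case analysis.

cat : ∀ {a} {A : Set a} {d m} → (Fin d → A) → (Fin m → A) → Fin (d ℕ.+ m) → A
cat {d = zero}  f g = g
cat {d = suc d} f g = f fzero ∷ cat (f ∘ fsuc) g

cat-all : ∀ {a b} {A : Set a} {d m} (P : A → Set b) (f : Fin d → A) (g : Fin m → A) →
          (∀ k → P (f k)) → (∀ k → P (g k)) → ∀ k → P (cat f g k)
cat-all {d = zero}  P f g pf pg k        = pg k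
cat-all {d = suc d} P f g pf pg fzero    = pf fzero
cat-all {d = suc d} P f g pf pg (fsuc k) = cat-all P (f ∘ fsuc) g (pf ∘ fsuc) pg k

cat-↑ˡ : ∀ {a} {A : Set a} {d m} (f : Fin d → A) (g : Fin m → A) k → cat f g (k ↑ˡ m) ≡ f k
cat-↑ˡ f g fzero    = ≡.refl
cat-↑ˡ f g (fsuc k) = cat-↑ˡ (f ∘ fsuc) g k

record Finite (I : Set) : Set where
  field
    size    : ℕ
    enc     : I → Fin size
    dec     : Fin size → I
    dec∘enc : ∀ i → dec (enc i) ≡ i

-- Linear algebra over a division ring, and the span of the rational vectors of a subspace.

module LinearAlgebra {c ℓ p} (K : DivisionRing c ℓ) (K₀ : SubDivisionRing K p)
                     (em : ExcludedMiddle (c ⊔ ℓ ⊔ p)) where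

  open DivisionRing K hiding (zero)
  open SubDivisionRing K₀
  open LinAlg K K₀
  open RingProperties ring
  open SetoidReasoning setoid
  private
    module S = SemiringSums semiring

  dec-ℓ : {P : Set ℓ} → Dec P
  dec-ℓ {P} with em {Lift (c ⊔ p) P}
  ... | yes (lift x) = yes x
  ... | no ¬x        = no (λ x → ¬x (lift x))

  dec-cℓ : {P : Set (c ⊔ ℓ)} → Dec P
  dec-cℓ {P} with em {Lift p P}
  ... | yes (lift x) = yes x
  ... | no ¬x        = no (λ x → ¬x (lift x))

  private
    ∑≡sum : ∀ {d} (f : Fin d → Carrier) → ∑ f ≡ S.sum f
    ∑≡sum {zero}  f = ≡.refl
    ∑≡sum {suc d} f = ≡.cong (f fzero +_) (∑≡sum (f ∘ fsuc))

  ∑-cong : ∀ {d} {f g : Fin d → Carrier} → (∀ k → f k ≈ g k) → ∑ f ≈ ∑ g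
  ∑-cong {zero}  e = refl
  ∑-cong {suc d} e = +-cong (e fzero) (∑-cong (e ∘ fsuc))

  ∑-zero : ∀ {d} {f : Fin d → Carrier} → (∀ k → f k ≈ 0#) → ∑ f ≈ 0#
  ∑-zero {zero}  e = refl
  ∑-zero {suc d} e = trans (+-cong (e fzero) (∑-zero (e ∘ fsuc))) (+-identityˡ 0#)

  ∑-+ : ∀ {d} (f g : Fin d → Carrier) → ∑ (λ k → f k + g k) ≈ ∑ f + ∑ g
  ∑-+ f g rewrite ∑≡sum (λ k → f k + g k) | ∑≡sum f | ∑≡sum g = S.∑-distrib-+ f g

  ∑-*ˡ : ∀ {d} x (f : Fin d → Carrier) → x * ∑ f ≈ ∑ (λ k → x * f k)
  ∑-*ˡ x f rewrite ∑≡sum f | ∑≡sum (λ k → x * f k) = S.*-distribˡ-sum x f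

  ∑-*ʳ : ∀ {d} x (f : Fin d → Carrier) → ∑ f * x ≈ ∑ (λ k → f k * x)
  ∑-*ʳ x f rewrite ∑≡sum f | ∑≡sum (λ k → f k * x) = S.*-distribʳ-sum x f

  ∑-swap : ∀ {d m} (f : Fin d → Fin m → Carrier) →
           ∑ (λ i → ∑ (λ j → f i j)) ≈ ∑ (λ j → ∑ (λ i → f i j))
  ∑-swap {zero} {m} f = sym (∑-zero {m} (λ _ → refl))
  ∑-swap {suc d} f = trans (+-congˡ (∑-swap (f ∘ fsuc))) (sym (∑-+ (f fzero) _))

  ∑-remove : ∀ {d} (i : Fin (suc d)) (f : Fin (suc d) → Carrier) →
             ∑ f ≈ f i + ∑ (f ∘ punchIn i)
  ∑-remove i f rewrite ∑≡sum f | ∑≡sum (f ∘ punchIn i) = S.sum-remove {i = i} f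

  ∑-assoc : ∀ {d m} (b : Fin d → Carrier) (A : Fin d → Fin m → Carrier) (x : Fin m → Carrier) →
            ∑ (λ k → ∑ (λ j → b j * A j k) * x k) ≈ ∑ (λ j → b j * ∑ (λ k → A j k * x k))
  ∑-assoc b A x = begin
    ∑ (λ k → ∑ (λ j → b j * A j k) * x k)      ≈⟨ ∑-cong (λ k → ∑-*ʳ (x k) (λ j → b j * A j k)) ⟩
    ∑ (λ k → ∑ (λ j → b j * A j k * x k))      ≈⟨ ∑-swap (λ k j → b j * A j k * x k) ⟩
    ∑ (λ j → ∑ (λ k → b j * A j k * x k))      ≈⟨ ∑-cong (λ j → ∑-cong (λ k → *-assoc (b j) (A j k) (x k))) ⟩
    ∑ (λ j → ∑ (λ k → b j * (A j k * x k)))    ≈⟨ ∑-cong (λ j → ∑-*ˡ (b j) (λ k → A j k * x k)) ⟨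
    ∑ (λ j → b j * ∑ (λ k → A j k * x k))      ∎

  ∑-in : ∀ {d} {f : Fin d → Carrier} → (∀ k → In (f k)) → In (∑ f)
  ∑-in {zero}  h = 0∈
  ∑-in {suc d} h = +∈ (h fzero) (∑-in (h ∘ fsuc))

  -- Structural recursion lets entries at explicit coordinates compute; the coordinate checks on the
  -- irrational flags rely on this. `X₀-δ` links it to the decidable equality in `X₀`.
  δ : ∀ {d} → Fin d → Fin d → Carrier
  δ fzero    fzero    = 1#
  δ fzero    (fsuc _) = 0#
  δ (fsuc _) fzero    = 0#
  δ (fsuc i) (fsuc j) = δ i j

  ∑-δ : ∀ {d} (i : Fin d) (f : Fin d → Carrier) → ∑ (λ k → δ i k * f k) ≈ f i
  ∑-δ fzero f = trans (+-cong (*-identityˡ _) (∑-zero (λ k → zeroˡ (f (fsuc k))))) (+-identityʳ _)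
  ∑-δ (fsuc i) f = trans (+-cong (zeroˡ _) (∑-δ i (f ∘ fsuc))) (+-identityˡ _)

  δ-in : ∀ {d} (i j : Fin d) → In (δ i j)
  δ-in fzero    fzero    = 1∈
  δ-in fzero    (fsuc _) = 0∈
  δ-in (fsuc _) fzero    = 0∈
  δ-in (fsuc i) (fsuc j) = δ-in i j

  -- Vectors and subspaces

  infixl 6 _+v_
  infixl 7 _·_

  _+v_ : ∀ {I} → Vect I → Vect I → Vect I
  (u +v v) i = u i + v i

  _·_ : ∀ {I} → Vect I → Carrier → Vect I
  (v · a) i = v i * a

  -- One interface for spans, perpendiculars, intersections and RS: `span∈` moves membership from
  -- generators to their span in all of them.
  record Sub {a} {I : Set} (P : Vect I → Set a) : Set (c ⊔ ℓ ⊔ a) where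
    field
      resp-≈ : ∀ {u v} → u ≈v v → P u → P v
      zero∈  : P zeroV
      add∈   : ∀ {u v} → P u → P v → P (u +v v)
      scale∈ : ∀ {v} a → P v → P (v · a)

    lincomb∈ : ∀ {d} {B : Frame d I} → (∀ k → P (B k)) → ∀ γ → P (lincomb B γ)
    lincomb∈ {zero}  h γ = zero∈
    lincomb∈ {suc d} h γ = add∈ (scale∈ (γ fzero) (h fzero)) (lincomb∈ (h ∘ fsuc) (γ ∘ fsuc))

    span∈ : ∀ {d} {B : Frame d I} → (∀ k → P (B k)) → ∀ {v} → InSpan B v → P v
    span∈ h (γ , e) = resp-≈ e (lincomb∈ h γ)

    cancel∈ : ∀ {u w} a → P w → P (u +v w · a) → P u
    cancel∈ {u} {w} a pw h = resp-≈ e (add∈ h (scale∈ (- a) pw))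
      where
      e : ((u +v w · a) +v w · (- a)) ≈v u
      e i = begin
        u i + w i * a + w i * (- a)    ≈⟨ +-assoc _ _ _ ⟩
        u i + (w i * a + w i * (- a))  ≈⟨ +-congˡ (distribˡ (w i) a (- a)) ⟨
        u i + w i * (a + - a)          ≈⟨ +-congˡ (trans (*-congˡ (-‿inverseʳ a)) (zeroʳ (w i))) ⟩
        u i + 0#                       ≈⟨ +-identityʳ (u i) ⟩
        u i                            ∎

    unscale∈ : ∀ {v} a → ¬ (a ≈ 0#) → P (v · a) → P v
    unscale∈ {v} a a≉0 h with inverse a a≉0
    ... | s , as≈1 , _ = resp-≈ (λ i → trans (*-assoc (v i) a s) (trans (*-congˡ as≈1) (*-identityʳ (v i)))) (scale∈ s h)

  open Sub

  Sub-× : ∀ {a b I} {P : Vect I → Set a} {Q : Vect I → Set b} → Sub P → Sub Q → Sub (λ v → P v × Q v)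
  Sub-× p q = record
    { resp-≈ = λ e (x , y) → resp-≈ p e x , resp-≈ q e y
    ; zero∈  = zero∈ p , zero∈ q
    ; add∈   = λ (x , y) (x′ , y′) → add∈ p x x′ , add∈ q y y′
    ; scale∈ = λ a (x , y) → scale∈ p a x , scale∈ q a y
    }

  InSpan-sub : ∀ {d I} (B : Frame d I) → Sub (InSpan B)
  InSpan-sub B = record
    { resp-≈ = λ e (γ , h) → γ , λ i → trans (h i) (e i)
    ; zero∈  = (λ _ → 0#) , λ i → ∑-zero (λ k → zeroʳ (B k i))
    ; add∈   = λ (γ , h) (γ′ , h′) → (λ k → γ k + γ′ k) , λ i →
        trans (∑-cong (λ k → distribˡ (B k i) (γ k) (γ′ k))) (trans (∑-+ (λ k → B k i * γ k) (λ k → B k i * γ′ k)) (+-cong (h i) (h′ i)))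
    ; scale∈ = λ a (γ , h) → (λ k → γ k * a) , λ i →
        trans (∑-cong (λ k → sym (*-assoc (B k i) (γ k) a))) (trans (sym (∑-*ʳ a (λ k → B k i * γ k))) (*-congʳ (h i)))
    }

  weaken : ∀ {d I} {B : Frame (suc d) I} {v} → InSpan (B ∘ fsuc) v → InSpan B v
  weaken {B = B} (γ , h) = (0# ∷ γ) , λ i →
    trans (+-congʳ (zeroʳ (B fzero i))) (trans (+-identityˡ _) (h i))

  gen : ∀ {d I} (B : Frame d I) k → InSpan B (B k)
  gen B fzero = (1# ∷ λ _ → 0#) , λ i →
    trans (+-cong (*-identityʳ _) (∑-zero (λ k → zeroʳ (B (fsuc k) i)))) (+-identityʳ _)
  gen B (fsuc k) = weaken {B = B} (gen (B ∘ fsuc) k)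

  span-mono : ∀ {d m I} {B : Frame d I} {C : Frame m I} → B ⊑ C → ∀ {v} → InSpan B v → InSpan C v
  span-mono {C = C} h = span∈ (InSpan-sub C) h

  SameSpan-refl : ∀ {d I} (B : Frame d I) → SameSpan B B
  SameSpan-refl B = gen B , gen B

  span-cons : ∀ {d I} {x : Vect I} {B : Frame d I} {a} {P : Vect I → Set a} → Sub P →
              P x → (∀ k → P (B k)) → ∀ {v} → InSpan (x ∷ B) v → P v
  span-cons {x = x} {B} {P = P} S px pB = span∈ S h
    where
    h : ∀ k → P ((x ∷ B) k)
    h fzero    = px
    h (fsuc k) = pB k

  indep-∷ : ∀ {d I} {B : Frame d I} {x} → Indep B → ¬ InSpan B x → Indep (x ∷ B)
  indep-∷ {B = B} {x} ind x∉ γ e = λ { fzero → γ₀≈0 ; (fsuc k) → ind (γ ∘ fsuc) rest k }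
    where
    γ₀≈0 : γ fzero ≈ 0#
    γ₀≈0 with dec-ℓ {γ fzero ≈ 0#}
    ... | yes h = h
    ... | no h = contradiction (unscale∈ SB (γ fzero) h (cancel∈ SB 1# (γ ∘ fsuc , λ _ → refl)
                   (resp-≈ SB (λ i → trans (sym (e i)) (+-congˡ (sym (*-identityʳ _)))) (zero∈ SB)))) x∉
      where SB = InSpan-sub B
    rest : lincomb B (γ ∘ fsuc) ≈v zeroV
    rest i = trans (sym (trans (+-congʳ (trans (*-congˡ γ₀≈0) (zeroʳ (x i)))) (+-identityˡ _))) (e i)

  lincomb-cat : ∀ {d m I} (B : Frame d I) (C : Frame m I) γ η →
                lincomb (cat B C) (cat γ η) ≈v (lincomb B γ +v lincomb C η)
  lincomb-cat {zero}  B C γ η i = sym (+-identityˡ _)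
  lincomb-cat {suc d} B C γ η i = trans (+-congˡ (lincomb-cat (B ∘ fsuc) C (γ ∘ fsuc) η i)) (sym (+-assoc _ _ _))

  cat-disjoint : ∀ {d m I} {B : Frame d I} {C : Frame m I} → Indep (cat B C) → ∀ γ → InSpan C (lincomb B γ) → ∀ k → γ k ≈ 0#
  cat-disjoint {B = B} {C} ind γ h with scale∈ (InSpan-sub C) (- 1#) h
  ... | η , e = λ k → trans (reflexive (≡.sym (cat-↑ˡ γ η k))) (ind (cat γ η) (λ i → begin
    lincomb (cat B C) (cat γ η) i          ≈⟨ lincomb-cat B C γ η i ⟩
    lincomb B γ i + lincomb C η i          ≈⟨ +-cong (sym (*-identityʳ _)) (e i) ⟩
    lincomb B γ i * 1# + lincomb B γ i * (- 1#)  ≈⟨ distribˡ _ _ _ ⟨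
    lincomb B γ i * (1# + - 1#)            ≈⟨ trans (*-congˡ (-‿inverseʳ 1#)) (zeroʳ _) ⟩
    0#                                     ∎) _)

  -- Gaussian elimination by induction on the number of equations. Coefficients act from the left: a
  -- zero first row is discarded; otherwise its pivot unknown is removed from the other rows by left
  -- multiplication and recovered by back substitution as `- s * r`.
  solve : ∀ {m d} (A : Fin m → Fin d → Carrier) → m < d →
          Σ (Fin d → Carrier) λ x → ¬ (∀ k → x k ≈ 0#) × (∀ i → ∑ (λ k → A i k * x k) ≈ 0#)
  solve {zero} {suc d} A _ = (λ _ → 1#) , (λ h → 0≉1 (sym (h fzero))) , λ ()
  solve {suc m} {suc d} A (s≤s m<d) with dec-ℓ {∀ k → A fzero k ≈ 0#}
  ... | yes row≈0 with solve (A ∘ fsuc) (ℕₚ.m<n⇒m<1+n m<d)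
  ...   | x , x≉0 , eq = x , x≉0 , λ
          { fzero    → ∑-zero (λ k → trans (*-congʳ (row≈0 k)) (zeroˡ (x k)))
          ; (fsuc i) → eq i }
  solve {suc m} {suc d} A (s≤s m<d) | no row≉0 = x , x≉0 , eq
    where
    pivot : Σ (Fin (suc d)) λ k → ¬ (A fzero k ≈ 0#)
    pivot with Finₚ.¬∀⟶∃¬ (suc d) (λ k → A fzero k ≈ 0#) (λ _ → dec-ℓ) row≉0
    ... | k , h = k , h
    k₀ : Fin (suc d)
    k₀ = proj₁ pivot
    inv : Σ Carrier λ y → (A fzero k₀ * y ≈ 1#) × (y * A fzero k₀ ≈ 1#)
    inv = inverse (A fzero k₀) (proj₂ pivot)
    s : Carrier
    s = proj₁ inv
    A′ : Fin m → Fin d → Carrier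
    A′ i j = A (fsuc i) (punchIn k₀ j) + A (fsuc i) k₀ * (- s * A fzero (punchIn k₀ j))
    sol : Σ (Fin d → Carrier) λ y → ¬ (∀ k → y k ≈ 0#) × (∀ i → ∑ (λ k → A′ i k * y k) ≈ 0#)
    sol = solve A′ m<d
    y : Fin d → Carrier
    y = proj₁ sol
    r : Carrier
    r = ∑ (λ j → A fzero (punchIn k₀ j) * y j)
    x : Fin (suc d) → Carrier
    x = insertAt y k₀ (- s * r)
    x-k₀ : x k₀ ≈ - s * r
    x-k₀ = reflexive (insertAt-lookup y k₀ _)
    x-punch : ∀ j → x (punchIn k₀ j) ≈ y j
    x-punch j = reflexive (insertAt-punchIn y k₀ _ j)
    x≉0 : ¬ (∀ k → x k ≈ 0#)
    x≉0 h = proj₁ (proj₂ sol) (λ j → trans (sym (x-punch j)) (h (punchIn k₀ j)))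
    split : ∀ i → ∑ (λ k → A i k * x k) ≈ A i k₀ * (- s * r) + ∑ (λ j → A i (punchIn k₀ j) * y j)
    split i = trans (∑-remove k₀ (λ k → A i k * x k))
                    (+-cong (*-congˡ x-k₀) (∑-cong (λ j → *-congˡ (x-punch j))))
    eq : ∀ i → ∑ (λ k → A i k * x k) ≈ 0#
    eq fzero = begin
      ∑ (λ k → A fzero k * x k)    ≈⟨ split fzero ⟩
      A fzero k₀ * (- s * r) + r   ≈⟨ +-congʳ (*-assoc _ _ _) ⟨
      A fzero k₀ * (- s) * r + r   ≈⟨ +-congʳ (*-congʳ (-‿distribʳ-* _ _)) ⟨
      - (A fzero k₀ * s) * r + r   ≈⟨ +-congʳ (*-congʳ (-‿cong (proj₁ (proj₂ inv)))) ⟩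
      - 1# * r + r                 ≈⟨ +-congʳ (-1*x≈-x r) ⟩
      - r + r                      ≈⟨ -‿inverseˡ r ⟩
      0#                           ∎
    eq (fsuc i) = begin
      ∑ (λ k → A (fsuc i) k * x k)                           ≈⟨ split (fsuc i) ⟩
      a * (- s * r) + ∑ (λ j → a′ j * y j)                   ≈⟨ +-comm _ _ ⟩
      ∑ (λ j → a′ j * y j) + a * (- s * r)                   ≈⟨ +-congˡ (*-congˡ (trans (∑-*ˡ {d} (- s) _) (∑-cong {d} (λ j → sym (*-assoc (- s) (t j) (y j)))))) ⟩
      ∑ (λ j → a′ j * y j) + a * ∑ (λ j → (- s * t j) * y j)  ≈⟨ +-congˡ (trans (∑-*ˡ {d} a _) (∑-cong {d} (λ j → sym (*-assoc a (- s * t j) (y j))))) ⟩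
      ∑ (λ j → a′ j * y j) + ∑ (λ j → a * (- s * t j) * y j)  ≈⟨ ∑-+ (λ j → a′ j * y j) (λ j → a * (- s * t j) * y j) ⟨
      ∑ (λ j → a′ j * y j + a * (- s * t j) * y j)           ≈⟨ ∑-cong (λ j → distribʳ (y j) (a′ j) (a * (- s * t j))) ⟨
      ∑ (λ j → A′ i j * y j)                                 ≈⟨ proj₂ (proj₂ sol) i ⟩
      0#                                                     ∎
      where
      a = A (fsuc i) k₀
      a′ = λ j → A (fsuc i) (punchIn k₀ j)
      t = λ j → A fzero (punchIn k₀ j)

  -- If d < m, the coordinate matrix of C over B has more columns than rows, and a nonzero solution
  -- of that system is a nontrivial relation among the vectors of C.
  steinitz : ∀ {m d I} {C : Frame m I} {B : Frame d I} → Indep C → C ⊑ B → m ≤ d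
  steinitz {m} {d} {C = C} {B} ind sub = ℕₚ.≮⇒≥ absurd
    where
    absurd : ¬ (d < m)
    absurd d<m with solve (λ j k → proj₁ (sub k) j) d<m
    ... | x , x≉0 , eq = x≉0 (ind x λ i → begin
      ∑ (λ k → C k i * x k)                                   ≈⟨ ∑-cong (λ k → *-congʳ (sym (proj₂ (sub k) i))) ⟩
      ∑ (λ k → ∑ (λ j → B j i * proj₁ (sub k) j) * x k)       ≈⟨ ∑-assoc (λ j → B j i) (λ j k → proj₁ (sub k) j) x ⟩
      ∑ (λ j → B j i * ∑ (λ k → proj₁ (sub k) j * x k))       ≈⟨ ∑-zero (λ j → trans (*-congˡ (eq j)) (zeroʳ _)) ⟩
      0#                                                      ∎)

  span-full : ∀ {m d I} {C : Frame m I} {B : Frame d I} → Indep C → C ⊑ B → d ≤ m → B ⊑ C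
  span-full {C = C} {B} ind sub d≤m k with dec-cℓ {InSpan C (B k)}
  ... | yes h = h
  ... | no h  = contradiction (ℕₚ.≤-trans (s≤s d≤m) (steinitz {C = B k ∷ C} (indep-∷ ind h) λ { fzero → gen B k ; (fsuc j) → sub j })) ℕₚ.1+n≰n

  -- Dimension orients a symmetrized inclusion: if the larger space lies in the smaller one, the two
  -- coincide.
  SymIncl⇒⊑ : ∀ {m d I} {C : Frame m I} {B : Frame d I} → Indep C → Indep B → m ≤ d → SymIncl C B → C ⊑ B
  SymIncl⇒⊑ indC indB m≤d (inj₁ h) = h
  SymIncl⇒⊑ indC indB m≤d (inj₂ h) = span-full indB h m≤d

  SymIncl-sym : ∀ {m d I} {C : Frame m I} {B : Frame d I} → SymIncl C B → SymIncl B C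
  SymIncl-sym (inj₁ h) = inj₂ h
  SymIncl-sym (inj₂ h) = inj₁ h

  module _ {I : Set} (fin : Finite I) where
    open Finite fin

    std : Frame size I
    std k i = δ (enc i) k

    std-spans : ∀ v → InSpan std v
    std-spans v = v ∘ dec , λ i → trans (∑-δ (enc i) (v ∘ dec)) (reflexive (≡.cong v (dec∘enc i)))

    indep-≤ : ∀ {m} {C : Frame m I} → Indep C → m ≤ size
    indep-≤ {C = C} ind = steinitz ind (std-spans ∘ C)

    Extension : ∀ {m} → (Vect I → Set (c ⊔ ℓ ⊔ p)) → Frame m I → Set (c ⊔ ℓ ⊔ p)
    Extension Q C = Σ ℕ λ e → Σ (Frame e I) λ E →
      Indep (cat E C) × (∀ k → Q (E k)) × (∀ v → Q v → InSpan (cat E C) v)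

    opaque
      -- Greedy extension. Q is an arbitrary predicate, for instance "rational and in P", so vectors
      -- of Q outside the current span are added until none remain; the ambient dimension bounds the
      -- number of rounds and serves as fuel.
      extend : ∀ {m} (Q : Vect I → Set (c ⊔ ℓ ⊔ p)) (C : Frame m I) → Indep C → Extension Q C
      extend {m} Q C indC = go size zero [] (ℕₚ.m≤m+n size m) indC λ ()
        where
        go : ∀ fuel e (E : Frame e I) → size ≤ fuel ℕ.+ (e ℕ.+ m) → Indep (cat E C) → (∀ k → Q (E k)) → Extension Q C
        go fuel e E bound ind QE with em {Σ (Vect I) λ v → Q v × ¬ InSpan (cat E C) v}
        go fuel e E bound ind QE | no none = e , E , ind , QE , all
          where
          all : ∀ v → Q v → InSpan (cat E C) v
          all v Qv with dec-cℓ {InSpan (cat E C) v}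
          ... | yes h = h
          ... | no h  = contradiction (v , Qv , h) none
        go zero e E bound ind QE | yes (v , Qv , v∉) =
          contradiction (ℕₚ.≤-trans (indep-≤ {C = v ∷ cat E C} (indep-∷ ind v∉)) bound) ℕₚ.1+n≰n
        go (suc fuel) e E bound ind QE | yes (v , Qv , v∉) =
          -- `cat (v ∷ E) C` unfolds to `v ∷ cat E C`, so `indep-∷` has the required type as it
          -- stands.
          go fuel (suc e) (v ∷ E) (ℕₚ.≤-trans bound (ℕₚ.≤-reflexive (≡.sym (ℕₚ.+-suc fuel (e ℕ.+ m)))))
             (indep-∷ ind v∉) λ { fzero → Qv ; (fsuc k) → QE k }

    opaque
      basis : (Q : Vect I → Set (c ⊔ ℓ ⊔ p)) → Σ ℕ λ d → Σ (Frame d I) λ B →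
              Indep B × (∀ k → Q (B k)) × (∀ v → Q v → InSpan B v)
      basis Q with extend Q [] (λ _ _ ())
      ... | d , B , rest = d ℕ.+ 0 , cat B [] , proj₁ rest , cat-all Q B [] (proj₁ (proj₂ rest)) (λ ()) , proj₂ (proj₂ rest)

  -- Rational hulls

  -- Independence in K as a left vector space over K₀. The side matters: coordinate i of Σ w_j b_j
  -- is Σ (w_j)_i b_j, with the rational factor on the left.
  LeftIndep : ∀ {m} → (Fin m → Carrier) → Set (c ⊔ ℓ ⊔ p)
  LeftIndep {m} b = ∀ (a : Fin m → Carrier) → (∀ j → In (a j)) → ∑ (λ j → a j * b j) ≈ 0# → ∀ j → a j ≈ 0#

  record Decomposition {I : Set} (v : Vect I) : Set (c ⊔ ℓ ⊔ p) where
    field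
      {len}  : ℕ
      coef   : Fin len → Carrier
      part   : Frame len I
      indep  : LeftIndep coef
      rat    : ∀ j → RatVec (part j)
      v≈     : lincomb part coef ≈v v

  -- Closure of K₀ under inverses enters here: a relation with nonzero coefficient at x can be
  -- divided by it on the left, which writes x as a rational combination of b.
  leftIndep-∷ : ∀ {m x} {b : Fin m → Carrier} → LeftIndep b →
                ¬ (Σ (Fin m → Carrier) λ a → (∀ j → In (a j)) × ∑ (λ j → a j * b j) ≈ x) → LeftIndep (x ∷ b)
  leftIndep-∷ {x = x} {b} ind x∉ a ain e = λ { fzero → a₀≈0 ; (fsuc j) → ind (a ∘ fsuc) (ain ∘ fsuc) rest j }
    where
    a₀≈0 : a fzero ≈ 0#
    a₀≈0 with dec-ℓ {a fzero ≈ 0#}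
    ... | yes h = h
    ... | no h with inverse (a fzero) h
    ...   | s , as≈1 , sa≈1 = contradiction
      ((λ j → - s * a (fsuc j)) , (λ j → *∈ (-∈ (inv∈ (ain fzero) as≈1 sa≈1)) (ain (fsuc j))) , (begin
        ∑ (λ j → - s * a (fsuc j) * b j)       ≈⟨ ∑-cong (λ j → *-assoc (- s) (a (fsuc j)) (b j)) ⟩
        ∑ (λ j → - s * (a (fsuc j) * b j))     ≈⟨ ∑-*ˡ (- s) (λ j → a (fsuc j) * b j) ⟨
        - s * t                                ≈⟨ -‿distribˡ-* s t ⟨
        - (s * t)                              ≈⟨ -‿distribʳ-* s t ⟩
        s * (- t)                              ≈⟨ *-congˡ (+-inverseˡ-unique (a fzero * x) t e) ⟨
        s * (a fzero * x)                      ≈⟨ *-assoc s (a fzero) x ⟨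
        s * a fzero * x                        ≈⟨ trans (*-congʳ sa≈1) (*-identityˡ x) ⟩
        x                                      ∎)) x∉
      where t = ∑ (λ j → a (fsuc j) * b j)
    rest : ∑ (λ j → a (fsuc j) * b j) ≈ 0#
    rest = trans (sym (trans (+-congʳ (trans (*-congʳ a₀≈0) (zeroˡ x))) (+-identityˡ _))) e

  -- The coordinates are read one at a time. A coordinate in the left K₀-span of the scalars found
  -- so far contributes new rational entries to the parts; any other one becomes a new scalar, with
  -- a unit vector as its part. Thus `coef` is a left K₀-basis of the span of the coordinates of v.
  decompose-Fin : ∀ {d} (v : Vect (Fin d)) → Decomposition v
  decompose-Fin {zero} v = record { len = 0 ; coef = λ () ; part = λ () ; indep = λ _ _ _ () ; rat = λ () ; v≈ = λ () }
  decompose-Fin {suc d} v with decompose-Fin (v ∘ fsuc)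
  ... | D with em {Lift (c ⊔ ℓ ⊔ p) (Σ (Fin (Decomposition.len D) → Carrier) λ a → (∀ j → In (a j)) × ∑ (λ j → a j * Decomposition.coef D j) ≈ v fzero)}
  ...   | yes (lift (a , ain , e)) = record
    { coef  = coef
    ; part  = λ { j fzero → a j ; j (fsuc i) → part j i }
    ; indep = indep
    ; rat   = λ { j fzero → ain j ; j (fsuc i) → rat j i }
    ; v≈    = λ { fzero → e ; (fsuc i) → v≈ i }
    }
    where open Decomposition D
  ...   | no v₀∉ = record
    { coef  = v fzero ∷ coef
    ; part  = λ { fzero → 1# ∷ (λ _ → 0#) ; (fsuc j) → 0# ∷ part j }
    ; indep = leftIndep-∷ indep (λ h → v₀∉ (lift h))
    ; rat   = λ { fzero fzero → 1∈ ; fzero (fsuc i) → 0∈ ; (fsuc j) fzero → 0∈ ; (fsuc j) (fsuc i) → rat j i }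
    ; v≈    = λ { fzero → trans (+-cong (*-identityˡ _) (∑-zero (λ j → zeroˡ (coef j)))) (+-identityʳ _)
                ; (fsuc i) → trans (trans (+-congʳ (zeroˡ _)) (+-identityˡ _)) (v≈ i) }
    }
    where open Decomposition D

  opaque
    decompose : ∀ {I} → Finite I → (v : Vect I) → Decomposition v
    decompose fin v = record
      { coef = coef ; part = λ j → part j ∘ enc ; indep = indep ; rat = λ j → rat j ∘ enc
      ; v≈ = λ i → trans (v≈ (enc i)) (reflexive (≡.cong v (dec∘enc i))) }
      where
      open Finite fin
      open Decomposition (decompose-Fin (v ∘ dec))

  -- Gaussian elimination: clearing a coordinate by means of a rational vector keeps everything rational.
  hull : ∀ {d I} (B : Frame d I) → (∀ k → RatVec (B k)) → ∀ {v} → InSpan B v →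
         (D : Decomposition v) → ∀ j → InSpan B (Decomposition.part D j)
  -- Here v is zero, so in each coordinate left independence forces the rational entries of all
  -- parts to vanish.
  hull {zero} B ratB (γ , e) D j = γ , λ i → sym (indep (λ j → part j i) (λ j → rat j i) (trans (v≈ i) (sym (e i))) j)
    where open Decomposition D
  hull {suc d} {I} B ratB {v} (γ , e) D j with em {Lift (c ⊔ ℓ ⊔ p) (Σ I λ i → ¬ (B fzero i ≈ 0#))}
  ... | no none = weaken {B = B} (hull (B ∘ fsuc) (ratB ∘ fsuc) (γ ∘ fsuc , tail-e) D j)
    where
    B₀≈0 : ∀ i → B fzero i ≈ 0#
    B₀≈0 i with dec-ℓ {B fzero i ≈ 0#}
    ... | yes h = h
    ... | no h  = contradiction (lift (i , h)) none
    tail-e : lincomb (B ∘ fsuc) (γ ∘ fsuc) ≈v v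
    tail-e i = trans (sym (trans (+-congʳ (trans (*-congʳ (B₀≈0 i)) (zeroˡ _))) (+-identityˡ _))) (e i)
  ... | yes (lift (i₀ , B₀≉0)) = resp-≈ SB back (add∈ SB (span-mono {C = B} TB⊑B (hull TB TB-rat Tv∈ TD j)) (scale∈ SB (s * part j i₀) (gen B fzero)))
    where
    open Decomposition D
    SB : Sub (InSpan B)
    SB = InSpan-sub B
    inv : Σ Carrier λ y → (B fzero i₀ * y ≈ 1#) × (y * B fzero i₀ ≈ 1#)
    inv = inverse (B fzero i₀) B₀≉0
    s : Carrier
    s = proj₁ inv
    s-in : In s
    s-in = inv∈ (ratB fzero i₀) (proj₁ (proj₂ inv)) (proj₂ (proj₂ inv))
    t : Vect I
    t i = B fzero i * (- s)
    -- T subtracts the multiple of `B fzero` that clears coordinate i₀. Its coefficients are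
    -- rational and act from the left, so it preserves rationality and commutes with right
    -- combinations: the image of the decomposition keeps the same scalars `coef`.
    T : Vect I → Vect I
    T u i = u i + t i * u i₀
    T-rat : ∀ {u} → RatVec u → RatVec (T u)
    T-rat h i = +∈ (h i) (*∈ (*∈ (ratB fzero i) (-∈ s-in)) (h i₀))
    T-cong : ∀ {u w} → u ≈v w → T u ≈v T w
    T-cong h i = +-cong (h i) (*-congˡ (h i₀))
    T-lincomb : ∀ {m} (C : Frame m I) η → lincomb (T ∘ C) η ≈v T (lincomb C η)
    T-lincomb C η i = begin
      ∑ (λ k → (C k i + t i * C k i₀) * η k)                    ≈⟨ ∑-cong (λ k → distribʳ (η k) _ _) ⟩
      ∑ (λ k → C k i * η k + t i * C k i₀ * η k)                ≈⟨ ∑-+ (λ k → C k i * η k) (λ k → t i * C k i₀ * η k) ⟩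
      lincomb C η i + ∑ (λ k → t i * C k i₀ * η k)              ≈⟨ +-congˡ (∑-cong (λ k → *-assoc (t i) (C k i₀) (η k))) ⟩
      lincomb C η i + ∑ (λ k → t i * (C k i₀ * η k))            ≈⟨ +-congˡ (∑-*ˡ (t i) (λ k → C k i₀ * η k)) ⟨
      lincomb C η i + t i * lincomb C η i₀                      ∎
    T-B₀ : T (B fzero) ≈v zeroV
    T-B₀ i = begin
      B fzero i + B fzero i * (- s) * B fzero i₀     ≈⟨ +-congˡ (*-assoc _ _ _) ⟩
      B fzero i + B fzero i * (- s * B fzero i₀)     ≈⟨ +-congˡ (*-congˡ (-‿distribˡ-* _ _)) ⟨
      B fzero i + B fzero i * (- (s * B fzero i₀))   ≈⟨ +-congˡ (*-congˡ (-‿cong (proj₂ (proj₂ inv)))) ⟩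
      B fzero i + B fzero i * (- 1#)                 ≈⟨ +-congˡ (-‿distribʳ-* _ _) ⟨
      B fzero i + - (B fzero i * 1#)                 ≈⟨ +-congˡ (-‿cong (*-identityʳ _)) ⟩
      B fzero i + - (B fzero i)                      ≈⟨ -‿inverseʳ _ ⟩
      0#                                             ∎
    TB : Frame d I
    TB = T ∘ B ∘ fsuc
    TB-rat : ∀ k → RatVec (TB k)
    TB-rat k = T-rat (ratB (fsuc k))
    TB⊑B : TB ⊑ B
    TB⊑B k = resp-≈ SB (λ i → +-congˡ (sym (*-assoc _ _ _)))
               (add∈ SB (gen B (fsuc k)) (scale∈ SB (- s * B (fsuc k) i₀) (gen B fzero)))
    Tv∈ : InSpan TB (T v)
    Tv∈ = γ ∘ fsuc , λ i → begin
      lincomb TB (γ ∘ fsuc) i                          ≈⟨ trans (+-congʳ (trans (*-congʳ (T-B₀ i)) (zeroˡ _))) (+-identityˡ _) ⟨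
      T (B fzero) i * γ fzero + lincomb TB (γ ∘ fsuc) i  ≈⟨ T-lincomb B γ i ⟩
      T (lincomb B γ) i                                ≈⟨ T-cong e i ⟩
      T v i                                            ∎
    TD : Decomposition (T v)
    TD = record { coef = coef ; part = T ∘ part ; indep = indep ; rat = T-rat ∘ rat
                ; v≈ = λ i → trans (T-lincomb part coef i) (T-cong v≈ i) }
    back : (T (part j) +v B fzero · (s * part j i₀)) ≈v part j
    back i = begin
      u i + B fzero i * (- s) * u i₀ + B fzero i * (s * u i₀)      ≈⟨ +-assoc _ _ _ ⟩
      u i + (B fzero i * (- s) * u i₀ + B fzero i * (s * u i₀))    ≈⟨ +-congˡ (+-congʳ (*-assoc _ _ _)) ⟩
      u i + (B fzero i * (- s * u i₀) + B fzero i * (s * u i₀))    ≈⟨ +-congˡ (distribˡ _ _ _) ⟨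
      u i + B fzero i * (- s * u i₀ + s * u i₀)                    ≈⟨ +-congˡ (*-congˡ (distribʳ _ _ _)) ⟨
      u i + B fzero i * ((- s + s) * u i₀)                         ≈⟨ +-congˡ (*-congˡ (trans (*-congʳ (-‿inverseˡ s)) (zeroˡ _))) ⟩
      u i + B fzero i * 0#                                         ≈⟨ trans (+-congˡ (zeroʳ _)) (+-identityʳ _) ⟩
      u i                                                          ∎
      where u = part j

  record RS {a I} (P : Vect I → Set a) (v : Vect I) : Set (c ⊔ ℓ ⊔ p ⊔ a) where
    constructor rs
    field
      {dim}  : ℕ
      frame  : Frame dim I
      inside : ∀ k → RatVec (frame k) × P (frame k)
      spans  : InSpan frame v

  -- With `parts-RS` this tests `RS P v` on any one decomposition of v: all parts must lie in P. The
  -- frames witnessing `RS P v` and `RS Q v` are unrelated, whereas the parts are common to both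
  -- tests; this yields `RS-∩`.
  RS-parts : ∀ {a I} {P : Vect I → Set a} → Sub P → ∀ {v} → RS P v →
             (D : Decomposition v) → ∀ j → P (Decomposition.part D j)
  RS-parts S (rs B h v∈) D j = span∈ S (proj₂ ∘ h) (hull B (proj₁ ∘ h) v∈ D j)

  parts-RS : ∀ {a I} {P : Vect I → Set a} {v} (D : Decomposition v) →
             (∀ j → P (Decomposition.part D j)) → RS P v
  parts-RS D h = rs part (λ j → rat j , h j) (coef , v≈)
    where open Decomposition D

  RS-mono : ∀ {a b I} {P : Vect I → Set a} {Q : Vect I → Set b} → (∀ {v} → P v → Q v) → ∀ {v} → RS P v → RS Q v
  RS-mono f (rs B h v∈) = rs B (λ k → proj₁ (h k) , f (proj₂ (h k))) v∈

  RS-∩ : ∀ {a b I} → Finite I → {P : Vect I → Set a} {Q : Vect I → Set b} → Sub P → Sub Q →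
         ∀ {v} → RS P v → RS Q v → RS (λ u → P u × Q u) v
  RS-∩ fin {P} {Q} SP SQ {v} p q = parts-RS D (λ j → RS-parts SP p D j , RS-parts SQ q D j)
    where D = decompose fin v

  RatSpace⇒RS : ∀ {d I} {B : Frame d I} → RatSpace B → ∀ {v} → InSpan B v → RS (InSpan B) v
  RatSpace⇒RS (B′ , _ , (B⊑B′ , B′⊑B) , ratB′) v∈ = rs B′ (λ k → ratB′ k , B′⊑B k) (span-mono B⊑B′ v∈)

  -- A maximal independent family of rational vectors of P; its `dim` is the number that selects the
  -- clause of near rationality.
  record RatBasis {I : Set} (P : Vect I → Set (c ⊔ ℓ)) : Set (c ⊔ ℓ ⊔ p) where
    field
      dim     : ℕ
      frame   : Frame dim I
      ind     : Indep frame
      ratl    : ∀ k → RatVec (frame k)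
      inside  : ∀ k → P (frame k)
      RS-span : ∀ {v} → RS P v → InSpan frame v

    span-RS : ∀ {v} → InSpan frame v → RS P v
    span-RS v∈ = rs frame (λ k → ratl k , inside k) v∈

  ratBasis : ∀ {I} → Finite I → (P : Vect I → Set (c ⊔ ℓ)) → RatBasis P
  ratBasis fin P with basis fin (λ v → RatVec v × P v)
  ... | d , B , ind , h , max = record
    { dim = d ; frame = B ; ind = ind ; ratl = proj₁ ∘ h ; inside = proj₂ ∘ h
    ; RS-span = λ (rs C hC v∈) → span-mono (λ k → max (C k) (hC k)) v∈ }

  RS-sub : ∀ {I} → Finite I → (P : Vect I → Set (c ⊔ ℓ)) → Sub (RS P)
  RS-sub fin P = record
    { resp-≈ = λ e h → span-RS (resp-≈ S e (RS-span h))
    ; zero∈ = span-RS (zero∈ S)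
    ; add∈ = λ h h′ → span-RS (add∈ S (RS-span h) (RS-span h′))
    ; scale∈ = λ a h → span-RS (scale∈ S a (RS-span h)) }
    where
    open RatBasis (ratBasis fin P)
    S = InSpan-sub frame

  RS⇒RatSpace : ∀ {d I} → Finite I → {B : Frame d I} → Indep B → (∀ k → RS (InSpan B) (B k)) → RatSpace B
  RS⇒RatSpace {d} {I} fin {B} indB h = conv dim frame ind ratl inside (λ k → RS-span (h k))
                              (ℕₚ.≤-antisym (steinitz ind inside) (steinitz indB (λ k → RS-span (h k))))
    where
    open RatBasis (ratBasis fin (InSpan B))
    -- `dim` is a projection of a record; replacing it by a variable e allows the equation with d to
    -- be matched.
    conv : ∀ e (C : Frame e I) → Indep C → (∀ k → RatVec (C k)) → C ⊑ B → B ⊑ C → e ≡ d → RatSpace B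
    conv e C indC ratC C⊑B B⊑C ≡.refl = C , indC , (B⊑C , C⊑B) , ratC

Even-Odd-⊥ : ∀ h k → h ℕ.+ h ≡ suc (k ℕ.+ k) → ⊥
Even-Odd-⊥ (suc h) k e = Even-Odd-⊥ k h (≡.trans (≡.sym (ℕₚ.suc-injective e)) (ℕₚ.+-suc h h))

-- The hyperbolic quadratic form and its maximal totally singular subspaces.

module Quadratic {c ℓ p} (K : DivisionRing c ℓ) (K₀ : SubDivisionRing K p)
                 (em : ExcludedMiddle (c ⊔ ℓ ⊔ p)) (comm : IsCommutative K) where

  open LinearAlgebra K K₀ em renaming (solve to solve-system)
  open DivisionRing K hiding (zero)
  open SubDivisionRing K₀
  open LinAlg K K₀
  open RingProperties ring
  open SetoidReasoning setoid
  open Sub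

  commutativeSemiring : CommutativeSemiring c ℓ
  commutativeSemiring = record
    { isCommutativeSemiring = record { isSemiring = isSemiring ; *-comm = comm } }

  open SemiringSolver commutativeSemiring using (solve; _:+_; _:*_; _:=_)

  opaque
    -- The polar form of `q`, see `q-+`. It is opaque so that later goals show `b` itself and not a
    -- sum over coordinates.
    b : ∀ {n} → Vect (VD n) → Vect (VD n) → Carrier
    b x y = ∑ (λ k → x (k , fzero) * y (k , fsuc fzero) + x (k , fsuc fzero) * y (k , fzero))

    b-sym : ∀ {n} (x y : Vect (VD n)) → b x y ≈ b y x
    b-sym {n} x y = ∑-cong {n} (λ k → trans (+-comm _ _) (+-cong (comm _ _) (comm _ _)))

    b-cong : ∀ {n} (x : Vect (VD n)) {u v} → u ≈v v → b x u ≈ b x v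
    b-cong {n} x h = ∑-cong {n} (λ k → +-cong (*-congˡ (h _)) (*-congˡ (h _)))

    b-+ : ∀ {n} (x u v : Vect (VD n)) → b x (u +v v) ≈ b x u + b x v
    b-+ {n} x u v = trans
      (∑-cong (λ k → solve 6 (λ x₀ x₁ u₀ u₁ v₀ v₁ →
        x₀ :* (u₁ :+ v₁) :+ x₁ :* (u₀ :+ v₀) := (x₀ :* u₁ :+ x₁ :* u₀) :+ (x₀ :* v₁ :+ x₁ :* v₀)) refl
        (x (k , fzero)) (x (k , fsuc fzero)) (u (k , fzero)) (u (k , fsuc fzero)) (v (k , fzero)) (v (k , fsuc fzero))))
      (∑-+ {n} _ _)

    b-· : ∀ {n} (x u : Vect (VD n)) a → b x (u · a) ≈ b x u * a
    b-· {n} x u a = trans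
      (∑-cong (λ k → solve 5 (λ x₀ x₁ u₀ u₁ a′ →
        x₀ :* (u₁ :* a′) :+ x₁ :* (u₀ :* a′) := (x₀ :* u₁ :+ x₁ :* u₀) :* a′) refl
        (x (k , fzero)) (x (k , fsuc fzero)) (u (k , fzero)) (u (k , fsuc fzero)) a))
      (sym (∑-*ʳ {n} a _))

    b-0 : ∀ {n} (x : Vect (VD n)) → b x zeroV ≈ 0#
    b-0 {n} x = ∑-zero {n} (λ k → trans (+-cong (zeroʳ _) (zeroʳ _)) (+-identityˡ 0#))

    q-+ : ∀ {n} (u v : Vect (VD n)) → q (u +v v) ≈ (q u + q v) + b u v
    q-+ {n} u v = trans
      (∑-cong (λ k → solve 4 (λ u₀ u₁ v₀ v₁ →
        (u₀ :+ v₀) :* (u₁ :+ v₁) := (u₀ :* u₁ :+ v₀ :* v₁) :+ (u₀ :* v₁ :+ u₁ :* v₀)) refl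
        (u (k , fzero)) (u (k , fsuc fzero)) (v (k , fzero)) (v (k , fsuc fzero))))
      (trans (∑-+ {n} _ _) (+-congʳ (∑-+ {n} _ _)))

    -- Pairing y with the unit vector at the partner coordinate reads off one coordinate of y.
    nondegenerate : ∀ {n} (y : Vect (VD n)) → (∀ v → b y v ≈ 0#) → y ≈v zeroV
    nondegenerate {n} y h (k , fzero) = trans (sym (trans (∑-cong {n} (λ j → trans (+-cong (comm (y (j , fzero)) (δ k j)) (zeroʳ (y (j , fsuc fzero)))) (+-identityʳ _)))
      (∑-δ k (λ j → y (j , fzero))))) (h λ { (j , fzero) → 0# ; (j , fsuc _) → δ k j })
    nondegenerate {n} y h (k , fsuc fzero) = trans (sym (trans (∑-cong {n} (λ j → trans (+-cong (zeroʳ (y (j , fzero))) (comm (y (j , fsuc fzero)) (δ k j))) (+-identityˡ _)))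
      (∑-δ k (λ j → y (j , fsuc fzero))))) (h λ { (j , fzero) → δ k j ; (j , fsuc _) → 0# })

    b-rat : ∀ {n} {x y : Vect (VD n)} → RatVec x → RatVec y → In (b x y)
    b-rat {n} hx hy = ∑-in {n} (λ k → +∈ (*∈ (hx _) (hy _)) (*∈ (hx _) (hy _)))

  b-lincomb : ∀ {n d} (x : Vect (VD n)) (B : Frame d (VD n)) γ → b x (lincomb B γ) ≈ ∑ (λ k → b x (B k) * γ k)
  b-lincomb {d = zero}  x B γ = b-0 x
  b-lincomb {d = suc d} x B γ = trans (b-+ x _ _) (+-cong (b-· x _ _) (b-lincomb x (B ∘ fsuc) (γ ∘ fsuc)))

  perp-sub : ∀ {n} (x : Vect (VD n)) → Sub (λ v → b x v ≈ 0#)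
  perp-sub x = record
    { resp-≈ = λ e h → trans (sym (b-cong x e)) h
    ; zero∈  = b-0 x
    ; add∈   = λ h h′ → trans (b-+ x _ _) (trans (+-cong h h′) (+-identityˡ 0#))
    ; scale∈ = λ a h → trans (b-· x _ a) (trans (*-congʳ h) (zeroˡ a)) }

  q-cong : ∀ {n} {u v : Vect (VD n)} → u ≈v v → q u ≈ q v
  q-cong {n} h = ∑-cong {n} (λ k → *-cong (h _) (h _))

  q-· : ∀ {n} (u : Vect (VD n)) a → q (u · a) ≈ q u * (a * a)
  q-· {n} u a = trans
    (∑-cong (λ k → solve 3 (λ u₀ u₁ a′ → (u₀ :* a′) :* (u₁ :* a′) := (u₀ :* u₁) :* (a′ :* a′)) refl
      (u (k , fzero)) (u (k , fsuc fzero)) a))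
    (sym (∑-*ʳ {n} (a * a) _))

  q-line : ∀ {n} {u v : Vect (VD n)} a a′ → q u ≈ 0# → q v ≈ 0# → q (u · a +v v · a′) ≈ b u v * (a * a′)
  q-line {u = u} {v} a a′ qu qv = begin
    q (u · a +v v · a′)                              ≈⟨ q-+ (u · a) (v · a′) ⟩
    (q (u · a) + q (v · a′)) + b (u · a) (v · a′)    ≈⟨ +-congʳ (+-cong (null u a qu) (null v a′ qv)) ⟩
    (0# + 0#) + b (u · a) (v · a′)                   ≈⟨ trans (+-congʳ (+-identityˡ 0#)) (+-identityˡ _) ⟩
    b (u · a) (v · a′)                               ≈⟨ b-· (u · a) v a′ ⟩
    b (u · a) v * a′                                 ≈⟨ *-congʳ (trans (b-sym (u · a) v) (b-· v u a)) ⟩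
    b v u * a * a′                                   ≈⟨ *-congʳ (*-congʳ (b-sym v u)) ⟩
    b u v * a * a′                                   ≈⟨ *-assoc _ _ _ ⟩
    b u v * (a * a′)                                 ∎
    where
    null : ∀ w s → q w ≈ 0# → q (w · s) ≈ 0#
    null w s h = trans (q-· w s) (trans (*-congʳ h) (zeroˡ _))

  VD-finite : ∀ n → Finite (VD n)
  VD-finite n = record
    { size = n ℕ.* 2 ; enc = λ (k , e) → combine k e ; dec = remQuot 2
    ; dec∘enc = λ (k , e) → Finₚ.remQuot-combine k e }

  TS-q : ∀ {n d} {B : Frame d (VD n)} → TotSingular B → ∀ {v} → InSpan B v → q v ≈ 0#
  TS-q ts (γ , e) = trans (sym (q-cong e)) (ts γ)

  TS-b : ∀ {n d} {B : Frame d (VD n)} → TotSingular B → ∀ {u v} → InSpan B u → InSpan B v → b u v ≈ 0#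
  TS-b {B = B} ts {u} {v} u∈ v∈ = begin
    b u v                     ≈⟨ +-identityˡ _ ⟨
    0# + b u v                ≈⟨ +-congʳ (trans (+-cong (TS-q {B = B} ts u∈) (TS-q {B = B} ts v∈)) (+-identityˡ 0#)) ⟨
    (q u + q v) + b u v       ≈⟨ q-+ u v ⟨
    q (u +v v)                ≈⟨ TS-q {B = B} ts (add∈ (InSpan-sub B) u∈ v∈) ⟩
    0#                        ∎

  TS-⊑ : ∀ {n d m} {B : Frame d (VD n)} {C : Frame m (VD n)} → B ⊑ C → TotSingular C → TotSingular B
  TS-⊑ {B = B} {C} h ts γ = TS-q {B = C} ts (lincomb∈ (InSpan-sub C) h γ)

  TS-∷ : ∀ {n d} {B : Frame d (VD n)} {x} → TotSingular B → q x ≈ 0# → (∀ k → b x (B k) ≈ 0#) → TotSingular (x ∷ B)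
  TS-∷ {B = B} {x} ts qx x⊥ γ = trans
    (q-cong {u = lincomb (x ∷ B) γ} {v = x · γ fzero +v lincomb B (γ ∘ fsuc) · 1#} (λ i → +-congˡ (sym (*-identityʳ _))))
    (trans (q-line {u = x} (γ fzero) 1# qx (ts (γ ∘ fsuc)))
           (trans (*-congʳ (lincomb∈ (perp-sub x) x⊥ (γ ∘ fsuc))) (zeroˡ _)))

  -- The class is left out, so the same lemmas serve elements of type + and of type -.
  record Max (n : ℕ) : Set (c ⊔ ℓ) where
    constructor max
    field
      frame : Frame n (VD n)
      ind   : Indep frame
      ts    : TotSingular frame

    _∋_ : Vect (VD n) → Set (c ⊔ ℓ)
    _∋_ = InSpan frame

    sub : Sub _∋_
    sub = InSpan-sub frame

    ∋-b : ∀ {u v} → _∋_ u → _∋_ v → b u v ≈ 0#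
    ∋-b = TS-b {B = frame} ts

  open Max using (frame; ind; ts; _∋_; sub; ∋-b)

  not-all : ∀ {d I} {B : Frame d I} {m} {C : Frame m I} → ¬ (B ⊑ C) → Σ (Fin d) λ k → ¬ InSpan C (B k)
  not-all {d} {B = B} {C = C} h = Finₚ.¬∀⟶∃¬ d (λ k → InSpan C (B k)) (λ _ → dec-cℓ) h

  opaque
    -- Y is its own perpendicular. If x ∉ Y, then x ∷ Y is completed to a basis of the
    -- 2n-dimensional space by e < n vectors Z. Orthogonality to Z imposes e equations on the n
    -- coefficients of a vector of Y, so some nonzero y in Y is orthogonal to Z, to x and to Y,
    -- hence to everything.
    perp⇒∈ : ∀ {n} (Y : Max n) {x} → (∀ k → b x (frame Y k) ≈ 0#) → Y ∋ x
    perp⇒∈ {n} Y {x} x⊥ with dec-cℓ {Y ∋ x}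
    ... | yes h = h
    ... | no x∉ with extend (VD-finite n) (λ _ → Lift (c ⊔ ℓ ⊔ p) ⊤) (x ∷ frame Y) (indep-∷ {B = frame Y} (ind Y) x∉)
    ...   | e , Z , indZ , _ , spans = contradiction γ≈0 (proj₁ (proj₂ sol))
      where
      e<n : e < n
      e<n = ℕₚ.+-cancelʳ-≤ n (suc e) n (ℕₚ.≤-trans (ℕₚ.≤-reflexive (≡.sym (ℕₚ.+-suc e n)))
              (ℕₚ.≤-trans (indep-≤ (VD-finite n) {C = cat Z (x ∷ frame Y)} indZ)
                (ℕₚ.≤-reflexive (≡.trans (ℕₚ.*-comm n 2) (≡.cong (n ℕ.+_) (ℕₚ.+-identityʳ n))))))
      sol : Σ (Fin n → Carrier) λ γ → ¬ (∀ k → γ k ≈ 0#) × (∀ i → ∑ (λ k → b (Z i) (frame Y k) * γ k) ≈ 0#)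
      sol = solve-system (λ i k → b (Z i) (frame Y k)) e<n
      γ : Fin n → Carrier
      γ = proj₁ sol
      y : Vect (VD n)
      y = lincomb (frame Y) γ
      y⊥ : ∀ k → b y (cat Z (x ∷ frame Y) k) ≈ 0#
      y⊥ = cat-all (λ v → b y v ≈ 0#) Z (x ∷ frame Y)
        (λ i → trans (b-sym y (Z i)) (trans (b-lincomb (Z i) (frame Y) γ) (proj₂ (proj₂ sol) i)))
        (λ { fzero → trans (b-sym y x) (lincomb∈ (perp-sub x) x⊥ γ)
           ; (fsuc k) → ∋-b Y (γ , λ _ → refl) (gen (frame Y) k) })
      γ≈0 : ∀ k → γ k ≈ 0#
      γ≈0 = ind Y γ (nondegenerate y (λ v → span∈ (perp-sub y) y⊥ (spans v (lift tt))))

  opaque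
    -- Let C be a basis of U ∩ X, extended by D to span U and by E to span X. Since m < n, E is
    -- longer than D, so some nonzero combination x of E is orthogonal to D; it is orthogonal to C
    -- because X is totally singular. If x were in U, it would lie in the span of C, against the
    -- independence of E and C.
    exists-perp : ∀ {n m} (X : Max n) (U : Frame m (VD n)) → Indep U → m < n →
                  Σ (Vect (VD n)) λ x → (X ∋ x) × (∀ k → b x (U k) ≈ 0#) × ¬ InSpan U x
    exists-perp {n} {m} X U indU m<n with basis (VD-finite n) (λ v → Lift p (InSpan U v × X ∋ v))
    ... | r , C , indC , C⊂ , C-max
      with extend (VD-finite n) (λ v → Lift p (InSpan U v)) C indC | extend (VD-finite n) (λ v → Lift p (X ∋ v)) C indC
    ... | d , D , indD , D⊂ , D-spans | e , E , indE , E⊂ , E-spans = x , x∈X , x⊥U , x∉U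
      where
      d+r≤m : d ℕ.+ r ≤ m
      d+r≤m = steinitz {C = cat D C} {B = U} indD (cat-all (InSpan U) D C (lower ∘ D⊂) (proj₁ ∘ lower ∘ C⊂))
      n≤e+r : n ≤ e ℕ.+ r
      n≤e+r = steinitz {C = frame X} {B = cat E C} (ind X) (λ k → E-spans _ (lift (gen (frame X) k)))
      d<e : d < e
      d<e = ℕₚ.+-cancelʳ-< r d e (ℕₚ.≤-<-trans d+r≤m (ℕₚ.<-≤-trans m<n n≤e+r))
      sol : Σ (Fin e → Carrier) λ γ → ¬ (∀ k → γ k ≈ 0#) × (∀ i → ∑ (λ k → b (D i) (E k) * γ k) ≈ 0#)
      sol = solve-system (λ i k → b (D i) (E k)) d<e
      γ : Fin e → Carrier
      γ = proj₁ sol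
      x : Vect (VD n)
      x = lincomb E γ
      x∈X : X ∋ x
      x∈X = lincomb∈ (sub X) (lower ∘ E⊂) γ
      x⊥U : ∀ k → b x (U k) ≈ 0#
      x⊥U k = span∈ (perp-sub x) (cat-all (λ v → b x v ≈ 0#) D C
        (λ i → trans (b-sym x (D i)) (trans (b-lincomb (D i) E γ) (proj₂ (proj₂ sol) i)))
        (λ j → ∋-b X x∈X (proj₂ (lower (C⊂ j))))) (D-spans _ (lift (gen U k)))
      x∉U : ¬ InSpan U x
      x∉U x∈U = proj₁ (proj₂ sol) (cat-disjoint indE γ (C-max x (lift (x∈U , x∈X))))

  spans-∷ : ∀ {d} (Y : Max (suc d)) {U : Frame d (VD (suc d))} {y} → Indep U → U ⊑ frame Y → Y ∋ y → ¬ InSpan U y →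
            frame Y ⊑ (y ∷ U)
  spans-∷ Y {U} {y} indU U⊑Y y∈ y∉ = span-full {C = y ∷ U} (indep-∷ {B = U} indU y∉)
    (λ { fzero → y∈ ; (fsuc k) → U⊑Y k }) ℕₚ.≤-refl

  perp-∷⇒∈ : ∀ {d} (Y : Max (suc d)) {U : Frame d (VD (suc d))} {y x} → Indep U → U ⊑ frame Y → Y ∋ y → ¬ InSpan U y →
             b x y ≈ 0# → (∀ k → b x (U k) ≈ 0#) → Y ∋ x
  perp-∷⇒∈ Y {U} {y} {x} indU U⊑Y y∈ y∉ xy x⊥ = perp⇒∈ Y λ k →
    span-cons {B = U} (perp-sub x) xy x⊥ (spans-∷ Y indU U⊑Y y∈ y∉ k)

  ≁⇒∉ : ∀ {n} (Y₁ Y₂ : Max n) → ¬ SameSpan (frame Y₁) (frame Y₂) → Σ (Vect (VD n)) λ y → (Y₁ ∋ y) × ¬ (Y₂ ∋ y)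
  ≁⇒∉ Y₁ Y₂ h with not-all {B = frame Y₁} {C = frame Y₂} (λ sub → h (sub , span-full {C = frame Y₁} (ind Y₁) sub ℕₚ.≤-refl))
  ... | k , ∉ = frame Y₁ k , gen (frame Y₁) k , ∉

  -- With y₁ ∈ Y₁ ∖ Y₂ and y₂ ∈ Y₂ ∖ Y₁, the vector z = x b(y₂,y₁) − y₂ b(x,y₁) is orthogonal to Y₁, hence lies
  -- in Y₁, and q(z) = 0 says b(y₂,y₁) b(x,y₁) b(x,y₂) = 0.
  opaque
    two-maximals : ∀ {d} (Y₁ Y₂ : Max (suc d)) (U : Frame d (VD (suc d))) → Indep U → U ⊑ frame Y₁ → U ⊑ frame Y₂ →
            ¬ SameSpan (frame Y₁) (frame Y₂) → ∀ {x} → q x ≈ 0# → (∀ k → b x (U k) ≈ 0#) → (Y₁ ∋ x) ⊎ (Y₂ ∋ x)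
    two-maximals {d} Y₁ Y₂ U indU U⊑Y₁ U⊑Y₂ ≁ {x} qx x⊥ with ≁⇒∉ Y₁ Y₂ ≁ | ≁⇒∉ Y₂ Y₁ (λ (s , t) → ≁ (t , s))
    ... | y₁ , y₁∈ , y₁∉ | y₂ , y₂∈ , y₂∉ with dec-ℓ {b x y₁ ≈ 0#} | dec-ℓ {b x y₂ ≈ 0#}
    ...   | yes h | _     = inj₁ (perp-∷⇒∈ Y₁ indU U⊑Y₁ y₁∈ (y₁∉ ∘ span-mono {B = U} {C = frame Y₂} U⊑Y₂) h x⊥)
    ...   | no _  | yes h = inj₂ (perp-∷⇒∈ Y₂ indU U⊑Y₂ y₂∈ (y₂∉ ∘ span-mono {B = U} {C = frame Y₁} U⊑Y₁) h x⊥)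
    ...   | no α≉0 | no xy₂≉0 = contradiction (cancel {b x y₂} β≉0 (cancel -α≉0 (trans (*-assoc _ _ _) prod≈0))) xy₂≉0
      where
      α β : Carrier
      α = b x y₁
      β = b y₂ y₁
      -α≉0 : ¬ (- α ≈ 0#)
      -α≉0 h = α≉0 (trans (sym (-‿involutive α)) (trans (-‿cong h) -0#≈0#))
      y₁∉U : ¬ InSpan U y₁
      y₁∉U = y₁∉ ∘ span-mono {B = U} {C = frame Y₂} U⊑Y₂
      cancel : ∀ {s t} → ¬ (t ≈ 0#) → s * t ≈ 0# → s ≈ 0#
      cancel {s} {t} t≉0 st with inverse t t≉0
      ... | i , ti , _ = trans (sym (trans (*-congˡ ti) (*-identityʳ s))) (trans (sym (*-assoc s t i)) (trans (*-congʳ st) (zeroˡ i)))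
      β≉0 : ¬ (β ≈ 0#)
      β≉0 h = y₂∉ (perp-∷⇒∈ Y₁ indU U⊑Y₁ y₁∈ y₁∉U h (λ k → ∋-b Y₂ y₂∈ (U⊑Y₂ k)))
      z : Vect (VD (suc d))
      z = x · β +v y₂ · (- α)
      z⊥ : ∀ {v} → b x v * β + b y₂ v * (- α) ≈ 0# → b z v ≈ 0#
      z⊥ {v} h = trans (b-sym z v) (trans (b-+ v _ _) (trans (+-cong
        (trans (b-· v x β) (*-congʳ (b-sym v x))) (trans (b-· v y₂ (- α)) (*-congʳ (b-sym v y₂)))) h))
      z∈Y₁ : Y₁ ∋ z
      z∈Y₁ = perp-∷⇒∈ Y₁ indU U⊑Y₁ y₁∈ y₁∉U
        (z⊥ (trans (+-congˡ (trans (sym (-‿distribʳ-* β α)) (-‿cong (comm β α)))) (-‿inverseʳ _)))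
        (λ k → z⊥ (trans (+-cong (trans (*-congʳ (x⊥ k)) (zeroˡ _)) (trans (*-congʳ (∋-b Y₂ y₂∈ (U⊑Y₂ k))) (zeroˡ _))) (+-identityˡ 0#)))
      prod≈0 : b x y₂ * (β * (- α)) ≈ 0#
      prod≈0 = trans (sym (q-line {u = x} β (- α) qx (TS-q {B = frame Y₂} (ts Y₂) y₂∈))) (TS-q {B = frame Y₁} (ts Y₁) z∈Y₁)

-- Rational singular vectors orthogonal to a rational subspace, and the parity of the two classes.

module OrthogonalSpaces {c ℓ p} (K : DivisionRing c ℓ) (K₀ : SubDivisionRing K p)
                 (em : ExcludedMiddle (c ⊔ ℓ ⊔ p)) (comm : IsCommutative K) where

  open LinearAlgebra K K₀ em
  open Quadratic K K₀ em comm
  open DivisionRing K hiding (zero)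
  open SubDivisionRing K₀
  open LinAlg K K₀
  open RingProperties ring
  open SetoidReasoning setoid
  open Sub
  open Max using (frame; ind; ts; _∋_; sub; ∋-b)

  δ-refl : ∀ {d} (i : Fin d) → δ i i ≡ 1#
  δ-refl fzero    = ≡.refl
  δ-refl (fsuc i) = δ-refl i

  δ-≢ : ∀ {d} {i j : Fin d} → ¬ (i ≡ j) → δ i j ≡ 0#
  δ-≢ {i = fzero}  {fzero}  h = contradiction ≡.refl h
  δ-≢ {i = fzero}  {fsuc j} h = ≡.refl
  δ-≢ {i = fsuc i} {fzero}  h = ≡.refl
  δ-≢ {i = fsuc i} {fsuc j} h = δ-≢ (h ∘ ≡.cong fsuc)

  X₀-δ : ∀ {n} (k k′ : Fin n) → X₀ n k (k′ , fzero) ≡ δ k′ k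
  X₀-δ k k′ with k Finₚ.≟ k′
  ... | yes ≡.refl = ≡.sym (δ-refl k)
  ... | no k≢k′    = ≡.sym (δ-≢ (k≢k′ ∘ ≡.sym))

  lincomb-X₀ : ∀ {n} γ (k : Fin n) → lincomb (X₀ n) γ (k , fzero) ≈ γ k
  lincomb-X₀ {n} γ k = trans (∑-cong {n} (λ j → *-congʳ (reflexive (X₀-δ j k)))) (∑-δ k γ)

  X₀-second≈0 : ∀ {n v} → InSpan (X₀ n) v → ∀ k → v (k , fsuc fzero) ≈ 0#
  X₀-second≈0 {n} (γ , e) k = trans (sym (e _)) (∑-zero {n} (λ j → zeroˡ (γ j)))

  second≈0-X₀ : ∀ {n v} → (∀ k → v (k , fsuc fzero) ≈ 0#) → InSpan (X₀ n) v
  second≈0-X₀ {n} {v} h = (λ k → v (k , fzero)) , λ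
    { (k , fzero)      → lincomb-X₀ (λ k → v (k , fzero)) k
    ; (k , fsuc fzero) → trans (∑-zero {n} (λ j → zeroˡ _)) (sym (h k)) }

  second≈0-q : ∀ {n} {v : Vect (VD n)} → (∀ k → v (k , fsuc fzero) ≈ 0#) → q v ≈ 0#
  second≈0-q {n} h = ∑-zero {n} (λ k → trans (*-congˡ (h k)) (zeroʳ _))

  reference : ∀ n → Max n
  reference n = max (X₀ n) (λ γ e k → trans (sym (lincomb-X₀ γ k)) (e (k , fzero)))
    (λ γ → second≈0-q {n} {lincomb (X₀ n) γ} (X₀-second≈0 {n} {lincomb (X₀ n) γ} (γ , λ _ → refl)))

  -- A linear equation over K₀ that holds for v holds for every part, since on v it reads as a left
  -- K₀-relation among the scalars `coef`. `part-perp` is the same principle for orthogonality to a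
  -- rational vector; together with `some-part` it turns solutions over K into rational ones.
  part-≈0 : ∀ {I} {v : Vect I} (D : Decomposition v) {i} → v i ≈ 0# → ∀ j → Decomposition.part D j i ≈ 0#
  part-≈0 D {i} h = indep (λ j → part j i) (λ j → rat j i) (trans (v≈ i) h)
    where open Decomposition D

  part-perp : ∀ {n} {u v : Vect (VD n)} → RatVec u → b u v ≈ 0# → (D : Decomposition v) → ∀ j → b u (Decomposition.part D j) ≈ 0#
  part-perp {u = u} ru uv D = indep (λ j → b u (part j)) (λ j → b-rat ru (rat j))
      (trans (sym (b-lincomb u part coef)) (trans (b-cong u v≈) uv))
    where open Decomposition D

  some-part : ∀ {a I} {P : Vect I → Set a} {v} → Sub P → (∀ u → Dec (P u)) → ¬ P v → (D : Decomposition v) →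
              Σ (Fin (Decomposition.len D)) λ j → ¬ P (Decomposition.part D j)
  some-part {P = P} S P? ¬Pv D = Finₚ.¬∀⟶∃¬ len (λ j → P (part j)) (λ j → P? (part j))
    (λ h → ¬Pv (resp-≈ S v≈ (lincomb∈ S h coef)))
    where open Decomposition D

  RatSpace-∷ : ∀ {d} (Y : Max (suc d)) {U : Frame d (VD (suc d))} {y} → Indep U → U ⊑ frame Y → (∀ k → RatVec (U k)) →
               Y ∋ y → ¬ InSpan U y → RatVec y → RatSpace (frame Y)
  RatSpace-∷ Y {U} {y} indU U⊑Y ratU y∈ y∉ raty = (y ∷ U) , indep-∷ {B = U} indU y∉ ,
    (spans-∷ Y indU U⊑Y y∈ y∉ , λ { fzero → y∈ ; (fsuc k) → U⊑Y k }) , λ { fzero → raty ; (fsuc k) → ratU k }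

  opaque
    -- As r is singular, q(w + r t) = q(w) + b(r,w) t has degree one in t, and its root lies in K₀.
    rational-singular : ∀ {n} {r w : Vect (VD n)} → RatVec r → RatVec w → q r ≈ 0# → ¬ (b r w ≈ 0#) →
                        Σ Carrier λ t → RatVec (w +v r · t) × q (w +v r · t) ≈ 0#
    rational-singular {n} {r} {w} r-rat w-rat qr rw≉0 with inverse (b r w) rw≉0
    ... | s , rws≈1 , srw≈1 = t , z-rat , qz
      where
      t : Carrier
      t = - (q w * s)
      t-in : In t
      t-in = -∈ (*∈ (∑-in {n} (λ k → *∈ (w-rat (k , fzero)) (w-rat (k , fsuc fzero)))) (inv∈ (b-rat r-rat w-rat) rws≈1 srw≈1))
      z-rat : RatVec (w +v r · t)
      z-rat e = +∈ (w-rat e) (*∈ (r-rat e) t-in)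
      qz : q (w +v r · t) ≈ 0#
      qz = begin
        q (w +v r · t)                        ≈⟨ q-+ w (r · t) ⟩
        (q w + q (r · t)) + b w (r · t)       ≈⟨ +-cong (+-congˡ (trans (q-· r t) (trans (*-congʳ qr) (zeroˡ _)))) (b-· w r t) ⟩
        (q w + 0#) + b w r * t                ≈⟨ +-cong (+-identityʳ _) (*-cong (b-sym w r) refl) ⟩
        q w + b r w * (- (q w * s))           ≈⟨ +-congˡ (-‿distribʳ-* _ _) ⟨
        q w + - (b r w * (q w * s))           ≈⟨ +-congˡ (-‿cong (trans (*-congˡ (comm _ _)) (sym (*-assoc _ _ _)))) ⟩
        q w + - (b r w * s * q w)             ≈⟨ +-congˡ (-‿cong (trans (*-congʳ rws≈1) (*-identityˡ _))) ⟩
        q w + - q w                           ≈⟨ -‿inverseʳ _ ⟩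
        0#                                    ∎

  opaque
    -- A vector x of X₀ ∩ U^⊥ outside U exists over K. Lying in X₀ and in U^⊥ are linear conditions
    -- over K₀, so all parts of x satisfy them, and some part is outside U. Singularity is not
    -- linear; it comes for free inside X₀.
    rational-perp : ∀ {n m} (U : Frame m (VD n)) → Indep U → (∀ k → RatVec (U k)) → m < n →
                    Σ (Vect (VD n)) λ r → RatVec r × q r ≈ 0# × (∀ k → b r (U k) ≈ 0#) × ¬ InSpan U r
    rational-perp {n} U indU ratU m<n with exists-perp (reference n) U indU m<n
    ... | x , x∈X₀ , x⊥U , x∉U with decompose (VD-finite n) x
    ...   | D with some-part (InSpan-sub U) (λ _ → dec-cℓ) x∉U D
    ...     | j , r∉U = part j , rat j
      , second≈0-q {n} {part j} (λ k → part-≈0 D (X₀-second≈0 {n} {x} x∈X₀ k) j)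
      , (λ k → trans (b-sym (part j) (U k)) (part-perp (ratU k) (trans (b-sym (U k) x) (x⊥U k)) D j))
      , r∉U
      where open Decomposition D

  opaque
    -- The parts of y stay in U^⊥ because U is rational, and they cannot all be orthogonal to r
    -- because y is not.
    rational-non-perp : ∀ {n m} (U : Frame m (VD n)) → (∀ k → RatVec (U k)) → ∀ {r y} → (∀ k → b y (U k) ≈ 0#) →
                        ¬ (b r y ≈ 0#) → Σ (Vect (VD n)) λ w → RatVec w × (∀ k → b w (U k) ≈ 0#) × ¬ (b r w ≈ 0#)
    rational-non-perp {n} U ratU {r} {y} y⊥U ry≉0 with decompose (VD-finite n) y
    ... | D with some-part (perp-sub r) (λ _ → dec-ℓ) ry≉0 D
    ...   | j , rw≉0 = part j , rat j
      , (λ k → trans (b-sym (part j) (U k)) (part-perp (ratU k) (trans (b-sym (U k) y) (y⊥U k)) D j))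
      , rw≉0
      where open Decomposition D

  opaque
    outside : ∀ {d} (Y : Max (suc d)) (U : Frame d (VD (suc d))) → Σ (Vect (VD (suc d))) λ y → Y ∋ y × ¬ InSpan U y
    outside {d} Y U with not-all {B = frame Y} {C = U} (λ h → contradiction (steinitz {C = frame Y} {B = U} (ind Y) h) ℕₚ.1+n≰n)
    ... | k , y∉U = frame Y k , gen (frame Y) k , y∉U

  opaque
    -- Exactly two maximal totally singular subspaces contain U. A rational singular r in U^⊥
    -- outside U spans one of them with U. If that one is not Y, a rational w in U^⊥ not orthogonal
    -- to r is moved along r to a singular z. Then z is not orthogonal to r, so it lies in the other
    -- subspace, which is Y, and is a rational vector of Y outside U.
    rational-hyperplane : ∀ {d} (Y : Max (suc d)) (U : Frame d (VD (suc d))) → Indep U → U ⊑ frame Y →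
                          (∀ k → RatVec (U k)) → RatSpace (frame Y)
    rational-hyperplane {d} Y U indU U⊑Y ratU with rational-perp U indU ratU ℕₚ.≤-refl
    ... | r , r-rat , qr , r⊥U , r∉U with dec-cℓ {Y ∋ r}
    ...   | yes r∈Y = RatSpace-∷ Y indU U⊑Y ratU r∈Y r∉U r-rat
    ...   | no r∉Y with outside Y U
    ...     | y , y∈Y , y∉U with rational-non-perp U ratU {r} {y} (λ k → ∋-b Y y∈Y (U⊑Y k))
                                   (λ h → r∉Y (perp-∷⇒∈ Y indU U⊑Y y∈Y y∉U h r⊥U))
    ...       | w , w-rat , w⊥U , rw≉0 with rational-singular r-rat w-rat qr rw≉0
    ...         | t , z-rat , qz = conclude (two-maximals Y Y′ U indU U⊑Y (λ k → gen (r ∷ U) (fsuc k)) (λ (_ , h) → r∉Y (h fzero)) qz z⊥U)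
      where
      Y′ : Max (suc d)
      Y′ = max (r ∷ U) (indep-∷ {B = U} indU r∉U) (TS-∷ {B = U} (TS-⊑ {B = U} {C = frame Y} U⊑Y (ts Y)) qr r⊥U)
      z : Vect (VD (suc d))
      z = w +v r · t
      z⊥U : ∀ k → b z (U k) ≈ 0#
      z⊥U k = trans (b-sym z (U k)) (add∈ (perp-sub (U k)) (trans (b-sym (U k) w) (w⊥U k))
                (scale∈ (perp-sub (U k)) t (trans (b-sym (U k) r) (r⊥U k))))
      rz≉0 : ¬ (b r z ≈ 0#)
      rz≉0 h = rw≉0 (cancel∈ (perp-sub r) t (∋-b Y′ (gen (r ∷ U) fzero) (gen (r ∷ U) fzero)) h)
      conclude : (Y ∋ z) ⊎ (Y′ ∋ z) → RatSpace (frame Y)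
      conclude (inj₁ z∈Y)  = RatSpace-∷ Y indU U⊑Y ratU z∈Y (λ z∈U → rz≉0 (span∈ (perp-sub r) r⊥U z∈U)) z-rat
      conclude (inj₂ z∈Y′) = contradiction (∋-b Y′ (gen (r ∷ U) fzero) z∈Y′) rz≉0

  opaque
    -- Y₁ ∩ X = ⟨x⟩ + (Y₂ ∩ X). A vector of Y₁ ∩ X is a multiple of x plus a vector of U, and the
    -- latter is in X since x is. Conversely, a vector of Y₂ ∩ X is orthogonal to x inside X and to
    -- U inside Y₂, hence lies in Y₁.
    codim-step : ∀ {d} (X Y₁ Y₂ : Max (suc d)) (U : Frame d (VD (suc d))) → Indep U → U ⊑ frame Y₁ → U ⊑ frame Y₂ →
                 ∀ {x} → X ∋ x → (∀ k → b x (U k) ≈ 0#) → ¬ InSpan U x → Y₁ ∋ x → ¬ (Y₂ ∋ x) →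
                 ∀ {m₁ m₂} → IntDim (frame Y₁) (frame X) m₁ → IntDim (frame Y₂) (frame X) m₂ → m₁ ≡ suc m₂
    codim-step {d} X Y₁ Y₂ U indU U⊑Y₁ U⊑Y₂ {x} x∈X x⊥U x∉U x∈Y₁ x∉Y₂ (C₁ , indC₁ , C₁⊂ , C₁-max) (C₂ , indC₂ , C₂⊂ , C₂-max) =
      ℕₚ.≤-antisym (steinitz {C = C₁} {B = x ∷ C₂} indC₁ below)
                   (steinitz {C = x ∷ C₂} {B = C₁} (indep-∷ {B = C₂} indC₂ (x∉Y₂ ∘ span∈ (sub Y₂) (proj₁ ∘ C₂⊂))) above)
      where
      above : (x ∷ C₂) ⊑ C₁
      above fzero    = C₁-max x x∈Y₁ x∈X
      above (fsuc k) = C₁-max (C₂ k) (perp-∷⇒∈ Y₁ indU U⊑Y₁ x∈Y₁ x∉U (∋-b X (proj₂ (C₂⊂ k)) x∈X)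
                         (λ j → ∋-b Y₂ (proj₁ (C₂⊂ k)) (U⊑Y₂ j))) (proj₂ (C₂⊂ k))
      below : C₁ ⊑ (x ∷ C₂)
      below k with spans-∷ Y₁ indU U⊑Y₁ x∈Y₁ x∉U
      ... | Y₁⊑ with span-mono {B = frame Y₁} {C = x ∷ U} Y₁⊑ (proj₁ (C₁⊂ k))
      ...   | γ , e = resp-≈ (InSpan-sub (x ∷ C₂)) e
        (add∈ (InSpan-sub (x ∷ C₂)) (scale∈ (InSpan-sub (x ∷ C₂)) (γ fzero) (gen (x ∷ C₂) fzero))
          (weaken {B = x ∷ C₂} (C₂-max u (lincomb∈ (sub Y₂) U⊑Y₂ (γ ∘ fsuc)) u∈X)))
        where
        u : Vect (VD (suc d))
        u = lincomb U (γ ∘ fsuc)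
        u∈X : X ∋ u
        u∈X = cancel∈ (sub X) (γ fzero) x∈X (resp-≈ (sub X) (λ i → trans (sym (e i)) (+-comm _ _)) (proj₂ (C₁⊂ k)))

  ¬Even×Odd : ∀ {m} → Even m → ¬ Odd m
  ¬Even×Odd (h , e) (k , e′) = Even-Odd-⊥ h k (≡.trans (≡.sym e) e′)

  Odd-pred : ∀ {m} → Odd (suc m) → Even m
  Odd-pred (h , e) = h , ℕₚ.suc-injective e

  SameParity : ℕ → ℕ → Set
  SameParity m m′ = (Even m × Even m′) ⊎ (Odd m × Odd m′)

  SameParity-suc : ∀ {m m′} → SameParity m m′ → ¬ (m′ ≡ suc m)
  SameParity-suc (inj₂ (o , o′)) ≡.refl = ¬Even×Odd (Odd-pred o′) o
  SameParity-suc {m} (inj₁ ((h , ≡.refl) , (h′ , e))) ≡.refl = Even-Odd-⊥ h′ h (≡.sym e)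

  SameParity-sym : ∀ {m m′} → SameParity m m′ → SameParity m′ m
  SameParity-sym (inj₁ (s , t)) = inj₁ (t , s)
  SameParity-sym (inj₂ (s , t)) = inj₂ (t , s)

  ∸-step : ∀ {n m} → suc m ≤ n → n ∸ m ≡ suc (n ∸ suc m)
  ∸-step {suc n} {m} (s≤s m≤n) = ℕₚ.+-∸-assoc 1 m≤n

  opaque
    -- A common vector v outside W would give a common hyperplane U = ⟨v, W⟩. A vector x of X ∩ U^⊥
    -- outside U lies in Y₁ or Y₂ by `two-maximals`, and not in both, as they differ. By
    -- `codim-step` the dimensions of Y₁ ∩ X and Y₂ ∩ X then differ by one, against equal parity.
    same-class-meet : ∀ {m} (X Y₁ Y₂ : Max (suc (suc m))) (W : Frame m (VD (suc (suc m)))) → Indep W →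
                      W ⊑ frame Y₁ → W ⊑ frame Y₂ → ¬ SameSpan (frame Y₁) (frame Y₂) →
                      ∀ {m₁ m₂} → IntDim (frame Y₁) (frame X) m₁ → IntDim (frame Y₂) (frame X) m₂ →
                      SameParity (suc (suc m) ∸ m₁) (suc (suc m) ∸ m₂) →
                      ∀ {v} → Y₁ ∋ v → Y₂ ∋ v → InSpan W v
    same-class-meet {m} X Y₁ Y₂ W indW W⊑Y₁ W⊑Y₂ ≁ {m₁} {m₂} I₁ I₂ par {v} v∈Y₁ v∈Y₂ with dec-cℓ {InSpan W v}
    ... | yes h = h
    ... | no v∉W with exists-perp X (v ∷ W) (indep-∷ {B = W} indW v∉W) ℕₚ.≤-refl
    ...   | x , x∈X , x⊥U , x∉U = ⊥-elim (cases (two-maximals Y₁ Y₂ U indU U⊑Y₁ U⊑Y₂ ≁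
                                    (TS-q {B = frame X} (ts X) x∈X) x⊥U))
      where
      U : Frame (suc m) (VD (suc (suc m)))
      U = v ∷ W
      indU : Indep U
      indU = indep-∷ {B = W} indW v∉W
      U⊑Y₁ : U ⊑ frame Y₁
      U⊑Y₁ = λ { fzero → v∈Y₁ ; (fsuc k) → W⊑Y₁ k }
      U⊑Y₂ : U ⊑ frame Y₂
      U⊑Y₂ = λ { fzero → v∈Y₂ ; (fsuc k) → W⊑Y₂ k }
      not-both : Y₁ ∋ x → ¬ (Y₂ ∋ x)
      not-both x∈Y₁ x∈Y₂ = ≁ ( (λ k → span-cons {B = U} (sub Y₂) x∈Y₂ U⊑Y₂ (spans-∷ Y₁ indU U⊑Y₁ x∈Y₁ x∉U k))
                             , (λ k → span-cons {B = U} (sub Y₁) x∈Y₁ U⊑Y₁ (spans-∷ Y₂ indU U⊑Y₂ x∈Y₂ x∉U k)))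
      bound : ∀ (Y : Max (suc (suc m))) {m′} → IntDim (frame Y) (frame X) m′ → m′ ≤ suc (suc m)
      bound Y (C , indC , C⊂ , _) = steinitz {C = C} {B = frame Y} indC (proj₁ ∘ C⊂)
      cases : (Y₁ ∋ x) ⊎ (Y₂ ∋ x) → ⊥
      cases (inj₁ x∈Y₁) with codim-step X Y₁ Y₂ U indU U⊑Y₁ U⊑Y₂ x∈X x⊥U x∉U x∈Y₁ (not-both x∈Y₁) I₁ I₂
      ... | ≡.refl = SameParity-suc par (∸-step (bound Y₁ I₁))
      cases (inj₂ x∈Y₂) with codim-step X Y₂ Y₁ U indU U⊑Y₂ U⊑Y₁ x∈X x⊥U x∉U x∈Y₂ (λ x∈Y₁ → not-both x∈Y₁ x∈Y₂) I₂ I₁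
      ... | ≡.refl = SameParity-suc (SameParity-sym par) (∸-step (bound Y₂ I₂))

-- How near rationality passes from two points of a line to a third.

module Lines {c ℓ p} (K : DivisionRing c ℓ) (K₀ : SubDivisionRing K p)
                 (em : ExcludedMiddle (c ⊔ ℓ ⊔ p)) where

  open LinearAlgebra K K₀ em
  open DivisionRing K hiding (zero)
  open SubDivisionRing K₀
  open LinAlg K K₀
  open Sub

  SymIncl⇒SameSpan : ∀ {d I} {B C : Frame d I} → Indep B → Indep C → SymIncl B C → SameSpan B C
  SymIncl⇒SameSpan indB indC h = SymIncl⇒⊑ indB indC ℕₚ.≤-refl h , SymIncl⇒⊑ indC indB ℕₚ.≤-refl (SymIncl-sym h)

  SameSpan-sym : ∀ {d e I} {B : Frame d I} {C : Frame e I} → SameSpan B C → SameSpan C B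
  SameSpan-sym (h , h′) = h′ , h

  SameSpan-trans : ∀ {d e f I} {B : Frame d I} {C : Frame e I} {D : Frame f I} → SameSpan B C → SameSpan C D → SameSpan B D
  SameSpan-trans {B = B} {C} {D} (s , s′) (t , t′) =
    (λ k → span-mono {B = C} {C = D} t (s k)) , (λ k → span-mono {B = C} {C = B} s′ (t′ k))

  RatSpace-resp : ∀ {d I} {B C : Frame d I} → SameSpan B C → RatSpace B → RatSpace C
  RatSpace-resp {B = B} {C} h (B′ , ind , same , rat) =
    B′ , ind , SameSpan-trans {B = C} {C = B} {D = B′} (SameSpan-sym {B = B} {C = C} h) same , rat

  collinear∈ : ∀ {I} {P₁ P₂ P₃ : Frame 1 I} {M : Frame 2 I} → Indep P₁ → Indep P₂ → ¬ SameSpan P₁ P₂ →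
               P₁ ⊑ M → P₂ ⊑ M → P₃ ⊑ M → ∀ {a} {S : Vect I → Set a} → Sub S →
               S (P₁ fzero) → S (P₂ fzero) → S (P₃ fzero)
  collinear∈ {P₁ = P₁} {P₂} {P₃} {M} ind₁ ind₂ ≁ h₁ h₂ h₃ sub s₁ s₂ =
    span-cons {B = P₂} sub s₁ (λ { fzero → s₂ }) (span-mono {C = P₁ fzero ∷ P₂} M⊑ (h₃ fzero))
    where
    ∉ : ¬ InSpan P₂ (P₁ fzero)
    ∉ h = ≁ (P₁⊑P₂ , span-full {C = P₁} {B = P₂} ind₁ P₁⊑P₂ ℕₚ.≤-refl)
      where
      P₁⊑P₂ : P₁ ⊑ P₂
      P₁⊑P₂ fzero = h
    M⊑ : M ⊑ (P₁ fzero ∷ P₂)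
    M⊑ = span-full {C = P₁ fzero ∷ P₂} (indep-∷ {B = P₂} ind₂ ∉) (λ { fzero → h₁ fzero ; (fsuc k) → h₂ k }) ℕₚ.≤-refl

  -- A common vector outside W would generate with W both H₁ and H₂, which would then be equal.
  meet-hyperplanes : ∀ {d e I} {H₁ H₂ : Frame e I} {W : Frame d I} → e ≡ suc d → Indep H₁ → Indep H₂ → Indep W → ¬ SameSpan H₁ H₂ →
                     W ⊑ H₁ → W ⊑ H₂ → ∀ {v} → InSpan H₁ v → InSpan H₂ v → InSpan W v
  meet-hyperplanes {H₁ = H₁} {H₂} {W} ≡.refl ind₁ ind₂ indW ≁ h₁ h₂ {v} v₁ v₂ with dec-cℓ {InSpan W v}
  ... | yes h = h
  ... | no ∉ = contradiction (incl {H₁} {H₂} ind₁ h₁ v₁ v₂ h₂ , incl {H₂} {H₁} ind₂ h₂ v₂ v₁ h₁) ≁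
    where
    incl : ∀ {H H′} → Indep H → W ⊑ H → InSpan H v → InSpan H′ v → W ⊑ H′ → H ⊑ H′
    incl {H} {H′} indH h v∈ v∈′ h′ k = span-cons {B = W} (InSpan-sub H′) v∈′ h′
      (span-full {C = v ∷ W} {B = H} (indep-∷ {B = W} indW ∉) (λ { fzero → v∈ ; (fsuc k) → h k }) ℕₚ.≤-refl k)

  basis⇒RatSpace : ∀ {d e I} {B : Frame d I} {C : Frame e I} → Indep B → Indep C → (∀ k → RatVec (C k)) →
                   B ⊑ C → C ⊑ B → RatSpace B
  basis⇒RatSpace {B = B} {C} indB indC ratC B⊑C C⊑B =
    conv (ℕₚ.≤-antisym (steinitz {C = C} {B = B} indC C⊑B) (steinitz {C = B} {B = C} indB B⊑C)) indC ratC B⊑C C⊑B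
    where
    conv : ∀ {d e I} {B : Frame d I} {C : Frame e I} → e ≡ d → Indep C → (∀ k → RatVec (C k)) →
                   B ⊑ C → C ⊑ B → RatSpace B
    conv {C = C} ≡.refl indC ratC B⊑C C⊑B = C , indC , (B⊑C , C⊑B) , ratC

  RatBetween : ∀ {I} → ℕ → (Vect I → Set (c ⊔ ℓ)) → Vect I → Set (c ⊔ ℓ ⊔ p)
  RatBetween {I} t P v = Σ (Frame (suc t) I) λ X → Indep X × (∀ k → RatVec (X k)) × InSpan X v × (∀ k → P (X k))

  -- Lines along which a maximal totally singular subspace moves.

  module PolarLines (comm : IsCommutative K) where
    open Quadratic K K₀ em comm
    open OrthogonalSpaces K K₀ em comm
    open Max using (frame; ind; ts; _∋_; sub; ∋-b)

    SameClass : ∀ {n} → Max n → Max n → Set (c ⊔ ℓ)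
    SameClass {n} X Y = (ClassPlus n (frame X) × ClassPlus n (frame Y)) ⊎ (ClassMinus n (frame X) × ClassMinus n (frame Y))

    IntDim-sym : ∀ {n d e m} {X : Frame d (VD n)} {Y : Frame e (VD n)} → IntDim X Y m → IntDim Y X m
    IntDim-sym (C , indC , C⊂ , C-max) = C , indC , (λ k → proj₂ (C⊂ k) , proj₁ (C⊂ k)) , λ v y x → C-max v x y

    IntDim-respʳ : ∀ {n d e f m} {X : Frame d (VD n)} {Y : Frame e (VD n)} {Z : Frame f (VD n)} →
                   SameSpan Y Z → IntDim X Y m → IntDim X Z m
    IntDim-respʳ {Y = Y} {Z} (Y⊑Z , Z⊑Y) (C , indC , C⊂ , C-max) = C , indC ,
      (λ k → proj₁ (C⊂ k) , span-mono {B = Y} {C = Z} Y⊑Z (proj₂ (C⊂ k))) , λ v x z → C-max v x (span-mono {B = Z} {C = Y} Z⊑Y z)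

    meet : ∀ {n w} (Y₁ Y₂ : Max n) {W : Frame w (VD n)} → suc (suc w) ≡ n → Indep W → W ⊑ frame Y₁ → W ⊑ frame Y₂ →
           SameClass Y₁ Y₂ → ¬ SameSpan (frame Y₁) (frame Y₂) → ∀ {v} → Y₁ ∋ v × Y₂ ∋ v → InSpan W v
    meet {n} Y₁ Y₂ {W} ≡.refl indW h₁ h₂ (inj₁ ((_ , I₁ , e₁) , (_ , I₂ , e₂))) ≁ (v₁ , v₂) =
      same-class-meet (reference n) Y₁ Y₂ W indW h₁ h₂ ≁ I₁ I₂ (inj₁ (e₁ , e₂)) v₁ v₂
    meet {n} Y₁ Y₂ {W} ≡.refl indW h₁ h₂ (inj₂ ((_ , I₁ , o₁) , (_ , I₂ , o₂))) ≁ (v₁ , v₂) =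
      same-class-meet (reference n) Y₁ Y₂ W indW h₁ h₂ ≁ I₁ I₂ (inj₂ (o₁ , o₂)) v₁ v₂

    RS-meet : ∀ {n w} (Y₁ Y₂ : Max n) {W : Frame w (VD n)} → suc (suc w) ≡ n → Indep W → W ⊑ frame Y₁ → W ⊑ frame Y₂ →
              SameClass Y₁ Y₂ → ¬ SameSpan (frame Y₁) (frame Y₂) → ∀ {v} → RS (Y₁ ∋_) v → RS (Y₂ ∋_) v → RS (InSpan W) v
    RS-meet {n} Y₁ Y₂ w indW h₁ h₂ cl ≁ r₁ r₂ =
      RS-mono (meet Y₁ Y₂ w indW h₁ h₂ cl ≁) (RS-∩ (VD-finite n) (sub Y₁) (sub Y₂) r₁ r₂)

    -- Dimension n leaves only Y itself; dimension n - 1 is the case of `rational-hyperplane`.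
    large-rational : ∀ {d e} (Y : Max (suc d)) {C : Frame e (VD (suc d))} → Indep C → (∀ k → RatVec (C k)) → C ⊑ frame Y →
                     d ≤ e → RatSpace (frame Y)
    large-rational {d} {e} Y {C} indC ratC C⊑Y d≤e with ℕₚ.m≤n⇒m<n∨m≡n d≤e
    ... | inj₁ d<e    = basis⇒RatSpace {B = frame Y} {C = C} (ind Y) indC ratC (span-full {C = C} indC C⊑Y d<e) C⊑Y
    ... | inj₂ ≡.refl = rational-hyperplane Y C indC C⊑Y ratC

    -- The three outcomes are dimension 1, dimensions 2 to n - 2, and dimension at least n - 1 of
    -- the rational hull of P. Dimension 0 is excluded by the nonzero vector of B.
    RS-trichotomy : ∀ {k} (Y : Max (suc (suc (suc k)))) {P : Vect (VD (suc (suc (suc k)))) → Set (c ⊔ ℓ)} → (∀ {v} → P v → Y ∋ v) →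
                    {B : Frame 1 (VD (suc (suc (suc k))))} → Indep B → RS P (B fzero) →
                    RatSpace B ⊎ RatSpace (frame Y) ⊎ Σ (Fin k) λ i → RatBetween (suc (toℕ i)) P (B fzero)
    RS-trichotomy {k} Y {P} P⊂Y {B} indB r = go dim frame′ RB.ind ratl inside (RS-span r)
      where
      module RB = RatBasis (ratBasis (VD-finite (suc (suc (suc k)))) P)
      open RB using (dim; ratl; inside; RS-span) renaming (frame to frame′)
      go : ∀ e (C : Frame e (VD (suc (suc (suc k))))) → Indep C → (∀ k → RatVec (C k)) → (∀ k → P (C k)) → InSpan C (B fzero) →
           RatSpace B ⊎ RatSpace (frame Y) ⊎ Σ (Fin k) λ i → RatBetween (suc (toℕ i)) P (B fzero)
      go zero C indC ratC C⊂P B∈ = contradiction (steinitz {C = B} {B = C} indB λ { fzero → B∈ }) λ ()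
      go (suc zero) C indC ratC C⊂P B∈ = inj₁ (basis⇒RatSpace {B = B} {C = C} indB indC ratC B⊑C
                                                (span-full {C = B} {B = C} indB B⊑C ℕₚ.≤-refl))
        where
        B⊑C : B ⊑ C
        B⊑C fzero = B∈
      -- With n = k + 3, the dimension e + 2 is at most n - 2 exactly when e < k; i = e then stands
      -- for node `sing (fsuc i)`, whose elements have dimension i + 2.
      go (suc (suc e)) C indC ratC C⊂P B∈ with e ℕ.<? k
      ... | yes e<k = inj₂ (inj₂ (Data.Fin.fromℕ< e<k , ≡.subst (λ t → RatBetween t P (B fzero))
                        (≡.cong suc (≡.sym (Finₚ.toℕ-fromℕ< e<k))) (C , indC , ratC , B∈ , C⊂P)))
      ... | no e≮k  = inj₂ (inj₁ (large-rational Y indC ratC (λ k → P⊂Y (C⊂P k)) (s≤s (s≤s (ℕₚ.≮⇒≥ e≮k)))))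

    record Near₁ {n} (X Y : Max n) (v : Vect (VD n)) : Set (c ⊔ ℓ ⊔ p) where
      constructor near₁
      field
        cases : RatSpace (frame X) ⊎ RatSpace (frame Y) ⊎ RS (λ u → X ∋ u × Y ∋ u) v

    Near₁-RS : ∀ {n} {X Y : Max n} {v} → X ∋ v → Near₁ X Y v → RatSpace (frame Y) ⊎ RS (X ∋_) v
    Near₁-RS {X = X} v∈X (near₁ (inj₁ r))        = inj₂ (RatSpace⇒RS {B = frame X} r v∈X)
    Near₁-RS v∈X (near₁ (inj₂ (inj₁ r))) = inj₁ r
    Near₁-RS v∈X (near₁ (inj₂ (inj₂ r))) = inj₂ (RS-mono proj₁ r)

    Near₁-sym : ∀ {n} {X Y : Max n} {v} → Near₁ X Y v → Near₁ Y X v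
    Near₁-sym (near₁ (inj₁ r))        = near₁ (inj₂ (inj₁ r))
    Near₁-sym (near₁ (inj₂ (inj₁ r))) = near₁ (inj₁ r)
    Near₁-sym (near₁ (inj₂ (inj₂ r))) = near₁ (inj₂ (inj₂ (RS-mono (λ (x , y) → y , x) r)))

    -- Y moves and O stays. A rational O settles the claim; otherwise both hypotheses put v into
    -- RS(Y₁) ∩ RS(Y₂), hence into RS(W), and W lies in Y₃ ∩ O.
    Near₁-line : ∀ {n w} {Y₁ Y₂ Y₃ O : Max n} {W : Frame w (VD n)} {v} → suc (suc w) ≡ n → Indep W →
                 W ⊑ frame Y₁ → W ⊑ frame Y₂ → W ⊑ frame Y₃ → W ⊑ frame O →
                 SameClass Y₁ Y₂ → ¬ SameSpan (frame Y₁) (frame Y₂) → Y₁ ∋ v → Y₂ ∋ v →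
                 Near₁ Y₁ O v → Near₁ Y₂ O v → Near₁ Y₃ O v
    Near₁-line {Y₁ = Y₁} {Y₂} {Y₃} {O} {W} w indW h₁ h₂ h₃ hO cl ≁ v₁ v₂ near near′ with Near₁-RS v₁ near | Near₁-RS v₂ near′
    ... | inj₁ r | _      = near₁ (inj₂ (inj₁ r))
    ... | inj₂ _ | inj₁ r = near₁ (inj₂ (inj₁ r))
    ... | inj₂ r | inj₂ s = near₁ (inj₂ (inj₂ (RS-mono (λ u∈W → span-mono {B = W} {C = frame Y₃} h₃ u∈W , span-mono {B = W} {C = frame O} hO u∈W)
                              (RS-meet Y₁ Y₂ w indW h₁ h₂ cl ≁ r s))))

    Near₁-resp : ∀ {n} {X X′ Y Y′ : Max n} {P : Frame 1 (VD n)} {v} → SameSpan (frame X) (frame X′) → SameSpan (frame Y) (frame Y′) →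
                 InSpan P v → Near₁ X Y (P fzero) → Near₁ X′ Y′ v
    Near₁-resp {X = X} {X′} sX sY _ (near₁ (inj₁ r)) = near₁ (inj₁ (RatSpace-resp {B = frame X} {C = frame X′} sX r))
    Near₁-resp {Y = Y} {Y′} sX sY _ (near₁ (inj₂ (inj₁ r))) = near₁ (inj₂ (inj₁ (RatSpace-resp {B = frame Y} {C = frame Y′} sY r)))
    Near₁-resp {n} {X} {X′} {Y} {Y′} {P} sX sY v∈ (near₁ (inj₂ (inj₂ r))) = near₁ (inj₂ (inj₂ (span∈
      (RS-sub (VD-finite n) (λ u → X′ ∋ u × Y′ ∋ u)) {B = P}
      (λ { fzero → RS-mono (λ (x , y) → span-mono {B = frame X} {C = frame X′} (proj₁ sX) x , span-mono {B = frame Y} {C = frame Y′} (proj₁ sY) y) r }) v∈)))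

    RatCodim2 : ∀ {n} → Max n → Max n → Set (c ⊔ ℓ ⊔ p)
    RatCodim2 {n} X Y = Σ ℕ λ u → suc (suc u) ≡ n × Σ (Frame u (VD n)) λ U →
      Indep U × (∀ k → RatVec (U k)) × U ⊑ frame X × U ⊑ frame Y

    record Near₂ {n} (X Y : Max n) : Set (c ⊔ ℓ ⊔ p) where
      constructor near₂
      field
        cases : RatSpace (frame X) ⊎ RatSpace (frame Y) ⊎ RatCodim2 X Y

    Near₂-sym : ∀ {n} {X Y : Max n} → Near₂ X Y → Near₂ Y X
    Near₂-sym (near₂ (inj₁ r))        = near₂ (inj₂ (inj₁ r))
    Near₂-sym (near₂ (inj₂ (inj₁ r))) = near₂ (inj₁ r)
    Near₂-sym (near₂ (inj₂ (inj₂ (u , e , U , indU , ratU , hX , hY)))) = near₂ (inj₂ (inj₂ (u , e , U , indU , ratU , hY , hX)))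

    Near₂-resp : ∀ {n} {X X′ Y Y′ : Max n} → SameSpan (frame X) (frame X′) → SameSpan (frame Y) (frame Y′) → Near₂ X Y → Near₂ X′ Y′
    Near₂-resp {X = X} {X′} sX sY (near₂ (inj₁ r)) = near₂ (inj₁ (RatSpace-resp {B = frame X} {C = frame X′} sX r))
    Near₂-resp {Y = Y} {Y′} sX sY (near₂ (inj₂ (inj₁ r))) = near₂ (inj₂ (inj₁ (RatSpace-resp {B = frame Y} {C = frame Y′} sY r)))
    Near₂-resp {X = X} {X′} {Y} {Y′} sX sY (near₂ (inj₂ (inj₂ (u , e , U , indU , ratU , hX , hY)))) =
      near₂ (inj₂ (inj₂ (u , e , U , indU , ratU , (λ k → span-mono {B = frame X} {C = frame X′} (proj₁ sX) (hX k)) ,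
                                                   (λ k → span-mono {B = frame Y} {C = frame Y′} (proj₁ sY) (hY k)))))

    -- Here Y ∩ O = Y ∩ r^⊥, and r^⊥ is defined over K₀.
    rational-neighbour : ∀ {n} (Y O : Max n) → RatSpace (frame Y) → IntDim (frame Y) (frame O) (n ∸ 1) →
                         ∀ {r} → RatVec r → O ∋ r → ¬ (Y ∋ r) → RatSpace (frame O)
    rational-neighbour {zero}  Y O _ _ _ (γ , e) r∉Y = contradiction ((λ ()) , e) r∉Y
    rational-neighbour {suc d} Y O ratY (C , indC , C⊂ , _) {r} r-rat r∈O r∉Y = RS⇒RatSpace fin {B = frame O} (ind O)
      λ k → span∈ (RS-sub fin (O ∋_)) r∷C-RS (spans-∷ O indC (proj₂ ∘ C⊂) r∈O r∉C k)
      where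
      fin : Finite (VD (suc d))
      fin = VD-finite (suc d)
      r∉C : ¬ InSpan C r
      r∉C h = r∉Y (span∈ (sub Y) (proj₁ ∘ C⊂) h)
      C-RS : ∀ k → RS (O ∋_) (C k)
      C-RS k = parts-RS D λ j → perp-∷⇒∈ O indC (proj₂ ∘ C⊂) r∈O r∉C
          (trans (b-sym (part j) r) (part-perp r-rat (∋-b O r∈O (proj₂ (C⊂ k))) D j))
          (λ i → ∋-b Y (RS-parts (sub Y) (RatSpace⇒RS {B = frame Y} ratY (proj₁ (C⊂ k))) D j) (proj₁ (C⊂ i)))
        where
        D : Decomposition (C k)
        D = decompose fin (C k)
        open Decomposition D using (part)
      r∷C-RS : ∀ k → RS (O ∋_) ((r ∷ C) k)
      r∷C-RS fzero    = rs {dim = 1} (λ _ → r) (λ _ → r-rat , r∈O) (gen (λ (_ : Fin 1) → r) fzero)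
      r∷C-RS (fsuc k) = C-RS k

    -- A rational O settles the claim. If Y₁ and Y₂ are rational, so is W = Y₁ ∩ Y₂. If Y₁ is
    -- rational and U is a rational subspace of Y₂ ∩ O of dimension n - 2, then either U ⊆ Y₁, so U
    -- ⊆ W ⊆ Y₃, or a rational vector of O outside Y₁ makes O rational. For two such subspaces U₁
    -- and U₂, either U₁ ⊆ Y₂, so U₁ ⊆ W, or a vector of U₁ outside Y₂ spans with U₂ a rational
    -- hyperplane of O.
    Near₂-line : ∀ {n w} {Y₁ Y₂ Y₃ O : Max n} {W : Frame w (VD n)} → suc (suc w) ≡ n → Indep W →
                 W ⊑ frame Y₁ → W ⊑ frame Y₂ → W ⊑ frame Y₃ → W ⊑ frame O →
                 SameClass Y₁ Y₂ → ¬ SameSpan (frame Y₁) (frame Y₂) →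
                 IntDim (frame Y₁) (frame O) (n ∸ 1) → IntDim (frame Y₂) (frame O) (n ∸ 1) →
                 Near₂ Y₁ O → Near₂ Y₂ O → Near₂ Y₃ O
    Near₂-line {n} {w} {Y₁} {Y₂} {Y₃} {O} {W} e indW h₁ h₂ h₃ hO cl ≁ I₁ I₂ = go
      where
      meet′ : ∀ {v} → Y₁ ∋ v × Y₂ ∋ v → InSpan W v
      meet′ = meet Y₁ Y₂ e indW h₁ h₂ cl ≁
      by-U : ∀ {u} {U : Frame u (VD n)} → suc (suc u) ≡ n → Indep U → (∀ k → RatVec (U k)) → U ⊑ frame O → U ⊑ frame Y₁ → U ⊑ frame Y₂ → Near₂ Y₃ O
      by-U {U = U} e′ indU ratU U⊑O U⊑Y₁ U⊑Y₂ = near₂ (inj₂ (inj₂ (_ , e′ , U , indU , ratU ,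
        (λ k → span-mono {B = W} {C = frame Y₃} h₃ (meet′ (U⊑Y₁ k , U⊑Y₂ k))) , U⊑O)))
      mixed : ∀ (Y Y′ : Max n) → IntDim (frame Y) (frame O) (n ∸ 1) → RatSpace (frame Y) → RatCodim2 Y′ O →
              (∀ {u} {U : Frame u (VD n)} → suc (suc u) ≡ n → Indep U → (∀ k → RatVec (U k)) → U ⊑ frame O → U ⊑ frame Y → U ⊑ frame Y′ → Near₂ Y₃ O) →
              Near₂ Y₃ O
      mixed Y Y′ I r (u , e′ , U , indU , ratU , U⊑Y′ , U⊑O) conclude with dec-cℓ {U ⊑ frame Y}
      ... | yes U⊑Y = conclude e′ indU ratU U⊑O U⊑Y U⊑Y′
      ... | no U⋢Y with not-all {B = U} {C = frame Y} U⋢Y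
      ...   | k , ∉ = near₂ (inj₂ (inj₁ (rational-neighbour Y O r I (ratU k) (U⊑O k) ∉)))
      both : suc (suc w) ≡ n → RatCodim2 Y₁ O → RatCodim2 Y₂ O → Near₂ Y₃ O
      both ≡.refl (u₁ , e₁ , U₁ , ind₁ , rat₁ , U₁⊑Y₁ , U₁⊑O) (u₂ , ≡.refl , U₂ , ind₂ , rat₂ , U₂⊑Y₂ , U₂⊑O) with dec-cℓ {U₁ ⊑ frame Y₂}
      ... | yes U₁⊑Y₂ = by-U e₁ ind₁ rat₁ U₁⊑O U₁⊑Y₁ U₁⊑Y₂
      ... | no U₁⋢Y₂ with not-all {B = U₁} {C = frame Y₂} U₁⋢Y₂
      ...   | k , ∉ = near₂ (inj₂ (inj₁ (rational-hyperplane O (U₁ k ∷ U₂)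
                       (indep-∷ {B = U₂} ind₂ (∉ ∘ span-mono {B = U₂} {C = frame Y₂} U₂⊑Y₂))
                       (λ { fzero → U₁⊑O k ; (fsuc j) → U₂⊑O j })
                       (λ { fzero → rat₁ k ; (fsuc j) → rat₂ j }))))
      two-rational : RatSpace (frame Y₁) → RatSpace (frame Y₂) → Near₂ Y₃ O
      two-rational r s with RS⇒RatSpace (VD-finite n) {B = W} indW (λ k → RS-meet Y₁ Y₂ e indW h₁ h₂ cl ≁
                              (RatSpace⇒RS {B = frame Y₁} r (h₁ k)) (RatSpace⇒RS {B = frame Y₂} s (h₂ k)))
      ... | W′ , indW′ , (_ , W′⊑W) , ratW′ = near₂ (inj₂ (inj₂ (w , e , W′ , indW′ , ratW′ ,
              (λ k → span-mono {B = W} {C = frame Y₃} h₃ (W′⊑W k)) , (λ k → span-mono {B = W} {C = frame O} hO (W′⊑W k)))))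
      go : Near₂ Y₁ O → Near₂ Y₂ O → Near₂ Y₃ O
      go (near₂ (inj₂ (inj₁ r))) _ = near₂ (inj₂ (inj₁ r))
      go _ (near₂ (inj₂ (inj₁ r))) = near₂ (inj₂ (inj₁ r))
      go (near₂ (inj₁ r)) (near₂ (inj₁ s)) = two-rational r s
      go (near₂ (inj₁ r)) (near₂ (inj₂ (inj₂ u))) = mixed Y₁ Y₂ I₁ r u by-U
      go (near₂ (inj₂ (inj₂ u))) (near₂ (inj₁ s)) = mixed Y₂ Y₁ I₂ s u (λ e′ i r o y₂ y₁ → by-U e′ i r o y₁ y₂)
      go (near₂ (inj₂ (inj₂ u))) (near₂ (inj₂ (inj₂ u′))) = both e u u′

-- Diagram nodes that split a type.

module Splitting {e r} (G : Geometry e r) where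
  open Geometry G
  open GeometryDefs G

  Reach-head : ∀ {t a b} → Reach t a b → ¬ (a ≡ t)
  Reach-head (here h)     = h
  Reach-head (step h _ _) = h

  Reach-invariant : ∀ {A : Set} {t} (f : Ty → A) → (∀ {a b} → ¬ (a ≡ t) → ¬ (b ≡ t) → Adj a b → f a ≡ f b) →
                    ∀ {a b} → Reach t a b → f a ≡ f b
  Reach-invariant f inv (here _)         = ≡.refl
  Reach-invariant f inv (step h adj rch) = ≡.trans (inv h (Reach-head rch) adj) (Reach-invariant f inv rch)

  -- A labelling that is constant along the edges avoiding t is constant on components, so two
  -- members of J with different labels cannot be reached from one node.
  separates⇒Splits : ∀ {A : Set} {J : Ty → Set} {t} (f : Ty → A) → ¬ J t →
                     (∀ {a b} → ¬ (a ≡ t) → ¬ (b ≡ t) → Adj a b → f a ≡ f b) →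
                     ∀ {a b} → J a → J b → ¬ (f a ≡ f b) → Splits J t
  separates⇒Splits f t∉J inv {a} {b} Ja Jb ≢ = t∉J , λ (c , _ , rch) →
    ≢ (≡.trans (≡.sym (Reach-invariant f inv (rch a Ja))) (Reach-invariant f inv (rch b Jb)))

-- The labelling for a path: nodes before t against the rest. Crossing from one side to the other
-- requires passing through t, see `below-path`.
below : ∀ {m} → Fin m → Fin m → Bool
below t a = does (toℕ a ℕ.<? toℕ t)

below-path : ∀ {m} {t a b : Fin m} → ¬ (a ≡ t) → ¬ (b ≡ t) → (toℕ b ≡ suc (toℕ a)) ⊎ (toℕ a ≡ suc (toℕ b)) →
             below t a ≡ below t b
below-path {t = t} {a} {b} a≢t b≢t adj = does-⇔ (mk⇔ (go adj b≢t) (go (swap adj) a≢t)) (toℕ a ℕ.<? toℕ t) (toℕ b ℕ.<? toℕ t)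
  where
  go : ∀ {a b} → (toℕ b ≡ suc (toℕ a)) ⊎ (toℕ a ≡ suc (toℕ b)) → ¬ (b ≡ t) → toℕ a < toℕ t → toℕ b < toℕ t
  go (inj₁ e) b≢t a<t = ℕₚ.≤∧≢⇒< (≡.subst (_≤ toℕ t) (≡.sym e) a<t) (b≢t ∘ Finₚ.toℕ-injective)
  go (inj₂ e) b≢t a<t = ℕₚ.<-trans (ℕₚ.≤-reflexive (≡.sym e)) a<t

-- A scalar outside K₀ and the vectors u + w x.

module Irrational {c ℓ p} (K : DivisionRing c ℓ) (K₀ : SubDivisionRing K p) (em : ExcludedMiddle (c ⊔ ℓ ⊔ p))
                  (x : DivisionRing.Carrier K) (x∉ : ¬ SubDivisionRing.In K₀ x) where
  open LinearAlgebra K K₀ em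
  open DivisionRing K hiding (zero)
  open SubDivisionRing K₀
  open LinAlg K K₀

  x≉0 : ¬ (x ≈ 0#)
  x≉0 h = x∉ (resp (sym h) 0∈)

  x*≈0 : ∀ {a} → x * a ≈ 0# → a ≈ 0#
  x*≈0 {a} h with inverse x x≉0
  ... | s , _ , sx≈1 = trans (sym (*-identityˡ a)) (trans (*-congʳ (sym sx≈1)) (trans (*-assoc s x a) (trans (*-congˡ h) (zeroʳ s))))

  leftIndep-x1 : LeftIndep (x ∷ 1# ∷ [])
  leftIndep-x1 = leftIndep-∷ {b = 1# ∷ []} (leftIndep-∷ {b = []} (λ _ _ _ ()) (λ (_ , _ , 0≈1) → 0≉1 0≈1))
    (λ (a , ain , e) → x∉ (resp (trans (sym (trans (+-identityʳ _) (*-identityʳ _))) e) (ain fzero)))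

  -- `RS-parts` accepts every decomposition, so the explicit one with scalars x and 1 and parts w
  -- and u can be used.
  RS-split : ∀ {a I} {P : Vect I → Set a} {u w : Vect I} → Sub P → RatVec u → RatVec w → RS P (u +v w · x) → P u × P w
  RS-split {I = I} {u = u} {w} S ru rw h = RS-parts S h D (fsuc fzero) , RS-parts S h D fzero
    where
    D : Decomposition (u +v w · x)
    D = record
      { coef = x ∷ 1# ∷ [] ; part = w ∷ u ∷ [] ; indep = leftIndep-x1
      ; rat = λ { fzero → rw ; (fsuc fzero) → ru }
      ; v≈ = λ i → trans (+-comm _ _) (+-congʳ (trans (+-identityʳ _) (*-identityʳ _))) }

-- Point-hyperplane flags of A_n.

module ProjectiveSpace {c ℓ p} (K : DivisionRing c ℓ) (K₀ : SubDivisionRing K p)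
                       (em : ExcludedMiddle (c ⊔ ℓ ⊔ p)) (m : ℕ) where
  open LinearAlgebra K K₀ em
  open Lines K K₀ em
  open DivisionRing K hiding (zero)
  open SubDivisionRing K₀
  open LinAlg K K₀
  open Sub

  n : ℕ
  n = suc (suc (suc m))
  open GeometryDefs (BuildingA n)
  open Splitting (BuildingA n)

  J : Fin n → Set
  J = J-A-1n n

  open PLGeometry (Gr J)

  fin : Finite (Fin (suc n))
  fin = record { size = suc n ; enc = λ i → i ; dec = λ i → i ; dec∘enc = λ _ → ≡.refl }

  last : Fin n
  last = fromℕ (suc (suc m))

  last∈J : suc (toℕ last) ≡ n
  last∈J = ≡.cong suc (Finₚ.toℕ-fromℕ (suc (suc m)))

  -- A node t with `suc (toℕ t) ≡ n` is not given by a constructor. It is identified with `last` and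
  -- its membership proof is normalized once here, so that statements about flags reduce to the
  -- point and the hyperplane.
  J-elim : ∀ {a} (Q : ∀ t → J t → Set a) → Q fzero (inj₁ ≡.refl) → Q last (inj₂ last∈J) → ∀ t p → Q t p
  J-elim Q first final fzero    (inj₁ ≡.refl) = first
  J-elim Q first final (fsuc _) (inj₁ ())
  J-elim Q first final t        (inj₂ e) with Finₚ.toℕ-injective {i = t} {j = last} (ℕₚ.suc-injective (≡.trans e (≡.sym last∈J)))
  ... | ≡.refl = ≡.subst (λ e → Q last (inj₂ e)) (ℕₚ.≡-irrelevant last∈J e) final

  point : Flag J → Frame 1 (Fin (suc n))
  point F = proj₁ (proj₁ F fzero (inj₁ ≡.refl))

  point-ind : ∀ F → Indep (point F)
  point-ind F = proj₂ (proj₁ F fzero (inj₁ ≡.refl))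

  hyperplane : Flag J → Frame (suc (toℕ last)) (Fin (suc n))
  hyperplane F = proj₁ (proj₁ F last (inj₂ last∈J))

  hyperplane-ind : ∀ F → Indep (hyperplane F)
  hyperplane-ind F = proj₂ (proj₁ F last (inj₂ last∈J))

  Near : Flag J → Set (c ⊔ ℓ ⊔ p)
  Near F = RS (InSpan (hyperplane F)) (point F fzero)

  point∈ : ∀ F → InSpan (hyperplane F) (point F fzero)
  point∈ F = SymIncl⇒⊑ {C = point F} {B = hyperplane F} (point-ind F) (hyperplane-ind F) (s≤s z≤n)
    (proj₂ F fzero last (inj₁ ≡.refl) (inj₂ last∈J)) fzero

  suc-toℕ≤last : ∀ (t : Fin n) → suc (toℕ t) ≤ suc (toℕ last)
  suc-toℕ≤last t = ℕₚ.≤-trans (Finₚ.toℕ<n t) (ℕₚ.≤-reflexive (≡.sym last∈J))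

  -- In every clause the rational element lies between the point and the hyperplane, and it is
  -- spanned by its rational vectors.
  NearlyRational⇒Near : ∀ F → NearlyRational J F → Near F
  NearlyRational⇒Near F (inj₁ (t , p , r)) = J-elim (λ t p → RatSpace (proj₁ (proj₁ F t p)) → Near F)
    (λ r → RS-mono (λ h → span-mono {B = point F} {C = hyperplane F} (λ { fzero → point∈ F }) h)
             (RatSpace⇒RS {B = point F} r (gen (point F) fzero)))
    (λ r → RatSpace⇒RS {B = hyperplane F} r (point∈ F)) t p r
  NearlyRational⇒Near F (inj₂ (t , _ , (X , indX) , r , inc)) = RS-mono (span-mono {B = X} {C = hyperplane F}
      (SymIncl⇒⊑ {C = X} {B = hyperplane F} indX (hyperplane-ind F) (suc-toℕ≤last t) (inc last (inj₂ last∈J))))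
    (RatSpace⇒RS {B = X} r (SymIncl⇒⊑ {C = point F} {B = X} (point-ind F) indX (s≤s z≤n)
      (SymIncl-sym {C = X} {B = point F} (inc fzero (inj₁ ≡.refl))) fzero))

  inner-splits : ∀ t → 0 < toℕ t → toℕ t < toℕ last → Splits J t
  inner-splits t 0<t t<last = separates⇒Splits (below t)
    (λ { (inj₁ e) → ℕₚ.<⇒≢ 0<t (≡.sym e) ; (inj₂ e) → ℕₚ.<⇒≢ t<last (ℕₚ.suc-injective (≡.trans e (≡.sym last∈J))) })
    below-path {fzero} {last} (inj₁ ≡.refl) (inj₂ last∈J) differ
    where
    differ : ¬ (below t fzero ≡ below t last)
    differ eq with ≡.trans (≡.sym (dec-true (0 ℕ.<? toℕ t) 0<t)) (≡.trans eq (dec-false (toℕ last ℕ.<? toℕ t) (ℕₚ.<-asym t<last)))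
    ... | ()

  Near⇒NearlyRational : ∀ F → Near F → NearlyRational J F
  Near⇒NearlyRational F near = go dim frame ind ratl inside (RS-span near)
    where
    open RatBasis (ratBasis fin (InSpan (hyperplane F)))
    go : ∀ d (C : Frame d (Fin (suc n))) → Indep C → (∀ k → RatVec (C k)) → C ⊑ hyperplane F → InSpan C (point F fzero) →
         NearlyRational J F
    go zero C indC ratC C⊑ p∈ = contradiction (steinitz {C = point F} {B = C} (point-ind F) λ { fzero → p∈ }) λ ()
    go (suc zero) C indC ratC C⊑ p∈ = inj₁ (fzero , inj₁ ≡.refl , basis⇒RatSpace {B = point F} {C = C} (point-ind F) indC ratC
        p⊑C (span-full {C = point F} {B = C} (point-ind F) p⊑C ℕₚ.≤-refl))
      where
      p⊑C : point F ⊑ C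
      p⊑C fzero = p∈
    -- Dimension e + 2 belongs to index e + 1. Below `last` this is an inner node, which splits J;
    -- from `last` on, the hull fills the hyperplane.
    go (suc (suc e)) C indC ratC C⊑ p∈ with suc e ℕ.<? toℕ last
    ... | no e≮ = inj₁ (last , inj₂ last∈J , basis⇒RatSpace {B = hyperplane F} {C = C} (hyperplane-ind F) indC ratC
                    (span-full {C = C} {B = hyperplane F} indC C⊑ (s≤s (ℕₚ.≮⇒≥ e≮))) C⊑)
    ... | yes e< = at (fromℕ< e<n) (Finₚ.toℕ-fromℕ< e<n)
      where
      e<n : suc e < n
      e<n = ℕₚ.<-≤-trans e< (ℕₚ.<⇒≤ (Finₚ.toℕ<n last))
      at : ∀ t → toℕ t ≡ suc e → NearlyRational J F
      at t eq with toℕ t in t≡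
      at t ≡.refl | .(suc e) = inj₂ (t , inner-splits t (≡.subst (0 <_) (≡.sym t≡) (s≤s z≤n)) (≡.subst (_< toℕ last) (≡.sym t≡) e<) , elem)
        where
        elem : Σ (Geometry.Elem (BuildingA n) t) λ X → RatSpace (proj₁ X) × (∀ s (q : J s) → SymIncl (proj₁ X) (proj₁ (proj₁ F s q)))
        elem = ≡.subst (λ d → Σ (Σ (Frame (suc d) (Fin (suc n))) Indep) λ X → RatSpace (proj₁ X) × (∀ s (q : J s) → SymIncl (proj₁ X) (proj₁ (proj₁ F s q))))
          (≡.sym t≡) ((C , indC) , basis⇒RatSpace {B = C} {C = C} indC indC ratC (gen C) (gen C) ,
            J-elim (λ s q → SymIncl C (proj₁ (proj₁ F s q))) (inj₂ λ { fzero → p∈ }) (inj₁ C⊑))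

  line-subspace : IsSubspace (Gr J) (NearlyRational J)
  line-subspace (j , j∈J , LF) x y z = J-elim (λ j j∈J → (LF : Flag (LineType J j)) → let L = j , j∈J , LF in
    x I L → y I L → z I L → ¬ (x ≈P y) → NearlyRational J x → NearlyRational J y → NearlyRational J z) points hyperplanes j j∈J LF
    where
    ≈P-intro : SameSpan (point x) (point y) → SameSpan (hyperplane x) (hyperplane y) → x ≈P y
    ≈P-intro = J-elim (λ t p → SameSpan (proj₁ (proj₁ x t p)) (proj₁ (proj₁ y t p)))

    points : (LF : Flag (LineType J fzero)) → let L = fzero , inj₁ ≡.refl , LF in
      x I L → y I L → z I L → ¬ (x ≈P y) → NearlyRational J x → NearlyRational J y → NearlyRational J z
    points LF xI yI zI x≉y nx ny = Near⇒NearlyRational z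
      (collinear∈ {P₁ = point x} {point y} {point z} {M} (point-ind x) (point-ind y)
        (λ h → x≉y (≈P-intro h (same x y yI (hyperplane∼ x xI)))) (⊑M x xI) (⊑M y yI) (⊑M z zI)
        (RS-sub fin (InSpan (hyperplane z)))
        (transport x xI (NearlyRational⇒Near x nx)) (transport y yI (NearlyRational⇒Near y ny)))
      where
      M : Frame 2 (Fin (suc n))
      M = proj₁ (proj₁ LF (fsuc fzero) (inj₂ (inj₁ ≡.refl)))
      H : Frame (suc (toℕ last)) (Fin (suc n))
      H = proj₁ (proj₁ LF last (inj₁ (inj₂ last∈J , λ ())))
      L : Ln
      L = fzero , inj₁ ≡.refl , LF
      ⊑M : ∀ F → F I L → point F ⊑ M
      ⊑M F FI = SymIncl⇒⊑ {C = point F} {B = M} (point-ind F) (proj₂ (proj₁ LF (fsuc fzero) (inj₂ (inj₁ ≡.refl)))) (s≤s z≤n)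
        (FI fzero (fsuc fzero) (inj₁ ≡.refl) (inj₂ (inj₁ ≡.refl)))
      hyperplane∼ : ∀ F → F I L → SameSpan (hyperplane F) H
      hyperplane∼ F FI = SymIncl⇒SameSpan {B = hyperplane F} {C = H} (hyperplane-ind F) (proj₂ (proj₁ LF last (inj₁ (inj₂ last∈J , λ ()))))
        (FI last last (inj₂ last∈J) (inj₁ (inj₂ last∈J , λ ())))
      same : ∀ F F′ → F′ I L → SameSpan (hyperplane F) H → SameSpan (hyperplane F) (hyperplane F′)
      same F F′ F′I s = SameSpan-trans {B = hyperplane F} {C = H} {D = hyperplane F′} s
        (SameSpan-sym {B = hyperplane F′} {C = H} (hyperplane∼ F′ F′I))
      transport : ∀ F {v} → F I L → RS (InSpan (hyperplane F)) v → RS (InSpan (hyperplane z)) v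
      transport F FI = RS-mono (span-mono {B = hyperplane F} {C = hyperplane z} (proj₁ (same F z zI (hyperplane∼ F FI))))

    hyperplanes : (LF : Flag (LineType J last)) → let L = last , inj₂ last∈J , LF in
      x I L → y I L → z I L → ¬ (x ≈P y) → NearlyRational J x → NearlyRational J y → NearlyRational J z
    hyperplanes LF xI yI zI x≉y nx ny = Near⇒NearlyRational z
      (RS-mono (λ (h₁ , h₂) → span-mono {B = W} {C = hyperplane z} (W⊑ z zI)
          (meet-hyperplanes {H₁ = hyperplane x} {H₂ = hyperplane y} {W = W} (≡.cong suc adj) (hyperplane-ind x) (hyperplane-ind y) W-ind
            (λ h → x≉y (≈P-intro (same x y yI (point∼ x xI)) h)) (W⊑ x xI) (W⊑ y yI) h₁ h₂))
        (RS-∩ fin (InSpan-sub (hyperplane x)) (InSpan-sub (hyperplane y))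
          (transport x xI (NearlyRational⇒Near x nx)) (transport y yI (NearlyRational⇒Near y ny))))
      where
      L : Ln
      L = last , inj₂ last∈J , LF
      t : Fin n
      t = inject₁ (fromℕ (suc m))
      adj : toℕ last ≡ suc (toℕ t)
      adj = ≡.cong suc (≡.sym (Finₚ.toℕ-inject₁ (fromℕ (suc m))))
      W : Frame (suc (toℕ t)) (Fin (suc n))
      W = proj₁ (proj₁ LF t (inj₂ (inj₂ adj)))
      W-ind : Indep W
      W-ind = proj₂ (proj₁ LF t (inj₂ (inj₂ adj)))
      P : Frame 1 (Fin (suc n))
      P = proj₁ (proj₁ LF fzero (inj₁ (inj₁ ≡.refl , λ ())))
      W⊑ : ∀ F → F I L → W ⊑ hyperplane F
      W⊑ F FI = SymIncl⇒⊑ {C = W} {B = hyperplane F} W-ind (hyperplane-ind F) (suc-toℕ≤last t)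
        (SymIncl-sym {C = hyperplane F} {B = W} (FI last t (inj₂ last∈J) (inj₂ (inj₂ adj))))
      point∼ : ∀ F → F I L → SameSpan (point F) P
      point∼ F FI = SymIncl⇒SameSpan {B = point F} {C = P} (point-ind F) (proj₂ (proj₁ LF fzero (inj₁ (inj₁ ≡.refl , λ ()))))
        (FI fzero fzero (inj₁ ≡.refl) (inj₁ (inj₁ ≡.refl , λ ())))
      same : ∀ F F′ → F′ I L → SameSpan (point F) P → SameSpan (point F) (point F′)
      same F F′ F′I s = SameSpan-trans {B = point F} {C = P} {D = point F′} s
        (SameSpan-sym {B = point F′} {C = P} (point∼ F′ F′I))
      transport : ∀ F → F I L → Near F → RS (InSpan (hyperplane F)) (point z fzero)
      transport F FI near = span∈ (RS-sub fin (InSpan (hyperplane F))) {B = point F} (λ { fzero → near })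
        (proj₂ (same F z zI (point∼ F FI)) fzero)

  module _ (x : Carrier) (x∉ : ¬ In x) where
    open Irrational K K₀ em x x∉

    u w : Vect (Fin (suc n))
    u = δ fzero
    w = δ (fsuc fzero)

    -- The hyperplane with equation v₁ = x v₀, counting coordinates from 0.
    H : Frame n (Fin (suc n))
    H = (u +v w · x) ∷ λ k i → δ i (fsuc (fsuc k))

    lincomb-H : ∀ γ → (lincomb H γ fzero ≈ γ fzero) × (lincomb H γ (fsuc fzero) ≈ x * γ fzero) ×
                      (∀ k → lincomb H γ (fsuc (fsuc k)) ≈ γ (fsuc k))
    lincomb-H γ =
      trans (+-cong (trans (*-congʳ (trans (+-congˡ (zeroˡ x)) (+-identityʳ 1#))) (*-identityˡ _)) (∑-zero (λ k → zeroˡ (γ (fsuc k))))) (+-identityʳ _) ,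
      trans (+-cong (*-congʳ (trans (+-congˡ (*-identityˡ x)) (+-identityˡ x))) (∑-zero (λ k → zeroˡ (γ (fsuc k))))) (+-identityʳ _) ,
      λ k → trans (+-cong (trans (*-congʳ (trans (+-congˡ (zeroˡ x)) (+-identityʳ 0#))) (zeroˡ _)) (∑-δ k (γ ∘ fsuc))) (+-identityˡ _)

    H-ind : Indep H
    H-ind γ e fzero    = trans (sym (proj₁ (lincomb-H γ))) (e fzero)
    H-ind γ e (fsuc k) = trans (sym (proj₂ (proj₂ (lincomb-H γ)) k)) (e (fsuc (fsuc k)))

    u∉H : ¬ InSpan H u
    u∉H (γ , e) = 0≉1 (trans (sym (x*≈0 (trans (sym (proj₁ (proj₂ (lincomb-H γ)))) (e (fsuc fzero)))))
                        (trans (sym (proj₁ (lincomb-H γ))) (e fzero)))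

    P : Frame 1 (Fin (suc n))
    P _ = u +v w · x

    P⊑H : P ⊑ H
    P⊑H _ = gen H fzero

    P-ind : Indep P
    P-ind γ e fzero = trans (sym (proj₁ (lincomb-H (γ fzero ∷ λ _ → 0#)))) (trans (+-congˡ (∑-zero {suc (suc m)} (λ k → zeroʳ (δ {suc n} fzero (fsuc (fsuc k)))))) (e fzero))

    -- The index of the hyperplane is known only through an equation, so H has to be transported.
    -- Recording the span of the result lets incidence be proved for spans, away from the transport.
    elem : ∀ t → J t → Σ (Geometry.Elem (BuildingA n) t) λ X → SameSpan (proj₁ X) P ⊎ SameSpan (proj₁ X) H
    elem fzero    (inj₁ ≡.refl) = (P , P-ind) , inj₁ (SameSpan-refl P)
    elem (fsuc _) (inj₁ ())
    elem t        (inj₂ e)      = cast e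
      where
      cast : ∀ {d} → d ≡ n → Σ (Σ (Frame d (Fin (suc n))) Indep) λ X → SameSpan (proj₁ X) P ⊎ SameSpan (proj₁ X) H
      cast ≡.refl = (H , H-ind) , inj₂ (SameSpan-refl H)

    ⊑H : ∀ {d} {X : Frame d (Fin (suc n))} → SameSpan X P ⊎ SameSpan X H → X ⊑ H
    ⊑H         (inj₁ (X⊑P , _)) k = span-mono {B = P} {C = H} P⊑H (X⊑P k)
    ⊑H         (inj₂ (X⊑H , _))   = X⊑H

    irrational-flag : Flag J
    irrational-flag = (λ t p → proj₁ (elem t p)) , λ s t p q → inc (proj₂ (elem s p)) (proj₂ (elem t q))
      where
      inc : ∀ {d e} {X : Frame d (Fin (suc n))} {Y : Frame e (Fin (suc n))} →
            SameSpan X P ⊎ SameSpan X H → SameSpan Y P ⊎ SameSpan Y H → SymIncl X Y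
      inc {X = X} {Y} hX (inj₂ (_ , H⊑Y)) = inj₁ λ k → span-mono {B = H} {C = Y} H⊑Y (⊑H {X = X} hX k)
      inc {X = X} {Y} (inj₂ (_ , H⊑X)) hY = inj₂ λ k → span-mono {B = H} {C = X} H⊑X (⊑H {X = Y} hY k)
      inc {X = X} {Y} (inj₁ (X⊑P , _)) (inj₁ (_ , P⊑Y)) = inj₁ λ k → span-mono {B = P} {C = Y} P⊑Y (X⊑P k)

    irrational-far : ¬ NearlyRational J irrational-flag
    irrational-far nr = u∉H (proj₁ (RS-split {u = u} {w = w} (InSpan-sub H) (δ-in fzero) (δ-in (fsuc fzero))
      (RS-mono (span-mono {B = hyperplane irrational-flag} {C = H} (⊑H {X = hyperplane irrational-flag} (proj₂ (elem last (inj₂ last∈J)))))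
        (NearlyRational⇒Near irrational-flag nr))))

  omega : (Σ Carrier λ x → ¬ In x) → OmegaProperSubspace J
  omega (x , x∉) = line-subspace , irrational-flag x x∉ , irrational-far x x∉

module PolarSpace {c ℓ p} (K : DivisionRing c ℓ) (K₀ : SubDivisionRing K p)
                  (em : ExcludedMiddle (c ⊔ ℓ ⊔ p)) (comm : IsCommutative K) (k : ℕ) where
  open LinearAlgebra K K₀ em
  open Lines K K₀ em
  open PolarLines comm
  open Quadratic K K₀ em comm
  open OrthogonalSpaces K K₀ em comm
  open DivisionRing K hiding (zero)
  open SubDivisionRing K₀
  open LinAlg K K₀
  open Sub
  open Max using (frame; ind; ts; _∋_; sub; ∋-b)

  n : ℕ
  n = suc (suc (suc k))

  open Geometry (BuildingD n) using (Elem)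
  open GeometryDefs (BuildingD n)
  open Splitting (BuildingD n)

  fin : Finite (VD n)
  fin = VD-finite n

  last : Fin (suc k)
  last = fromℕ k

  last-adj : suc (toℕ last) ≡ suc k
  last-adj = ≡.cong suc (Finₚ.toℕ-fromℕ k)

  adj⇒last : ∀ {i : Fin (suc k)} → suc (toℕ i) ≡ suc k → i ≡ last
  adj⇒last e = Finₚ.toℕ-injective (ℕₚ.suc-injective (≡.trans e (≡.sym last-adj)))

  -- Nodes 2, ..., n - 2 separate 1 from -. The labelling `below` is continued by `false` at both
  -- ends; `end` checks that this agrees with the label of node n - 2, which never precedes
  -- `fsuc i`.
  inner-splits : ∀ {J : DType n → Set} (i : Fin k) → ¬ J (sing (fsuc i)) → J (sing fzero) → J minus → Splits J (sing (fsuc i))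
  inner-splits i t∉J first∈J minus∈J = separates⇒Splits side t∉J invariant {sing fzero} {minus} first∈J minus∈J λ ()
    where
    side : DType n → Bool
    side (sing j) = below (fsuc i) j
    side plus     = false
    side minus    = false
    end : ∀ {j} → suc (toℕ j) ≡ suc k → below (fsuc i) j ≡ false
    end {j} e = dec-false (toℕ j ℕ.<? suc (toℕ i)) λ j<t → ℕₚ.<-irrefl ≡.refl
      (ℕₚ.<-≤-trans (≡.subst (_< suc (toℕ i)) (ℕₚ.suc-injective e) j<t) (Finₚ.toℕ<n i))
    invariant : ∀ {a b} → ¬ (a ≡ sing (fsuc i)) → ¬ (b ≡ sing (fsuc i)) → AdjD a b → side a ≡ side b
    invariant {sing a} {sing b} a≢ b≢ adj = below-path (a≢ ∘ ≡.cong sing) (b≢ ∘ ≡.cong sing) adj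
    invariant {sing a} {plus}   a≢ b≢ adj = end adj
    invariant {sing a} {minus}  a≢ b≢ adj = end adj
    invariant {plus}   {sing b} a≢ b≢ adj = ≡.sym (end adj)
    invariant {minus}  {sing b} a≢ b≢ adj = ≡.sym (end adj)

  last-splits : Splits (J-D-pm n) (sing last)
  last-splits = separates⇒Splits side (λ { (inj₁ ()) ; (inj₂ ()) }) invariant {plus} {minus} (inj₁ ≡.refl) (inj₂ ≡.refl) λ ()
    where
    side : DType n → ℕ
    side (sing j) = 0
    side plus     = 1
    side minus    = 2
    invariant : ∀ {a b} → ¬ (a ≡ sing last) → ¬ (b ≡ sing last) → AdjD a b → side a ≡ side b
    invariant {sing a} {sing b} a≢ b≢ adj = ≡.refl
    invariant {sing a} {plus}   a≢ b≢ adj = contradiction (≡.cong sing (adj⇒last adj)) a≢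
    invariant {sing a} {minus}  a≢ b≢ adj = contradiction (≡.cong sing (adj⇒last adj)) a≢
    invariant {plus}   {sing b} a≢ b≢ adj = contradiction (≡.cong sing (adj⇒last adj)) b≢
    invariant {minus}  {sing b} a≢ b≢ adj = contradiction (≡.cong sing (adj⇒last adj)) b≢

  -- As long as node n - 2 remains, + and - are both adjacent to it.
  only-last-splits : ∀ {i} → Splits (J-D-pm n) (sing i) → i ≡ last
  only-last-splits {i} (_ , connected) with i Finₚ.≟ last
  ... | yes h = h
  ... | no i≢last = contradiction (sing last , last≢i , λ
        { plus (inj₁ _) → step last≢i last-adj (here λ ())
        ; minus (inj₂ _) → step last≢i last-adj (here λ ())
        ; plus (inj₂ ()) ; minus (inj₁ ()) ; (sing _) (inj₁ ()) ; (sing _) (inj₂ ()) }) connected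
    where
    last≢i : ¬ (sing last ≡ sing i)
    last≢i ≡.refl = i≢last ≡.refl

  -- The path 1, ..., n - 2, - avoids +. This matters because a rational member of 𝔖⁺ incident with
  -- the flag is not contained in its element of type -, so it would not place the point in the
  -- rational hull of that element.
  plus-splits-not : ¬ Splits (J-D-1m n) plus
  plus-splits-not (_ , connected) = connected (sing fzero , (λ ()) , λ
      { (sing fzero) (inj₁ _) → here (λ ()) ; minus (inj₂ _) → path k fzero ≡.refl
      ; (sing (fsuc _)) (inj₁ ()) ; (sing _) (inj₂ ()) ; plus (inj₁ ()) ; plus (inj₂ ()) ; minus (inj₁ ()) })
    where
    path : ∀ d (i : Fin (suc k)) → toℕ i ℕ.+ d ≡ k → Reach plus (sing i) minus
    path zero    i e = step (λ ()) (≡.cong suc (≡.trans (≡.sym (ℕₚ.+-identityʳ (toℕ i))) e)) (here λ ())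
    path (suc d) i e = step (λ ()) (inj₁ (Finₚ.toℕ-fromℕ< i<k))
        (path d (fromℕ< i<k) (≡.trans (≡.cong (ℕ._+ d) (Finₚ.toℕ-fromℕ< i<k)) (≡.trans (≡.sym (ℕₚ.+-suc (toℕ i) d)) e)))
      where
      i<k : suc (toℕ i) < suc k
      i<k = s≤s (≡.subst (suc (toℕ i) ≤_) (≡.trans (≡.sym (ℕₚ.+-suc (toℕ i) d)) e) (ℕₚ.m≤m+n (suc (toℕ i)) d))

  ⁺ : Elem plus → Max n
  ⁺ (X , ind , ts , _) = max X ind ts

  ⁻ : Elem minus → Max n
  ⁻ (X , ind , ts , _) = max X ind ts

  sing⊑ : ∀ {i} ((X , _) : Elem (sing i)) (Y : Max n) → SymIncl X (frame Y) → X ⊑ frame Y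
  sing⊑ {i} (X , indX , _) Y h = SymIncl⇒⊑ {C = X} {B = frame Y} indX (ind Y)
    (ℕₚ.≤-trans (Finₚ.toℕ<n i) (ℕₚ.m≤n⇒m≤1+n (ℕₚ.n≤1+n (suc k)))) h

  first⊑ : ∀ {i} ((P , _) : Elem (sing fzero)) ((X , _) : Elem (sing i)) → SymIncl P X → P ⊑ X
  first⊑ (P , indP , _) (X , indX , _) h = SymIncl⇒⊑ {C = P} {B = X} indP indX (s≤s z≤n) h

  same-type : ∀ t (X Y : Elem t) → Geometry.Inc (BuildingD n) X Y → SameSpan (proj₁ X) (proj₁ Y)
  same-type (sing i) (X , indX , _) (Y , indY , _) h = SymIncl⇒SameSpan {B = X} {C = Y} indX indY h
  same-type plus     (X , indX , _) (Y , indY , _) h = SymIncl⇒SameSpan {B = X} {C = Y} indX indY h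
  same-type minus    (X , indX , _) (Y , indY , _) h = SymIncl⇒SameSpan {B = X} {C = Y} indX indY h

  module OnLine (J : DType n → Set) (J-prop : ∀ {t} (p q : J t) → p ≡ q) where
    open PLGeometry (Gr J)

    at : (F : Flag J) → ∀ t → J t → Frame (dimD t) (VD n)
    at F t p = proj₁ (proj₁ F t p)

    same : ∀ (L : Ln) F F′ → F I L → F′ I L → ∀ {t} (p : J t) → ¬ (t ≡ proj₁ L) → SameSpan (at F t p) (at F′ t p)
    same (j , _ , LF) F F′ FI F′I {t} p t≢j = SameSpan-trans {B = at F t p} {C = proj₁ (proj₁ LF t t∈L)} {D = at F′ t p}
        (same-type t (proj₁ F t p) (proj₁ LF t t∈L) (FI t t p t∈L))
        (SameSpan-sym {B = at F′ t p} {C = proj₁ (proj₁ LF t t∈L)} (same-type t (proj₁ F′ t p) (proj₁ LF t t∈L) (F′I t t p t∈L)))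
      where
      t∈L : LineType J j t
      t∈L = inj₁ (p , t≢j)

    -- Points of a line of type j agree, up to span, at all other types, so distinct ones must
    -- differ at j. Elements of a flag are indexed by membership proofs, and `J-prop` identifies the
    -- proof carried by the line with that carried by the flag.
    differ : ∀ (L : Ln) F F′ → F I L → F′ I L → ¬ (F ≈P F′) → ¬ SameSpan (at F _ (proj₁ (proj₂ L))) (at F′ _ (proj₁ (proj₂ L)))
    differ L@(j , j∈J , LF) F F′ FI F′I F≉F′ h = F≉F′ go
      where
      go : F ≈P F′
      go t t∈J with em {Lift (c ⊔ ℓ ⊔ p) (t ≡ j)}
      ... | yes (lift ≡.refl) = ≡.subst (λ q → SameSpan (at F t q) (at F′ t q)) (J-prop j∈J t∈J) h
      ... | no t≢j = same L F F′ FI F′I t∈J (λ e → t≢j (lift e))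

  module Ends where
    J : DType n → Set
    J = J-D-pm n

    J-prop : ∀ {t} (p q : J t) → p ≡ q
    J-prop (inj₁ ≡.refl) (inj₁ ≡.refl) = ≡.refl
    J-prop (inj₂ ≡.refl) (inj₂ ≡.refl) = ≡.refl

    open OnLine J J-prop
    open PLGeometry (Gr J)

    X⁺ X⁻ : Flag J → Max n
    X⁺ F = ⁺ (proj₁ F plus (inj₁ ≡.refl))
    X⁻ F = ⁻ (proj₁ F minus (inj₂ ≡.refl))

    incident : ∀ F → IntDim (frame (X⁺ F)) (frame (X⁻ F)) (n ∸ 1)
    incident F = proj₂ F plus minus (inj₁ ≡.refl) (inj₂ ≡.refl)

    Near : Flag J → Set (c ⊔ ℓ ⊔ p)
    Near F = Near₂ (X⁺ F) (X⁻ F)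

    NearlyRational⇒Near : ∀ F → NearlyRational J F → Near F
    NearlyRational⇒Near F (inj₁ (plus , inj₁ ≡.refl , r))  = near₂ (inj₁ r)
    NearlyRational⇒Near F (inj₁ (minus , inj₂ ≡.refl , r)) = near₂ (inj₂ (inj₁ r))
    NearlyRational⇒Near F (inj₂ (plus , (∉J , _) , _))  = contradiction (inj₁ ≡.refl) ∉J
    NearlyRational⇒Near F (inj₂ (minus , (∉J , _) , _)) = contradiction (inj₂ ≡.refl) ∉J
    NearlyRational⇒Near F (inj₂ (sing i , spl , E@(X , indX , _) , (B , indB , (X⊑B , B⊑X) , ratB) , inc)) with only-last-splits spl
    ... | ≡.refl = near₂ (inj₂ (inj₂ (suc (toℕ last) , ≡.cong (suc ∘ suc) last-adj , B , indB , ratB ,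
        (λ j → span-mono {B = X} {C = frame (X⁺ F)} (sing⊑ E (X⁺ F) (inc plus (inj₁ ≡.refl))) (B⊑X j)) ,
        (λ j → span-mono {B = X} {C = frame (X⁻ F)} (sing⊑ E (X⁻ F) (inc minus (inj₂ ≡.refl))) (B⊑X j)))))

    Near⇒NearlyRational : ∀ F → Near F → NearlyRational J F
    Near⇒NearlyRational F (near₂ (inj₁ r))        = inj₁ (plus , inj₁ ≡.refl , r)
    Near⇒NearlyRational F (near₂ (inj₂ (inj₁ r))) = inj₁ (minus , inj₂ ≡.refl , r)
    Near⇒NearlyRational F (near₂ (inj₂ (inj₂ (u , e , U , indU , ratU , U⊑X⁺ , U⊑X⁻))))
      with cast (≡.trans (ℕₚ.suc-injective (ℕₚ.suc-injective e)) (≡.sym last-adj)) indU ratU U⊑X⁺ U⊑X⁻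
      where
      cast : ∀ {u d} {U : Frame u (VD n)} → u ≡ d → Indep U → (∀ k → RatVec (U k)) → U ⊑ frame (X⁺ F) → U ⊑ frame (X⁻ F) →
             Σ (Frame d (VD n)) λ X → Indep X × RatSpace X × X ⊑ frame (X⁺ F) × X ⊑ frame (X⁻ F)
      cast {U = U} ≡.refl indU ratU U⊑X⁺ U⊑X⁻ =
        U , indU , basis⇒RatSpace {B = U} {C = U} indU indU ratU (gen U) (gen U) , U⊑X⁺ , U⊑X⁻
    ... | X , indX , ratX , X⊑X⁺ , X⊑X⁻ = inj₂ (sing last , last-splits ,
      (X , indX , TS-⊑ {B = X} {C = frame (X⁺ F)} X⊑X⁺ (ts (X⁺ F)) , lift tt) , ratX ,
      λ { plus (inj₁ ≡.refl) → inj₁ X⊑X⁺ ; minus (inj₂ ≡.refl) → inj₁ X⊑X⁻ })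

    -- The element that stays along the line is fixed only up to equal span. It is taken from x; the
    -- hypothesis at y is transported to it, and the conclusion is transported from it to z.
    line-subspace : IsSubspace (Gr J) (NearlyRational J)
    line-subspace L@(plus , inj₁ ≡.refl , LF) x y z xI yI zI x≉y nx ny = Near⇒NearlyRational z
      (Near₂-resp {X = X⁺ z} (SameSpan-refl (frame (X⁺ z))) (same L x z xI zI (inj₂ ≡.refl) (λ ()))
        (Near₂-line {Y₁ = X⁺ x} {X⁺ y} {X⁺ z} {X⁻ x} {W} (≡.cong (suc ∘ suc) last-adj) (proj₁ (proj₂ E))
          (W⊑ x xI) (W⊑ y yI) (W⊑ z zI) W⊑X⁻ (inj₁ (class x , class y)) (differ L x y xI yI x≉y)
          (incident x) (IntDim-respʳ {X = frame (X⁺ y)} y∼x (incident y)) (NearlyRational⇒Near x nx)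
          (Near₂-resp {X = X⁺ y} (SameSpan-refl (frame (X⁺ y))) y∼x (NearlyRational⇒Near y ny))))
      where
      E : Elem (sing last)
      E = proj₁ LF (sing last) (inj₂ last-adj)
      W : Frame (suc (toℕ last)) (VD n)
      W = proj₁ E
      W⊑ : ∀ F → F I L → W ⊑ frame (X⁺ F)
      W⊑ F FI = sing⊑ E (X⁺ F) (SymIncl-sym {C = frame (X⁺ F)} {B = W} (FI plus (sing last) (inj₁ ≡.refl) (inj₂ last-adj)))
      W⊑X⁻ : W ⊑ frame (X⁻ x)
      W⊑X⁻ = sing⊑ E (X⁻ x) (SymIncl-sym {C = frame (X⁻ x)} {B = W} (xI minus (sing last) (inj₂ ≡.refl) (inj₂ last-adj)))
      class : ∀ F → ClassPlus n (frame (X⁺ F))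
      class F = proj₂ (proj₂ (proj₂ (proj₁ F plus (inj₁ ≡.refl))))
      y∼x : SameSpan (frame (X⁻ y)) (frame (X⁻ x))
      y∼x = same L y x yI xI (inj₂ ≡.refl) (λ ())
    line-subspace L@(minus , inj₂ ≡.refl , LF) x y z xI yI zI x≉y nx ny = Near⇒NearlyRational z
      (Near₂-sym (Near₂-resp {X = X⁻ z} (SameSpan-refl (frame (X⁻ z))) (same L x z xI zI (inj₁ ≡.refl) (λ ()))
        (Near₂-line {Y₁ = X⁻ x} {X⁻ y} {X⁻ z} {X⁺ x} {W} (≡.cong (suc ∘ suc) last-adj) (proj₁ (proj₂ E))
          (W⊑ x xI) (W⊑ y yI) (W⊑ z zI) W⊑X⁺ (inj₂ (class x , class y)) (differ L x y xI yI x≉y)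
          (IntDim-sym {X = frame (X⁺ x)} {Y = frame (X⁻ x)} (incident x)) (IntDim-respʳ {X = frame (X⁻ y)} y∼x (IntDim-sym {X = frame (X⁺ y)} {Y = frame (X⁻ y)} (incident y))) (Near₂-sym (NearlyRational⇒Near x nx))
          (Near₂-resp {X = X⁻ y} (SameSpan-refl (frame (X⁻ y))) y∼x (Near₂-sym (NearlyRational⇒Near y ny))))))
      where
      E : Elem (sing last)
      E = proj₁ LF (sing last) (inj₂ last-adj)
      W : Frame (suc (toℕ last)) (VD n)
      W = proj₁ E
      W⊑ : ∀ F → F I L → W ⊑ frame (X⁻ F)
      W⊑ F FI = sing⊑ E (X⁻ F) (SymIncl-sym {C = frame (X⁻ F)} {B = W} (FI minus (sing last) (inj₂ ≡.refl) (inj₂ last-adj)))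
      W⊑X⁺ : W ⊑ frame (X⁺ x)
      W⊑X⁺ = sing⊑ E (X⁺ x) (SymIncl-sym {C = frame (X⁺ x)} {B = W} (xI plus (sing last) (inj₁ ≡.refl) (inj₂ last-adj)))
      class : ∀ F → ClassMinus n (frame (X⁻ F))
      class F = proj₂ (proj₂ (proj₂ (proj₁ F minus (inj₂ ≡.refl))))
      y∼x : SameSpan (frame (X⁺ y)) (frame (X⁺ x))
      y∼x = same L y x yI xI (inj₁ ≡.refl) (λ ())

module PolarSpaceRank4 {c ℓ p} (K : DivisionRing c ℓ) (K₀ : SubDivisionRing K p)
                       (em : ExcludedMiddle (c ⊔ ℓ ⊔ p)) (comm : IsCommutative K) (m : ℕ) where
  open LinearAlgebra K K₀ em
  open Lines K K₀ em
  open PolarLines comm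
  open Quadratic K K₀ em comm
  open OrthogonalSpaces K K₀ em comm
  open PolarSpace K K₀ em comm (suc m)
  open DivisionRing K hiding (zero)
  open SubDivisionRing K₀
  open LinAlg K K₀
  open Sub
  open Max using (frame; ind; ts; _∋_; sub; ∋-b)
  open Geometry (BuildingD n) using (Elem)
  open GeometryDefs (BuildingD n)
  open Splitting (BuildingD n)

  inner-element : ∀ {P : Vect (VD n) → Set (c ⊔ ℓ)} {v} (i : Fin (suc m)) → (∀ {u} → P u → q u ≈ 0#) → Sub P →
                  RatBetween (suc (toℕ i)) P v →
                  Σ (Elem (sing (fsuc i))) λ E → RatSpace (proj₁ E) × InSpan (proj₁ E) v × (∀ k → P (proj₁ E k))
  inner-element i P-q P-sub (X , indX , ratX , v∈ , X⊂P) =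
    (X , indX , (λ γ → P-q (lincomb∈ P-sub X⊂P γ)) , lift tt) , basis⇒RatSpace {B = X} {C = X} indX indX ratX (gen X) (gen X) , v∈ , X⊂P

  module FirstLine (J : DType n → Set) (J-prop : ∀ {t} (p q : J t) → p ≡ q) (first∈J : J (sing fzero)) where
    open OnLine J J-prop public
    open PLGeometry (Gr J) public

    point : Flag J → Frame 1 (VD n)
    point F = at F (sing fzero) first∈J

    point-ind : ∀ F → Indep (point F)
    point-ind F = proj₁ (proj₂ (proj₁ F (sing fzero) first∈J))

    -- From n ≥ 4 on, node 1 has the neighbour 2, so a line that moves the point carries a
    -- 2-dimensional M containing all its points.
    first-line : ∀ (LF : Flag (LineType J (sing fzero))) (let L = sing fzero , first∈J , LF) x y z →
                 x I L → y I L → z I L → ¬ (x ≈P y) → ∀ {a} {S : Vect (VD n) → Set a} → Sub S →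
                 S (point x fzero) → S (point y fzero) → S (point z fzero)
    first-line LF x y z xI yI zI x≉y = collinear∈ {P₁ = point x} {point y} {point z} {M} (point-ind x) (point-ind y)
        (differ (sing fzero , first∈J , LF) x y xI yI x≉y) (⊑M x xI) (⊑M y yI) (⊑M z zI)
      where
      E : Elem (sing (fsuc fzero))
      E = proj₁ LF (sing (fsuc fzero)) (inj₂ (inj₁ ≡.refl))
      M : Frame 2 (VD n)
      M = proj₁ E
      ⊑M : ∀ F → F I (sing fzero , first∈J , LF) → point F ⊑ M
      ⊑M F FI = first⊑ (proj₁ F (sing fzero) first∈J) E (FI (sing fzero) (sing (fsuc fzero)) first∈J (inj₂ (inj₁ ≡.refl)))

  module PointMinus where
    J : DType n → Set
    J = J-D-1m n

    J-prop : ∀ {t} (p q : J t) → p ≡ q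
    J-prop {sing i} (inj₁ e)      (inj₁ e′)     = ≡.cong inj₁ (ℕₚ.≡-irrelevant e e′)
    J-prop          (inj₂ ≡.refl) (inj₂ ≡.refl) = ≡.refl

    open FirstLine J J-prop (inj₁ ≡.refl)

    X⁻ : Flag J → Max n
    X⁻ F = ⁻ (proj₁ F minus (inj₂ ≡.refl))

    point∈ : ∀ F → X⁻ F ∋ point F fzero
    point∈ F = sing⊑ (proj₁ F (sing fzero) (inj₁ ≡.refl)) (X⁻ F) (proj₂ F (sing fzero) minus (inj₁ ≡.refl) (inj₂ ≡.refl)) fzero

    Near : Flag J → Set (c ⊔ ℓ ⊔ p)
    Near F = RS (X⁻ F ∋_) (point F fzero)

    NearlyRational⇒Near : ∀ F → NearlyRational J F → Near F
    NearlyRational⇒Near F (inj₁ (sing fzero , inj₁ ≡.refl , r)) = RS-mono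
      (span∈ (sub (X⁻ F)) {B = point F} λ { fzero → point∈ F }) (RatSpace⇒RS {B = point F} r (gen (point F) fzero))
    NearlyRational⇒Near F (inj₁ (sing (fsuc _) , inj₁ () , _))
    NearlyRational⇒Near F (inj₁ (minus , inj₂ ≡.refl , r)) = RatSpace⇒RS {B = frame (X⁻ F)} r (point∈ F)
    NearlyRational⇒Near F (inj₂ (plus , spl , _)) = contradiction spl plus-splits-not
    NearlyRational⇒Near F (inj₂ (minus , (∉J , _) , _)) = contradiction (inj₂ ≡.refl) ∉J
    NearlyRational⇒Near F (inj₂ (sing i , _ , E@(X , _) , r , inc)) = RS-mono
      (span-mono {B = X} {C = frame (X⁻ F)} (sing⊑ E (X⁻ F) (inc minus (inj₂ ≡.refl))))
      (RatSpace⇒RS {B = X} r (first⊑ (proj₁ F (sing fzero) (inj₁ ≡.refl)) E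
        (SymIncl-sym {C = X} {B = point F} (inc (sing fzero) (inj₁ ≡.refl))) fzero))

    Near⇒NearlyRational : ∀ F → Near F → NearlyRational J F
    Near⇒NearlyRational F near with RS-trichotomy (X⁻ F) (λ h → h) {point F} (point-ind F) near
    ... | inj₁ r              = inj₁ (sing fzero , inj₁ ≡.refl , r)
    ... | inj₂ (inj₁ r)       = inj₁ (minus , inj₂ ≡.refl , r)
    ... | inj₂ (inj₂ (i , h)) with inner-element i (TS-q {B = frame (X⁻ F)} (ts (X⁻ F))) (sub (X⁻ F)) h
    ...   | E , r , p∈ , X⊂ = inj₂ (sing (fsuc i) , inner-splits i (λ { (inj₁ ()) ; (inj₂ ()) }) (inj₁ ≡.refl) (inj₂ ≡.refl) ,
        E , r , λ { (sing fzero) (inj₁ ≡.refl) → inj₂ λ { fzero → p∈ } ; (sing (fsuc _)) (inj₁ ()) ; minus (inj₂ ≡.refl) → inj₁ X⊂ })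

    line-subspace : IsSubspace (Gr J) (NearlyRational J)
    line-subspace (sing (fsuc _) , inj₁ () , _)
    line-subspace L@(sing fzero , inj₁ ≡.refl , LF) x y z xI yI zI x≉y nx ny = Near⇒NearlyRational z
        (first-line LF x y z xI yI zI x≉y (RS-sub fin (X⁻ z ∋_)) (transport x xI (NearlyRational⇒Near x nx)) (transport y yI (NearlyRational⇒Near y ny)))
      where
      transport : ∀ F → F I L → ∀ {v} → RS (X⁻ F ∋_) v → RS (X⁻ z ∋_) v
      transport F FI = RS-mono (span-mono {B = frame (X⁻ F)} {C = frame (X⁻ z)} (proj₁ (same L F z FI zI (inj₂ ≡.refl) (λ ()))))
    line-subspace L@(minus , inj₂ ≡.refl , LF) x y z xI yI zI x≉y nx ny = Near⇒NearlyRational z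
      (RS-mono (span-mono {B = W} {C = frame (X⁻ z)} (W⊑ z zI))
        (RS-meet (X⁻ x) (X⁻ y) (≡.cong (suc ∘ suc) last-adj) (proj₁ (proj₂ E)) (W⊑ x xI) (W⊑ y yI) (inj₂ (class x , class y))
          (differ L x y xI yI x≉y) (transport x xI (NearlyRational⇒Near x nx)) (transport y yI (NearlyRational⇒Near y ny))))
      where
      E : Elem (sing last)
      E = proj₁ LF (sing last) (inj₂ last-adj)
      W : Frame (suc (toℕ last)) (VD n)
      W = proj₁ E
      W⊑ : ∀ F → F I L → W ⊑ frame (X⁻ F)
      W⊑ F FI = sing⊑ E (X⁻ F) (SymIncl-sym {C = frame (X⁻ F)} {B = W} (FI minus (sing last) (inj₂ ≡.refl) (inj₂ last-adj)))
      class : ∀ F → ClassMinus n (frame (X⁻ F))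
      class F = proj₂ (proj₂ (proj₂ (proj₁ F minus (inj₂ ≡.refl))))
      transport : ∀ F → F I L → Near F → RS (X⁻ F ∋_) (point z fzero)
      transport F FI near = span∈ (RS-sub fin (X⁻ F ∋_)) {B = point F} (λ { fzero → near })
        (proj₂ (same L F z FI zI (inj₁ ≡.refl) (λ ())) fzero)

  module PointEnds where
    J : DType n → Set
    J = J-D-1pm n

    J-prop : ∀ {t} (p q : J t) → p ≡ q
    J-prop {sing i} (inj₁ e)      (inj₁ e′)     = ≡.cong inj₁ (ℕₚ.≡-irrelevant e e′)
    J-prop {sing i} (inj₁ _)      (inj₂ (inj₁ ()))
    J-prop {sing i} (inj₁ _)      (inj₂ (inj₂ ()))
    J-prop          (inj₂ (inj₁ ≡.refl)) (inj₂ (inj₁ ≡.refl)) = ≡.refl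
    J-prop          (inj₂ (inj₂ ≡.refl)) (inj₂ (inj₂ ≡.refl)) = ≡.refl

    open FirstLine J J-prop (inj₁ ≡.refl)

    X⁺ X⁻ : Flag J → Max n
    X⁺ F = ⁺ (proj₁ F plus (inj₂ (inj₁ ≡.refl)))
    X⁻ F = ⁻ (proj₁ F minus (inj₂ (inj₂ ≡.refl)))

    Both : Flag J → Vect (VD n) → Set (c ⊔ ℓ)
    Both F v = X⁺ F ∋ v × X⁻ F ∋ v

    Both-sub : ∀ F → Sub (Both F)
    Both-sub F = Sub-× (sub (X⁺ F)) (sub (X⁻ F))

    point∈ : ∀ F → Both F (point F fzero)
    point∈ F = sing⊑ (proj₁ F (sing fzero) (inj₁ ≡.refl)) (X⁺ F) (proj₂ F (sing fzero) plus (inj₁ ≡.refl) (inj₂ (inj₁ ≡.refl))) fzero ,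
               sing⊑ (proj₁ F (sing fzero) (inj₁ ≡.refl)) (X⁻ F) (proj₂ F (sing fzero) minus (inj₁ ≡.refl) (inj₂ (inj₂ ≡.refl))) fzero

    Near : Flag J → Set (c ⊔ ℓ ⊔ p)
    Near F = Near₁ (X⁺ F) (X⁻ F) (point F fzero)

    NearlyRational⇒Near : ∀ F → NearlyRational J F → Near F
    NearlyRational⇒Near F (inj₁ (sing fzero , inj₁ ≡.refl , r)) = near₁ (inj₂ (inj₂ (RS-mono
      (span∈ (Both-sub F) {B = point F} λ { fzero → point∈ F }) (RatSpace⇒RS {B = point F} r (gen (point F) fzero)))))
    NearlyRational⇒Near F (inj₁ (sing (fsuc _) , inj₁ () , _))
    NearlyRational⇒Near F (inj₁ (sing _ , inj₂ (inj₁ ()) , _))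
    NearlyRational⇒Near F (inj₁ (sing _ , inj₂ (inj₂ ()) , _))
    NearlyRational⇒Near F (inj₁ (plus , inj₂ (inj₁ ≡.refl) , r))  = near₁ (inj₁ r)
    NearlyRational⇒Near F (inj₁ (minus , inj₂ (inj₂ ≡.refl) , r)) = near₁ (inj₂ (inj₁ r))
    NearlyRational⇒Near F (inj₂ (plus , (∉J , _) , _))  = contradiction (inj₂ (inj₁ ≡.refl)) ∉J
    NearlyRational⇒Near F (inj₂ (minus , (∉J , _) , _)) = contradiction (inj₂ (inj₂ ≡.refl)) ∉J
    NearlyRational⇒Near F (inj₂ (sing i , _ , E@(X , _) , r , inc)) = near₁ (inj₂ (inj₂ (RS-mono
      (λ v∈ → span-mono {B = X} {C = frame (X⁺ F)} (sing⊑ E (X⁺ F) (inc plus (inj₂ (inj₁ ≡.refl)))) v∈ ,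
              span-mono {B = X} {C = frame (X⁻ F)} (sing⊑ E (X⁻ F) (inc minus (inj₂ (inj₂ ≡.refl)))) v∈)
      (RatSpace⇒RS {B = X} r (first⊑ (proj₁ F (sing fzero) (inj₁ ≡.refl)) E
        (SymIncl-sym {C = X} {B = point F} (inc (sing fzero) (inj₁ ≡.refl))) fzero)))))

    Near⇒NearlyRational : ∀ F → Near F → NearlyRational J F
    Near⇒NearlyRational F (near₁ (inj₁ r))        = inj₁ (plus , inj₂ (inj₁ ≡.refl) , r)
    Near⇒NearlyRational F (near₁ (inj₂ (inj₁ r))) = inj₁ (minus , inj₂ (inj₂ ≡.refl) , r)
    -- A hull of X⁺ ∩ X⁻ of dimension at least n - 1 is in particular a rational subspace of X⁺ of
    -- that dimension, so the third outcome can be reported as rationality of X⁺.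
    Near⇒NearlyRational F (near₁ (inj₂ (inj₂ near))) with RS-trichotomy (X⁺ F) proj₁ {point F} (point-ind F) near
    ... | inj₁ r              = inj₁ (sing fzero , inj₁ ≡.refl , r)
    ... | inj₂ (inj₁ r)       = inj₁ (plus , inj₂ (inj₁ ≡.refl) , r)
    ... | inj₂ (inj₂ (i , h)) with inner-element i (λ (h , _) → TS-q {B = frame (X⁺ F)} (ts (X⁺ F)) h) (Both-sub F) h
    ...   | E , r , p∈ , X⊂ = inj₂ (sing (fsuc i) ,
        inner-splits i (λ { (inj₁ ()) ; (inj₂ (inj₁ ())) ; (inj₂ (inj₂ ())) }) (inj₁ ≡.refl) (inj₂ (inj₂ ≡.refl)) , E , r ,
        λ { (sing fzero) (inj₁ ≡.refl) → inj₂ λ { fzero → p∈ } ; (sing (fsuc _)) (inj₁ ()) ; (sing _) (inj₂ (inj₁ ())) ; (sing _) (inj₂ (inj₂ ()))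
          ; plus (inj₂ (inj₁ ≡.refl)) → inj₁ (proj₁ ∘ X⊂) ; minus (inj₂ (inj₂ ≡.refl)) → inj₁ (proj₂ ∘ X⊂) })

    line-subspace : IsSubspace (Gr J) (NearlyRational J)
    line-subspace (sing (fsuc _) , inj₁ () , _)
    line-subspace (sing _ , inj₂ (inj₁ ()) , _)
    line-subspace (sing _ , inj₂ (inj₂ ()) , _)
    line-subspace L@(sing fzero , inj₁ ≡.refl , LF) x y z xI yI zI x≉y nx ny = Near⇒NearlyRational z
        (join (transport x xI (NearlyRational⇒Near x nx)) (transport y yI (NearlyRational⇒Near y ny)))
      where
      transport : ∀ F → F I L → Near F → Near₁ (X⁺ z) (X⁻ z) (point F fzero)
      transport F FI = Near₁-resp {P = point F} (same L F z FI zI (inj₂ (inj₁ ≡.refl)) (λ ())) (same L F z FI zI (inj₂ (inj₂ ≡.refl)) (λ ())) (gen (point F) fzero)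
      join : Near₁ (X⁺ z) (X⁻ z) (point x fzero) → Near₁ (X⁺ z) (X⁻ z) (point y fzero) → Near z
      join (near₁ (inj₁ r)) _ = near₁ (inj₁ r)
      join (near₁ (inj₂ (inj₁ r))) _ = near₁ (inj₂ (inj₁ r))
      join _ (near₁ (inj₁ r)) = near₁ (inj₁ r)
      join _ (near₁ (inj₂ (inj₁ r))) = near₁ (inj₂ (inj₁ r))
      join (near₁ (inj₂ (inj₂ r))) (near₁ (inj₂ (inj₂ s))) = near₁ (inj₂ (inj₂
        (first-line LF x y z xI yI zI x≉y (RS-sub fin (Both z)) r s)))
    line-subspace L@(plus , inj₂ (inj₁ ≡.refl) , LF) x y z xI yI zI x≉y nx ny = Near⇒NearlyRational z
      (Near₁-resp {X = X⁺ z} {P = point x} (SameSpan-refl (frame (X⁺ z))) (same L x z xI zI (inj₂ (inj₂ ≡.refl)) (λ ()))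
        (proj₂ (same L x z xI zI (inj₁ ≡.refl) (λ ())) fzero)
        (Near₁-line {Y₁ = X⁺ x} {X⁺ y} {X⁺ z} {X⁻ x} {W} (≡.cong (suc ∘ suc) last-adj) (proj₁ (proj₂ E))
          (W⊑ x xI) (W⊑ y yI) (W⊑ z zI) W⊑X⁻ (inj₁ (class x , class y)) (differ L x y xI yI x≉y)
          (proj₁ (point∈ x)) (span∈ (sub (X⁺ y)) {B = point y} (λ { fzero → proj₁ (point∈ y) }) x∈y) (NearlyRational⇒Near x nx)
          (Near₁-resp {X = X⁺ y} {P = point y} (SameSpan-refl (frame (X⁺ y))) (same L y x yI xI (inj₂ (inj₂ ≡.refl)) (λ ()))
            x∈y (NearlyRational⇒Near y ny))))
      where
      E : Elem (sing last)
      E = proj₁ LF (sing last) (inj₂ last-adj)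
      W : Frame (suc (toℕ last)) (VD n)
      W = proj₁ E
      W⊑ : ∀ F → F I L → W ⊑ frame (X⁺ F)
      W⊑ F FI = sing⊑ E (X⁺ F) (SymIncl-sym {C = frame (X⁺ F)} {B = W} (FI plus (sing last) (inj₂ (inj₁ ≡.refl)) (inj₂ last-adj)))
      W⊑X⁻ : W ⊑ frame (X⁻ x)
      W⊑X⁻ = sing⊑ E (X⁻ x) (SymIncl-sym {C = frame (X⁻ x)} {B = W} (xI minus (sing last) (inj₂ (inj₂ ≡.refl)) (inj₂ last-adj)))
      class : ∀ F → ClassPlus n (frame (X⁺ F))
      class F = proj₂ (proj₂ (proj₂ (proj₁ F plus (inj₂ (inj₁ ≡.refl)))))
      x∈y : InSpan (point y) (point x fzero)
      x∈y = proj₁ (same L x y xI yI (inj₁ ≡.refl) (λ ())) fzero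
    line-subspace L@(minus , inj₂ (inj₂ ≡.refl) , LF) x y z xI yI zI x≉y nx ny = Near⇒NearlyRational z
      (Near₁-sym (Near₁-resp {X = X⁻ z} {P = point x} (SameSpan-refl (frame (X⁻ z))) (same L x z xI zI (inj₂ (inj₁ ≡.refl)) (λ ()))
        (proj₂ (same L x z xI zI (inj₁ ≡.refl) (λ ())) fzero)
        (Near₁-line {Y₁ = X⁻ x} {X⁻ y} {X⁻ z} {X⁺ x} {W} (≡.cong (suc ∘ suc) last-adj) (proj₁ (proj₂ E))
          (W⊑ x xI) (W⊑ y yI) (W⊑ z zI) W⊑X⁺ (inj₂ (class x , class y)) (differ L x y xI yI x≉y)
          (proj₂ (point∈ x)) (span∈ (sub (X⁻ y)) {B = point y} (λ { fzero → proj₂ (point∈ y) }) x∈y) (Near₁-sym (NearlyRational⇒Near x nx))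
          (Near₁-resp {X = X⁻ y} {P = point y} (SameSpan-refl (frame (X⁻ y))) (same L y x yI xI (inj₂ (inj₁ ≡.refl)) (λ ()))
            x∈y (Near₁-sym (NearlyRational⇒Near y ny))))))
      where
      E : Elem (sing last)
      E = proj₁ LF (sing last) (inj₂ last-adj)
      W : Frame (suc (toℕ last)) (VD n)
      W = proj₁ E
      W⊑ : ∀ F → F I L → W ⊑ frame (X⁻ F)
      W⊑ F FI = sing⊑ E (X⁻ F) (SymIncl-sym {C = frame (X⁻ F)} {B = W} (FI minus (sing last) (inj₂ (inj₂ ≡.refl)) (inj₂ last-adj)))
      W⊑X⁺ : W ⊑ frame (X⁺ x)
      W⊑X⁺ = sing⊑ E (X⁺ x) (SymIncl-sym {C = frame (X⁺ x)} {B = W} (xI plus (sing last) (inj₂ (inj₁ ≡.refl)) (inj₂ last-adj)))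
      class : ∀ F → ClassMinus n (frame (X⁻ F))
      class F = proj₂ (proj₂ (proj₂ (proj₁ F minus (inj₂ (inj₂ ≡.refl)))))
      x∈y : InSpan (point y) (point x fzero)
      x∈y = proj₁ (same L x y xI yI (inj₁ ≡.refl) (λ ())) fzero

-- A flag of D_n that is not nearly rational.

module IrrationalFlag {c ℓ p} (K : DivisionRing c ℓ) (K₀ : SubDivisionRing K p)
                      (em : ExcludedMiddle (c ⊔ ℓ ⊔ p)) (comm : IsCommutative K) (k : ℕ)
                      (x : DivisionRing.Carrier K) (x∉ : ¬ SubDivisionRing.In K₀ x) where
  open LinearAlgebra K K₀ em
  open Lines K K₀ em
  open PolarLines comm
  open Quadratic K K₀ em comm
  open OrthogonalSpaces K K₀ em comm
  open PolarSpace K K₀ em comm k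
  open Irrational K K₀ em x x∉
  open DivisionRing K hiding (zero)
  open SubDivisionRing K₀
  open LinAlg K K₀
  open RingProperties ring
  open SetoidReasoning setoid
  open Sub
  open Max using (frame; ind; ts; _∋_; sub; ∋-b)
  open Geometry (BuildingD n) using (Elem)
  open GeometryDefs (BuildingD n)

  -- Y ε is spanned by e₁ + e₄ x, e₃ − e₂ x, one of e₅, e₆ (chosen by ε) and e₇, e₉, …: the coordinate i of the
  -- combination with coefficients γ is coef ε i * γ (idx i).
  idx : VD n → Fin n
  idx (fzero , fzero)        = fzero
  idx (fzero , fsuc _)       = fsuc fzero
  idx (fsuc fzero , fzero)   = fsuc fzero
  idx (fsuc fzero , fsuc _)  = fzero
  idx (fsuc (fsuc j) , _)    = fsuc (fsuc j)

  coef : Fin 2 → VD n → Carrier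
  coef ε (fzero , fzero)                  = 1#
  coef ε (fzero , fsuc _)                 = - x
  coef ε (fsuc fzero , fzero)             = 1#
  coef ε (fsuc fzero , fsuc _)            = x
  coef ε (fsuc (fsuc fzero) , e)          = δ ε e
  coef ε (fsuc (fsuc (fsuc j)) , fzero)   = 1#
  coef ε (fsuc (fsuc (fsuc j)) , fsuc _)  = 0#

  Y : Fin 2 → Frame n (VD n)
  Y ε j i = coef ε i * δ (idx i) j

  lincomb-Y : ∀ ε γ i → lincomb (Y ε) γ i ≈ coef ε i * γ (idx i)
  lincomb-Y ε γ i = begin
    ∑ (λ j → coef ε i * δ (idx i) j * γ j)     ≈⟨ ∑-cong {n} (λ j → *-assoc (coef ε i) (δ (idx i) j) (γ j)) ⟩
    ∑ (λ j → coef ε i * (δ (idx i) j * γ j))   ≈⟨ ∑-*ˡ {n} (coef ε i) (λ j → δ (idx i) j * γ j) ⟨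
    coef ε i * ∑ (λ j → δ (idx i) j * γ j)     ≈⟨ *-congˡ (∑-δ (idx i) γ) ⟩
    coef ε i * γ (idx i)                       ∎

  coordinate : ∀ {ε γ v} → lincomb (Y ε) γ ≈v v → ∀ i → v i ≈ coef ε i * γ (idx i)
  coordinate {ε} {γ} e i = trans (sym (e i)) (lincomb-Y ε γ i)

  pivot : Fin 2 → Fin n → VD n
  pivot ε fzero                  = fzero , fzero
  pivot ε (fsuc fzero)           = fsuc fzero , fzero
  pivot ε (fsuc (fsuc fzero))    = fsuc (fsuc fzero) , ε
  pivot ε (fsuc (fsuc (fsuc j))) = fsuc (fsuc (fsuc j)) , fzero

  at-pivot : ∀ {ε γ v} → lincomb (Y ε) γ ≈v v → ∀ j → v (pivot ε j) ≈ γ j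
  at-pivot {ε} {γ} e fzero                  = trans (coordinate {ε} {γ} e (fzero , fzero)) (*-identityˡ _)
  at-pivot {ε} {γ} e (fsuc fzero)           = trans (coordinate {ε} {γ} e (fsuc fzero , fzero)) (*-identityˡ _)
  at-pivot {ε} {γ} e (fsuc (fsuc fzero))    = trans (coordinate {ε} {γ} e (fsuc (fsuc fzero) , ε)) (trans (*-congʳ (reflexive (δ-refl ε))) (*-identityˡ _))
  at-pivot {ε} {γ} e (fsuc (fsuc (fsuc j))) = trans (coordinate {ε} {γ} e (fsuc (fsuc (fsuc j)) , fzero)) (*-identityˡ _)

  Y-ind : ∀ ε → Indep (Y ε)
  Y-ind ε γ e j = sym (at-pivot {ε} {γ} e j)

  -- The first two hyperbolic planes contribute - a x a′ and a′ x a, which cancel; this dictates the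
  -- sign in e₃ - e₂ x. In every other plane one of the two coordinates is zero.
  Y-ts : ∀ ε → TotSingular (Y ε)
  Y-ts ε γ = begin
    q v
      ≈⟨ +-cong (Lc² fzero)
      (+-cong (Lc² (fsuc fzero)) (trans (+-cong (Lc² (fsuc (fsuc fzero))) (∑-zero {k} tail)) (+-identityʳ _))) ⟩
    1# * a * (- x * a′) + (1# * a′ * (x * a) + δ ε fzero * g * (δ ε (fsuc fzero) * g))
      ≈⟨ +-cong (trans (*-congʳ (*-identityˡ a)) (trans (*-congˡ (sym (-‿distribˡ-* x a′))) (sym (-‿distribʳ-* a (x * a′)))))
           (trans (+-cong (*-congʳ (*-identityˡ a′)) (third ε)) (+-identityʳ _)) ⟩
    - (a * (x * a′)) + a′ * (x * a)    ≈⟨ +-congˡ (trans (comm a′ (x * a)) (trans (*-congʳ (comm x a)) (*-assoc a x a′))) ⟩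
    - (a * (x * a′)) + a * (x * a′)    ≈⟨ -‿inverseˡ _ ⟩
    0#                                 ∎
    where
    v : Vect (VD n)
    v = lincomb (Y ε) γ
    a a′ g : Carrier
    a = γ fzero
    a′ = γ (fsuc fzero)
    g = γ (fsuc (fsuc fzero))
    Lc : ∀ i → v i ≈ coef ε i * γ (idx i)
    Lc = lincomb-Y ε γ
    Lc² : ∀ i → v (i , fzero) * v (i , fsuc fzero) ≈
                coef ε (i , fzero) * γ (idx (i , fzero)) * (coef ε (i , fsuc fzero) * γ (idx (i , fsuc fzero)))
    Lc² i = *-cong (Lc (i , fzero)) (Lc (i , fsuc fzero))
    tail : ∀ j → v (fsuc (fsuc (fsuc j)) , fzero) * v (fsuc (fsuc (fsuc j)) , fsuc fzero) ≈ 0#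
    tail j = trans (*-congˡ (trans (Lc (fsuc (fsuc (fsuc j)) , fsuc fzero)) (zeroˡ _))) (zeroʳ _)
    third : ∀ ε → δ ε fzero * g * (δ ε (fsuc fzero) * g) ≈ 0#
    third fzero        = trans (*-congˡ (zeroˡ g)) (zeroʳ _)
    third (fsuc fzero) = trans (*-congʳ (zeroˡ g)) (zeroˡ _)

  Indep-tail : ∀ {d I} {B : Frame (suc d) I} → Indep B → Indep (B ∘ fsuc)
  Indep-tail {B = B} ind γ e j = ind (0# ∷ γ) (λ i → trans (+-congʳ (zeroʳ (B fzero i))) (trans (+-identityˡ _) (e i))) (fsuc j)

  drop : ∀ {d I} {B : Frame (suc d) I} {γ v} → γ fzero ≈ 0# → lincomb B γ ≈v v → lincomb (B ∘ fsuc) (γ ∘ fsuc) ≈v v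
  drop {B = B} {γ} h e i = trans (sym (trans (+-congʳ (trans (*-congˡ h) (zeroʳ (B fzero i)))) (+-identityˡ _))) (e i)

  Y-second : ∀ ε (j : Fin (suc k)) → δ ε (fsuc fzero) * δ {n} (fsuc (fsuc fzero)) (fsuc (fsuc j)) ≈ 0# →
             ∀ i → Y ε (fsuc (fsuc j)) (i , fsuc fzero) ≈ 0#
  Y-second ε j _  fzero                  = zeroʳ (- x)
  Y-second ε j _  (fsuc fzero)           = zeroʳ x
  Y-second ε j h  (fsuc (fsuc fzero))    = h
  Y-second ε j _  (fsuc (fsuc (fsuc i))) = zeroˡ _

  both-≈0 : ∀ {ε γ v} → lincomb (Y ε) γ ≈v v → InSpan (X₀ n) v → (γ fzero ≈ 0#) × (γ (fsuc fzero) ≈ 0#)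
  both-≈0 {ε} {γ} {v} e v∈ =
    x*≈0 (trans (sym (coordinate {ε} {γ} e (fsuc fzero , fsuc fzero))) (X₀-second≈0 {n} {v} v∈ (fsuc fzero))) ,
    x*≈0 (trans (sym (-‿involutive _)) (trans (-‿cong (trans (-‿distribˡ-* x _)
      (trans (sym (coordinate {ε} {γ} e (fzero , fsuc fzero))) (X₀-second≈0 {n} {v} v∈ fzero)))) -0#≈0#))

  -- By `both-≈0` the generators e₁ + e₄ x and e₃ - e₂ x drop out of the intersection with X₀, while
  -- e₅, e₇, ... stay: codimension 2 = 1 + 1. In `class⁻` the generator e₆ replaces e₅ and drops out
  -- too, giving codimension 3. This is why ε chooses the class.
  class⁺ : ClassPlus n (Y fzero)
  class⁺ = suc k , (C , C-ind , C⊂ , C-max) , 1 , ℕₚ.m+n∸n≡m 2 k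
    where
    C : Frame (suc k) (VD n)
    C j = Y fzero (fsuc (fsuc j))
    C-ind : Indep C
    C-ind = Indep-tail {B = Y fzero ∘ fsuc} (Indep-tail {B = Y fzero} (Y-ind fzero))
    C⊂ : ∀ j → InSpan (Y fzero) (C j) × InSpan (X₀ n) (C j)
    C⊂ j = gen (Y fzero) (fsuc (fsuc j)) , second≈0-X₀ {n} {C j} (Y-second fzero j (zeroˡ _))
    C-max : ∀ v → InSpan (Y fzero) v → InSpan (X₀ n) v → InSpan C v
    C-max v (γ , e) v∈ = γ ∘ fsuc ∘ fsuc , drop {B = Y fzero ∘ fsuc} {γ ∘ fsuc} (proj₂ zeros) (drop {B = Y fzero} {γ} (proj₁ zeros) e)
      where zeros = both-≈0 {fzero} {γ} {v} e v∈

  class⁻ : ClassMinus n (Y (fsuc fzero))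
  class⁻ = k , (C , C-ind , C⊂ , C-max) , 1 , ℕₚ.m+n∸n≡m 3 k
    where
    ε : Fin 2
    ε = fsuc fzero
    C : Frame k (VD n)
    C j = Y ε (fsuc (fsuc (fsuc j)))
    C-ind : Indep C
    C-ind = Indep-tail {B = Y ε ∘ fsuc ∘ fsuc} (Indep-tail {B = Y ε ∘ fsuc} (Indep-tail {B = Y ε} (Y-ind ε)))
    C⊂ : ∀ j → InSpan (Y ε) (C j) × InSpan (X₀ n) (C j)
    C⊂ j = gen (Y ε) (fsuc (fsuc (fsuc j))) , second≈0-X₀ {n} {C j} (Y-second ε (fsuc j) (zeroʳ _))
    C-max : ∀ v → InSpan (Y ε) v → InSpan (X₀ n) v → InSpan C v
    C-max v (γ , e) v∈ = γ ∘ fsuc ∘ fsuc ∘ fsuc , drop {B = Y ε ∘ fsuc ∘ fsuc} {γ ∘ fsuc ∘ fsuc}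
        (trans (sym (at-pivot {ε} {γ} e (fsuc (fsuc fzero)))) (X₀-second≈0 {n} {v} v∈ (fsuc (fsuc fzero))))
        (drop {B = Y ε ∘ fsuc} {γ ∘ fsuc} (proj₂ zeros) (drop {B = Y ε} {γ} (proj₁ zeros) e))
      where zeros = both-≈0 {ε} {γ} {v} e v∈

  third≈0 : ∀ {γ v} → lincomb (Y fzero) γ ≈v v → InSpan (Y (fsuc fzero)) v → γ (fsuc (fsuc fzero)) ≈ 0#
  third≈0 {γ} e (γ′ , e′) = trans (sym (at-pivot {fzero} {γ} e (fsuc (fsuc fzero))))
    (trans (coordinate {fsuc fzero} {γ′} e′ (fsuc (fsuc fzero) , fzero)) (zeroˡ _))

  -- The two frames differ only in the generator with index 2, e₅ against e₆, and by `third≈0` a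
  -- common vector does not involve it.
  adjacent : IntDim (Y fzero) (Y (fsuc fzero)) (n ∸ 1)
  adjacent = C , C-ind , (λ j → gen (Y fzero) (σ j) , resp-≈ (InSpan-sub (Y (fsuc fzero))) (agree j) (gen (Y (fsuc fzero)) (σ j))) , C-max
    where
    σ : Fin (suc (suc k)) → Fin n
    σ = punchIn (fsuc (fsuc fzero))
    C : Frame (suc (suc k)) (VD n)
    C = Y fzero ∘ σ
    pad : (Fin (suc (suc k)) → Carrier) → Fin n → Carrier
    pad γ = insertAt γ (fsuc (fsuc fzero)) 0#
    lincomb-pad : ∀ γ → lincomb (Y fzero) (pad γ) ≈v lincomb C γ
    lincomb-pad γ i = +-congˡ (+-congˡ (trans (+-congʳ (zeroʳ _)) (+-identityˡ _)))
    C-ind : Indep C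
    C-ind γ e j = trans (sym (reflexive (insertAt-punchIn γ (fsuc (fsuc fzero)) 0# j)))
      (Y-ind fzero (pad γ) (λ i → trans (lincomb-pad γ i) (e i)) (σ j))
    agree : ∀ j → Y (fsuc fzero) (σ j) ≈v Y fzero (σ j)
    agree j (fzero , fzero)                         = refl
    agree j (fzero , fsuc fzero)                    = refl
    agree j (fsuc fzero , fzero)                    = refl
    agree j (fsuc fzero , fsuc fzero)               = refl
    agree j (fsuc (fsuc fzero) , e)                 = trans (trans (*-congˡ (reflexive off)) (zeroʳ _)) (sym (trans (*-congˡ (reflexive off)) (zeroʳ _)))
      where
      off : δ (fsuc (fsuc fzero)) (σ j) ≡ 0#
      off = δ-≢ (Finₚ.punchInᵢ≢i (fsuc (fsuc fzero)) j ∘ ≡.sym)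
    agree j (fsuc (fsuc (fsuc _)) , fzero)          = refl
    agree j (fsuc (fsuc (fsuc _)) , fsuc fzero)     = refl
    C-max : ∀ v → InSpan (Y fzero) v → InSpan (Y (fsuc fzero)) v → InSpan C v
    C-max v (γ , e) v∈ = γ ∘ σ , λ i → trans (+-congˡ (+-congˡ (sym (trans (+-congʳ (trans (*-congˡ (third≈0 {γ} e v∈)) (zeroʳ _))) (+-identityˡ _))))) (e i)

  u w : Vect (VD n)
  u (fzero , fzero) = 1#
  u _               = 0#
  w (fsuc fzero , fsuc _) = 1#
  w _                     = 0#

  u-rat : RatVec u
  u-rat (fzero , fzero)  = 1∈
  u-rat (fzero , fsuc _) = 0∈
  u-rat (fsuc _ , _)     = 0∈

  w-rat : RatVec w
  w-rat (fzero , _)             = 0∈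
  w-rat (fsuc fzero , fzero)    = 0∈
  w-rat (fsuc fzero , fsuc _)   = 1∈
  w-rat (fsuc (fsuc _) , _)     = 0∈

  P : Frame 1 (VD n)
  P _ = u +v w · x

  Y₀≈P : ∀ ε → Y ε fzero ≈v P fzero
  Y₀≈P ε (fzero , fzero)                     = trans (*-identityʳ 1#) (sym (trans (+-congˡ (zeroˡ x)) (+-identityʳ 1#)))
  Y₀≈P ε (fzero , fsuc fzero)                = trans (zeroʳ _) (sym (trans (+-congˡ (zeroˡ x)) (+-identityʳ 0#)))
  Y₀≈P ε (fsuc fzero , fzero)                = trans (zeroʳ _) (sym (trans (+-congˡ (zeroˡ x)) (+-identityʳ 0#)))
  Y₀≈P ε (fsuc fzero , fsuc fzero)           = trans (*-identityʳ x) (sym (trans (+-congˡ (*-identityˡ x)) (+-identityˡ x)))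
  Y₀≈P ε (fsuc (fsuc fzero) , e)             = trans (zeroʳ _) (sym (trans (+-congˡ (zeroˡ x)) (+-identityʳ 0#)))
  Y₀≈P ε (fsuc (fsuc (fsuc _)) , fzero)      = trans (zeroʳ _) (sym (trans (+-congˡ (zeroˡ x)) (+-identityʳ 0#)))
  Y₀≈P ε (fsuc (fsuc (fsuc _)) , fsuc fzero) = trans (zeroʳ _) (sym (trans (+-congˡ (zeroˡ x)) (+-identityʳ 0#)))

  P⊑Y : ∀ ε → P ⊑ Y ε
  P⊑Y ε _ = resp-≈ (InSpan-sub (Y ε)) (Y₀≈P ε) (gen (Y ε) fzero)

  P-ind : Indep P
  P-ind γ e fzero = trans (sym (trans (+-identityʳ _) (trans (*-congʳ (trans (+-congˡ (zeroˡ x)) (+-identityʳ 1#))) (*-identityˡ _)))) (e (fzero , fzero))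

  u∉Y : ∀ ε → ¬ InSpan (Y ε) u
  u∉Y ε (γ , e) = 0≉1 (trans (sym (x*≈0 (sym (coordinate {ε} {γ} e (fsuc fzero , fsuc fzero)))))
    (trans (sym (*-identityˡ _)) (sym (coordinate {ε} {γ} e (fzero , fzero)))))

  P-far : ∀ ε → ¬ RS (InSpan (Y ε)) (P fzero)
  P-far ε h = u∉Y ε (proj₁ (RS-split {u = u} {w = w} (InSpan-sub (Y ε)) u-rat w-rat h))

  Y-irrational : ∀ ε → ¬ RatSpace (Y ε)
  Y-irrational ε r = P-far ε (RatSpace⇒RS {B = Y ε} r (P⊑Y ε fzero))

  x*-in : ∀ {a} → In a → In (x * a) → a ≈ 0#
  x*-in {a} a-in xa-in with dec-ℓ {a ≈ 0#}
  ... | yes h = h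
  ... | no h with inverse a h
  ...   | s , as≈1 , sa≈1 = contradiction (resp (trans (*-assoc x a s) (trans (*-congˡ as≈1) (*-identityʳ x))) (*∈ xa-in (inv∈ a-in as≈1 sa≈1))) x∉

  -- For a rational vector of the intersection, both γ₀ and x γ₀ are rational coordinates, so γ₀ =
  -- 0, and likewise γ₁ = 0; membership in both spaces gives γ₂ = 0. Only n - 3 generators remain,
  -- too few for dimension n - 2.
  no-codim2 : ¬ RatCodim2 (max (Y fzero) (Y-ind fzero) (Y-ts fzero)) (max (Y (fsuc fzero)) (Y-ind (fsuc fzero)) (Y-ts (fsuc fzero)))
  no-codim2 (d , e , U , indU , ratU , U⊑Y⁺ , U⊑Y⁻) = ℕₚ.1+n≰n (ℕₚ.≤-trans (ℕₚ.≤-reflexive (≡.sym (ℕₚ.suc-injective (ℕₚ.suc-injective e))))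
      (steinitz {C = U} {B = λ j → Y fzero (fsuc (fsuc (fsuc j)))} indU λ i → small (ratU i) (U⊑Y⁺ i) (U⊑Y⁻ i)))
    where
    small : ∀ {v} → RatVec v → InSpan (Y fzero) v → InSpan (Y (fsuc fzero)) v → InSpan (λ j → Y fzero (fsuc (fsuc (fsuc j)))) v
    small {v} ratv (γ , e) v∈ = γ ∘ fsuc ∘ fsuc ∘ fsuc , drop {B = Y fzero ∘ fsuc ∘ fsuc} {γ ∘ fsuc ∘ fsuc} (third≈0 {γ} e v∈)
        (drop {B = Y fzero ∘ fsuc} {γ ∘ fsuc} γ₁≈0 (drop {B = Y fzero} {γ} γ₀≈0 e))
      where
      γ₀≈0 : γ fzero ≈ 0#
      γ₀≈0 = x*-in (resp (at-pivot {fzero} {γ} e fzero) (ratv _)) (resp (coordinate {fzero} {γ} e (fsuc fzero , fsuc fzero)) (ratv _))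
      γ₁≈0 : γ (fsuc fzero) ≈ 0#
      γ₁≈0 = x*-in (resp (at-pivot {fzero} {γ} e (fsuc fzero)) (ratv _))
        (resp (trans (-‿distribˡ-* _ _) (trans (*-congʳ (-‿involutive x)) refl)) (-∈ (resp (coordinate {fzero} {γ} e (fzero , fsuc fzero)) (ratv _))))

  flag : Flag (J-D-1pm n)
  flag = elem , inc
    where
    elem : ∀ t → J-D-1pm n t → Elem t
    elem (sing fzero)    (inj₁ ≡.refl)         = P , P-ind , TS-⊑ {B = P} {C = Y fzero} (P⊑Y fzero) (Y-ts fzero) , lift tt
    elem (sing (fsuc _)) (inj₁ ())
    elem (sing _)        (inj₂ (inj₁ ()))
    elem (sing _)        (inj₂ (inj₂ ()))
    elem plus            (inj₂ (inj₁ ≡.refl))  = Y fzero , Y-ind fzero , Y-ts fzero , class⁺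
    elem minus           (inj₂ (inj₂ ≡.refl))  = Y (fsuc fzero) , Y-ind (fsuc fzero) , Y-ts (fsuc fzero) , class⁻
    inc : ∀ s t p q → Geometry.Inc (BuildingD n) (elem s p) (elem t q)
    inc (sing (fsuc _)) _ (inj₁ ()) _
    inc (sing _) _ (inj₂ (inj₁ ())) _
    inc (sing _) _ (inj₂ (inj₂ ())) _
    inc _ (sing (fsuc _)) _ (inj₁ ())
    inc _ (sing _) _ (inj₂ (inj₁ ()))
    inc _ (sing _) _ (inj₂ (inj₂ ()))
    inc (sing fzero) (sing fzero) (inj₁ ≡.refl) (inj₁ ≡.refl) = inj₁ (gen P)
    inc (sing fzero) plus  (inj₁ ≡.refl) (inj₂ (inj₁ ≡.refl)) = inj₁ (P⊑Y fzero)
    inc (sing fzero) minus (inj₁ ≡.refl) (inj₂ (inj₂ ≡.refl)) = inj₁ (P⊑Y (fsuc fzero))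
    inc plus  (sing fzero) (inj₂ (inj₁ ≡.refl)) (inj₁ ≡.refl) = inj₂ (P⊑Y fzero)
    inc minus (sing fzero) (inj₂ (inj₂ ≡.refl)) (inj₁ ≡.refl) = inj₂ (P⊑Y (fsuc fzero))
    inc plus  plus  (inj₂ (inj₁ ≡.refl)) (inj₂ (inj₁ ≡.refl)) = inj₁ (gen (Y fzero))
    inc minus minus (inj₂ (inj₂ ≡.refl)) (inj₂ (inj₂ ≡.refl)) = inj₁ (gen (Y (fsuc fzero)))
    inc plus  minus (inj₂ (inj₁ ≡.refl)) (inj₂ (inj₂ ≡.refl)) = adjacent
    inc minus plus  (inj₂ (inj₂ ≡.refl)) (inj₂ (inj₁ ≡.refl)) = IntDim-sym {X = Y fzero} {Y = Y (fsuc fzero)} adjacent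

  restrict : ∀ {J : DType n → Set} → (∀ t → J t → J-D-1pm n t) → Flag J
  restrict f = (λ t p → proj₁ flag t (f t p)) , λ s t p q → proj₂ flag s t (f s p) (f t q)

theorem3p3 : ∀ {c ℓ p} (K : DivisionRing c ℓ) (K₀ : SubDivisionRing K p) →
    ExcludedMiddle (c ⊔ ℓ ⊔ p) →
    IsProper K₀ →
    let open LinAlg K K₀ in
    (∀ n → 3 ≤ n → GeometryDefs.OmegaProperSubspace (BuildingA n) (J-A-1n n))
    × (IsCommutative K →
        (∀ n → 4 ≤ n → GeometryDefs.OmegaProperSubspace (BuildingD n) (J-D-1m n))
        × (∀ n → 4 ≤ n → GeometryDefs.OmegaProperSubspace (BuildingD n) (J-D-1pm n))
        × (∀ n → 3 ≤ n → GeometryDefs.OmegaProperSubspace (BuildingD n) (J-D-pm n)))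
theorem3p3 K K₀ em (x , x∉) =
  (λ { (suc (suc (suc m))) (s≤s (s≤s (s≤s z≤n))) → ProjectiveSpace.omega K K₀ em m (x , x∉) }) , λ comm →
  (λ { (suc (suc (suc (suc m)))) (s≤s (s≤s (s≤s (s≤s z≤n)))) → point-minus comm m }) ,
  (λ { (suc (suc (suc (suc m)))) (s≤s (s≤s (s≤s (s≤s z≤n)))) → point-ends comm m }) ,
  (λ { (suc (suc (suc k))) (s≤s (s≤s (s≤s z≤n))) → ends comm k })
  where
  open LinAlg K K₀

  point-minus : IsCommutative K → ∀ m → GeometryDefs.OmegaProperSubspace (BuildingD (suc (suc (suc (suc m))))) (J-D-1m _)
  point-minus comm m = line-subspace , F , λ nr → P-far (fsuc fzero) (NearlyRational⇒Near F nr)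
    where
    open PolarSpaceRank4.PointMinus K K₀ em comm m
    open IrrationalFlag K K₀ em comm (suc m) x x∉
    F = restrict {J} λ { t (inj₁ h) → inj₁ h ; t (inj₂ h) → inj₂ (inj₂ h) }

  point-ends : IsCommutative K → ∀ m → GeometryDefs.OmegaProperSubspace (BuildingD (suc (suc (suc (suc m))))) (J-D-1pm _)
  point-ends comm m = line-subspace , flag , λ nr → far (NearlyRational⇒Near flag nr)
    where
    open PolarSpaceRank4.PointEnds K K₀ em comm m
    open IrrationalFlag K K₀ em comm (suc m) x x∉
    open LinearAlgebra K K₀ em using (RS-mono)
    open Lines.PolarLines K K₀ em comm using (near₁)
    far : ¬ Near flag
    far (near₁ (inj₁ r))        = Y-irrational fzero r
    far (near₁ (inj₂ (inj₁ r))) = Y-irrational (fsuc fzero) r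
    far (near₁ (inj₂ (inj₂ r))) = P-far fzero (RS-mono proj₁ r)

  ends : IsCommutative K → ∀ k → GeometryDefs.OmegaProperSubspace (BuildingD (suc (suc (suc k)))) (J-D-pm _)
  ends comm k = line-subspace , F , λ nr → far (NearlyRational⇒Near F nr)
    where
    open PolarSpace.Ends K K₀ em comm k
    open IrrationalFlag K K₀ em comm k x x∉
    open Lines.PolarLines K K₀ em comm using (near₂)
    F = restrict {J} λ t h → inj₂ h
    far : ¬ Near F
    far (near₂ (inj₁ r))        = Y-irrational fzero r
    far (near₂ (inj₂ (inj₁ r))) = Y-irrational (fsuc fzero) r
    far (near₂ (inj₂ (inj₂ c))) = no-codim2 c
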